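{- Let $r,n\ge 1$. If $\chi_\lambda$ is the irreducible character of $G(r,1,n)$ indexed by the $r$-tuple $\lambda$ of partitions $\lambda(0),\ldots,\lambda(r-1)$ (whose sizes add up to $n$), then the Poincaré polynomial $$R_\lambda^*(t)=\frac{1}{\chi_\lambda(1)}\sum_{w\in G(r,1,n)}\chi_\lambda(w)\,t^{\dim(V^w)}$$ factors as $$R_{\lambda}^*(t)=\prod_{ij\in\lambda(0)}(t+r-1+rc_{ij})\prod_{ij\in\lambda(1)}(t-1+rc_{ij})\cdots\prod_{ij\in\lambda(r-1)}(t-1+rc_{ij}),$$ where $ij\in\lambda(k)$ ranges over the boxes of the Young diagram of $\lambda(k)$ and $c_{ij}=j-i$ is the content of the box in row $i$ and column $j$.
   Context: The group $G(r,1,n)$ is the group of all $n\times n$ monomial matrices whose nonzero entries are complex $r$-th roots of unity; it acts on $V=\mathbb{C}^n$ by this standard monomial representation. For $w\in G(r,1,n)$, $V^w=\{v\in V\mid wv=v\}$ is the fixed point space. Each element $g\in G(r,1,n)$ is conjugate by a permutation matrix to a direct sum of blocks $\delta_i\sigma_i$ with $\delta_i$ diagonal and $\sigma_i$ a cyclic permutation matrix; the cycle-size of the block is the order of $\sigma_i$ and its cycle-product is $\det(\delta_i)$. Indexing of characters: let $C_r$ be the cyclic group generated by $\zeta_r=e^{2\pi i/r}$, with irreducible characters $\gamma_0,\dots,\gamma_{r-1}$, $\gamma_k(\zeta_r)=\zeta_r^k$. Let $p_{d,c}$ ($d\ge1$, $c\in C_r$) be algebraically independent indeterminates over $\mathbb{C}$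 and put $p_{d,k}=\frac1r\sum_{c\in C_r}\gamma_k(c)p_{d,c}$. For a partition $\mu$ of $m$, let $\chi_\mu$ be the irreducible character of the symmetric group $S_m$ indexed by $\mu$ (with a single row indexing the trivial character), and let $s_{\mu,k}$ be the Schur function $s_\mu=\frac{1}{m!}\sum_{\sigma\in S_m}\chi_\mu(\sigma)p_\sigma$ expressed in the power sums $p_{d,k}$, where $p_\sigma$ is the product over cycles of $\sigma$ of the power sum of degree equal to the cycle length. For $g\in G(r,1,n)$ let $P_g$ be the product over the blocks of $g$ of $p_{d,c}$, where $d$ is the cycle-size and $c$ the cycle-product. The irreducible characters $\chi_\lambda$ of $G=G(r,1,n)$ are indexed by $r$-tuples $\lambda=(\lambda(0),\dots,\lambda(r-1))$ of partitions of total size $n$ so that $$\prod_{k=0}^{r-1}s_{\lambda(k),k}=\frac{1}{|G|}\sum_{g\in G}\chi_\lambda(g)P_g.$$ Equivalently, with $n_k=|\lambda(k)|$, $\chi_\lambda$ is induced from the block subgroup $\prod_k G(r,1,n_k)$ of the outer product over $k$ of the characters $g\mapsto\chi_{\lambda(k)}(\bar g)\,\gamma_k(\pi(g))$, where $\bar g\in S_{n_k}$ is the underlying permutation and $\pi(g)$ the product of the nonzero entries of $g$. -}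

module Defs where

open import Level using (Level; _⊔_)
open import Algebra.Bundles using (CommutativeRing)
open import Algebra.Apartness.Bundles using (HeytingField; HeytingCommutativeRing)
import Algebra.Definitions.RawMonoid as RawMonoidDefs
import Algebra.Properties.Semiring.Exp as Exp
open import Data.Bool.Base using (if_then_else_)
open import Data.Fin.Base using (Fin; zero; suc; toℕ)
open import Data.Fin.Permutation using (Permutation′; _⟨$⟩ʳ_; _⟨$⟩ˡ_; _∘ₚ_; flip; insert; id)
import Data.Fin.Properties as Fin
open import Data.List.Base as List using (List; []; _∷_; _++_; length; lookup; upTo; allFin)
open import Data.List.Relation.Unary.All using (All)
open import Data.List.Relation.Unary.Linked using (Linked)
open import Data.Nat.Base as ℕ using (ℕ; zero; suc; NonZero)
open import Data.Nat.DivMod using (_mod_)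
import Data.Nat.Properties as ℕ
open import Data.Product.Base using (Σ-syntax; ∃-syntax; _×_; _,_; proj₁; proj₂)
import Data.Vec.Functional as Vector
open import Data.Sum.Function.Propositional using (_⊎-↔_)
open import Function.Construct.Composition using (_↔-∘_)
open import Function.Construct.Symmetry using (↔-sym)
open import Relation.Binary.PropositionalEquality.Core using (_≡_; subst)
open import Relation.Nullary.Decidable using (Dec; does; _×-dec_)
open import Relation.Unary using (Pred)

private
  variable
    m n r : ℕ

------------------------------------------------------------------------
-- Partitions and Young diagrams

record Partition : Set where
  field
    parts      : List ℕ
    decreasing : Linked ℕ._≥_ parts
    positive   : All (0 ℕ.<_) parts

-- Boxes are pairs (row , column), counted from 0 and listed row by row.
Box : Set
Box = ℕ × ℕ

boxesFrom : ℕ → List ℕ → List Box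
boxesFrom i []       = []
boxesFrom i (p ∷ ps) = List.map (i ,_) (upTo p) ++ boxesFrom (suc i) ps

boxes : Partition → List Box
boxes μ = boxesFrom 0 (Partition.parts μ)

size : Partition → ℕ
size μ = length (boxes μ)

record MultiPartition (r n : ℕ) : Set where
  field
    component : Fin r → Partition
    total     : Vector.foldr ℕ._+_ 0 (λ k → size (component k)) ≡ n

------------------------------------------------------------------------
-- Enumeration of finite types.  Permutations and functions are
-- compared pointwise; each of them is listed exactly once.

allΠ : ∀ {a} {A : Fin m → Set a} → (∀ k → List (A k)) → List (∀ k → A k)
allΠ {zero}  xs = (λ ()) ∷ []
allΠ {suc m} xs = List.cartesianProductWith Fin.∀-cons (xs zero) (allΠ (λ k → xs (suc k)))

allPerms : ∀ m → List (Permutation′ m)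
allPerms zero    = id ∷ []
allPerms (suc m) = List.cartesianProductWith (insert zero) (allFin (suc m)) (allPerms m)

------------------------------------------------------------------------
-- Symmetric groups

-- The group law σ τ is "first τ, then σ"; _∘ₚ_ composes in the opposite
-- order.
infixl 7 _·_
_·_ : Permutation′ m → Permutation′ m → Permutation′ m
σ · τ = τ ∘ₚ σ

inversions : Permutation′ m → ℕ
inversions {m} σ = length (List.filter
  (λ (i , j) → (i Fin.<? j) ×-dec ((σ ⟨$⟩ʳ j) Fin.<? (σ ⟨$⟩ʳ i)))
  (List.cartesianProduct (allFin m) (allFin m)))

-- The canonical tableau of shape μ puts i in the i-th box of boxes μ.
module Tableau (μ : Partition) where
  row column : Fin (size μ) → ℕ
  row    i = proj₁ (lookup (boxes μ) i)
  column i = proj₂ (lookup (boxes μ) i)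

  preservesRows? : ∀ (σ : Permutation′ (size μ)) → Dec (∀ i → row (σ ⟨$⟩ʳ i) ≡ row i)
  preservesRows? σ = Fin.all? (λ i → row (σ ⟨$⟩ʳ i) ℕ.≟ row i)

  preservesColumns? : ∀ (σ : Permutation′ (size μ)) → Dec (∀ i → column (σ ⟨$⟩ʳ i) ≡ column i)
  preservesColumns? σ = Fin.all? (λ i → column (σ ⟨$⟩ʳ i) ℕ.≟ column i)

------------------------------------------------------------------------
-- The groups G(r,1,n)

-- (σ , a) stands for the monomial matrix δσ, where δ is the diagonal
-- matrix with entries ζ ^ aᵢ; for ζ a primitive r-th root of unity each
-- matrix of G(r,1,n) is of this form for exactly one (σ , a).  See
-- `matrix` below.
record G (r n : ℕ) : Set where
  constructor _,_
  field
    perm : Permutation′ n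
    exps : Fin n → Fin r

open G public

module _ {r} .{{_ : NonZero r}} where

  1ᴳ : G r n
  1ᴳ = id , λ _ → 0 mod r

  -- (δσ)(δ′σ′) = δ(σδ′σ⁻¹) σσ′
  infixl 7 _∙_
  _∙_ : G r n → G r n → G r n
  (σ , a) ∙ (τ , b) = (σ · τ) , λ i → (toℕ (a i) ℕ.+ toℕ (b (σ ⟨$⟩ˡ i))) mod r

infix 4 _≐_ _≐?_
_≐_ : G r n → G r n → Set
g ≐ h = (∀ i → perm g ⟨$⟩ʳ i ≡ perm h ⟨$⟩ʳ i) × (∀ i → exps g i ≡ exps h i)

_≐?_ : ∀ (g h : G r n) → Dec (g ≐ h)
g ≐? h = Fin.all? (λ i → (perm g ⟨$⟩ʳ i) Fin.≟ (perm h ⟨$⟩ʳ i))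
   ×-dec Fin.all? (λ i → exps g i Fin.≟ exps h i)

allG : ∀ r n → List (G r n)
allG r n = List.cartesianProductWith _,_ (allPerms n) (allΠ (λ _ → allFin r))

infixr 6 _⊕_
_⊕_ : G r m → G r n → G r (m ℕ.+ n)
(σ , a) ⊕ (τ , b) =
  (↔-sym Fin.+↔⊎ ↔-∘ ((σ ⊎-↔ τ) ↔-∘ Fin.+↔⊎)) , (a Vector.++ b)

-- (h₀ , h₁ , …) ↦ h₀ ⊕ h₁ ⊕ …
blockDiagonal : ∀ {s} {ns : Fin s → ℕ} →
                (∀ k → G r (ns k)) → G r (Vector.foldr ℕ._+_ 0 ns)
blockDiagonal {s = zero}  h = id , λ ()
blockDiagonal {s = suc s} h = h zero ⊕ blockDiagonal (λ k → h (suc k))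

-- The direct product of the G(r,1,nₖ) and its embedding as the block
-- subgroup of G(r,1,n), where nₖ is the size of the k-th partition.
module BlockSubgroup (Λ : MultiPartition r n) where
  open MultiPartition Λ

  H : Set
  H = ∀ k → G r (size (component k))

  allH : List H
  allH = allΠ (λ k → allG r (size (component k)))

  ι : H → G r n
  ι h = subst (G r) total (blockDiagonal h)

------------------------------------------------------------------------
-- Linear algebra and characters over a field

-- The complex numbers are not available; K is an arbitrary field of
-- characteristic zero and ζ ∈ K will be a primitive r-th root of unity.
-- Taking K = ℂ and ζ = e^{2πi/r} gives back the classical objects.
module Over {c ℓ₁ ℓ₂} (K : HeytingField c ℓ₁ ℓ₂) where

  open HeytingField K public
    using (Carrier; _≈_; _#_; _+_; _*_; -_; _-_; 0#; 1#; heytingCommutativeRing)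

  commutativeRing : CommutativeRing c ℓ₁
  commutativeRing = HeytingCommutativeRing.commutativeRing heytingCommutativeRing

  open CommutativeRing commutativeRing public
    using (semiring; +-rawMonoid; *-rawMonoid)

  open Exp semiring public using (_^_)
  open RawMonoidDefs +-rawMonoid public using () renaming (_×_ to _×ⁿ_; sum to ∑)
  open RawMonoidDefs *-rawMonoid public using () renaming (sum to ∏)

  CharacteristicZero : Set ℓ₂
  CharacteristicZero = ∀ m → .{{_ : NonZero m}} → (m ×ⁿ 1#) # 0#

  IsPrimitiveRoot : ℕ → Carrier → Set (ℓ₁ ⊔ ℓ₂)
  IsPrimitiveRoot r ζ = (ζ ^ r ≈ 1#) × (∀ k → 0 ℕ.< k → k ℕ.< r → (ζ ^ k) # 1#)

  sumOver : ∀ {a} {A : Set a} → List A → (A → Carrier) → Carrier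
  sumOver xs f = List.foldr (λ x s → f x + s) 0# xs

  indicator : ∀ {p} {P : Set p} → Dec P → Carrier
  indicator P? = if does P? then 1# else 0#

  ----------------------------------------------------------------------
  -- Polynomials in one variable t, as lists of coefficients, constant
  -- term first.  Trailing zeros are allowed.

  Poly : Set c
  Poly = List Carrier

  coeff : Poly → ℕ → Carrier
  coeff []      i       = 0#
  coeff (a ∷ p) zero    = a
  coeff (a ∷ p) (suc i) = coeff p i

  infix 4 _≈ₚ_
  _≈ₚ_ : Poly → Poly → Set ℓ₁
  p ≈ₚ q = ∀ i → coeff p i ≈ coeff q i

  infixl 6 _+ₚ_
  infixl 7 _*ₚ_ _∙ₚ_

  _+ₚ_ : Poly → Poly → Poly
  []      +ₚ q       = q
  p       +ₚ []      = p
  (a ∷ p) +ₚ (b ∷ q) = (a + b) ∷ (p +ₚ q)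

  _∙ₚ_ : Carrier → Poly → Poly
  a ∙ₚ p = List.map (a *_) p

  _*ₚ_ : Poly → Poly → Poly
  []      *ₚ q = []
  (a ∷ p) *ₚ q = (a ∙ₚ q) +ₚ (0# ∷ (p *ₚ q))

  constant : Carrier → Poly
  constant a = a ∷ []

  t : Poly
  t = 0# ∷ 1# ∷ []

  t^_ : ℕ → Poly
  t^ zero  = constant 1#
  t^ suc d = t *ₚ (t^ d)

  ∑ₚ ∏ₚ : List Poly → Poly
  ∑ₚ = List.foldr _+ₚ_ []
  ∏ₚ = List.foldr _*ₚ_ (constant 1#)

  ----------------------------------------------------------------------
  -- Subspaces of K^X

  module _ {X : Set} where

    infix 4 _≋_
    _≋_ : (X → Carrier) → (X → Carrier) → Set ℓ₁
    v ≋ w = ∀ x → v x ≈ w x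

    combination : ∀ {d} → (Fin d → Carrier) → (Fin d → X → Carrier) → X → Carrier
    combination a b x = ∑ (λ i → a i * b i x)

    record Basis {p} (W : Pred (X → Carrier) p) (d : ℕ) : Set (c ⊔ ℓ₁ ⊔ p) where
      field
        vec         : Fin d → X → Carrier
        vec∈        : ∀ i → W (vec i)
        spanning    : ∀ {v} → W v → ∃[ a ] (v ≋ combination a vec)
        independent : ∀ a → combination a vec ≋ (λ _ → 0#) → ∀ i → a i ≈ 0#

    HasDimension : ∀ {p} → Pred (X → Carrier) p → ℕ → Set (c ⊔ ℓ₁ ⊔ p)
    HasDimension W d = Basis W d

    -- χ is the character of the action of S on its invariant
    -- subspace W: χ s is the trace of the matrix of s in a basis of W.
    HasCharacter : ∀ {p} {S : Set} → Pred (X → Carrier) p →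
                   (S → (X → Carrier) → (X → Carrier)) → (S → Carrier) → Set (c ⊔ ℓ₁ ⊔ p)
    HasCharacter W act χ =
      Σ[ d ∈ ℕ ] Σ[ basis ∈ Basis W d ] let open Basis basis in
        ∀ s → Σ[ A ∈ (Fin d → Fin d → Carrier) ]
          (∀ j → act s (vec j) ≋ combination (λ i → A i j) vec) ×
          (χ s ≈ ∑ (λ i → A i i))

  ----------------------------------------------------------------------
  -- Irreducible characters of the symmetric groups

  -- Elements of the group algebra K[S_m], as functions σ ↦ coefficient of σ.
  GroupAlgebra : ℕ → Set c
  GroupAlgebra m = Permutation′ m → Carrier

  infixl 7 _⊛_
  _⊛_ : GroupAlgebra m → GroupAlgebra m → GroupAlgebra m
  (x ⊛ y) π = sumOver (allPerms _) (λ σ → x σ * y (flip σ · π))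

  leftMultiplication : Permutation′ m → GroupAlgebra m → GroupAlgebra m
  leftMultiplication σ x π = x (flip σ · π)

  module _ (μ : Partition) where
    open Tableau μ

    rowSymmetrizer columnAntisymmetrizer youngSymmetrizer : GroupAlgebra (size μ)
    rowSymmetrizer        σ = indicator (preservesRows? σ)
    columnAntisymmetrizer σ = indicator (preservesColumns? σ) * (- 1#) ^ inversions σ
    youngSymmetrizer        = rowSymmetrizer ⊛ columnAntisymmetrizer

    -- The Specht module, realised as the left ideal K[S_m] c_μ generated
    -- by the Young symmetrizer.  One row gives the trivial representation.
    SpechtModule : Pred (GroupAlgebra (size μ)) (c ⊔ ℓ₁)
    SpechtModule x = ∃[ y ] (x ≋ y ⊛ youngSymmetrizer)

    IsSymmetricCharacter : (Permutation′ (size μ) → Carrier) → Set (c ⊔ ℓ₁)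
    IsSymmetricCharacter = HasCharacter SpechtModule leftMultiplication

  ----------------------------------------------------------------------
  -- G(r,1,n) acting on K^n, and its irreducible characters

  module Reflection (r : ℕ) .{{_ : NonZero r}} (ζ : Carrier) where

    matrix : G r n → Fin n → Fin n → Carrier
    matrix g i j = indicator ((perm g ⟨$⟩ʳ j) Fin.≟ i) * ζ ^ toℕ (exps g i)

    FixedSpace : G r n → Pred (Fin n → Carrier) ℓ₁
    FixedSpace w v = (λ i → ∑ (λ j → matrix w i j * v j)) ≋ v

    γ : Fin r → Carrier → Carrier
    γ k z = z ^ toℕ k

    entryProduct : G r n → Carrier
    entryProduct g = ∏ (λ i → ζ ^ toℕ (exps g i))

    -- χ is induced from the character ψ of the block subgroup H:
    --   |H| χ(g) = Σ_{x ∈ G} ψ°(x⁻¹ g x),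
    -- where ψ° is ψ extended by zero outside H.  The condition
    -- x⁻¹ g x = ι h is written without inverses.
    IsInduced : (Λ : MultiPartition r n) →
                (BlockSubgroup.H Λ → Carrier) → (G r n → Carrier) → Set ℓ₁
    IsInduced Λ ψ χ = ∀ g →
      length allH ×ⁿ χ g ≈
        sumOver (allG _ _) (λ x → sumOver allH (λ h →
          indicator ((x ∙ ι h) ≐? (g ∙ x)) * ψ h))
      where open BlockSubgroup Λ

    -- χ is the irreducible character χ_λ: it is induced from the outer
    -- product of the characters g ↦ χ_{λ(k)}(ḡ) γ_k(π(g)).
    IsIrreducibleCharacter : MultiPartition r n → (G r n → Carrier) → Set (c ⊔ ℓ₁)
    IsIrreducibleCharacter Λ χ =
      Σ[ φ ∈ (∀ k → Permutation′ (size (component k)) → Carrier) ]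
        (∀ k → IsSymmetricCharacter (component k) (φ k)) ×
        IsInduced Λ (λ h → ∏ (λ k → φ k (perm (h k)) * γ k (entryProduct (h k)))) χ
      where open MultiPartition Λ

    -- R = χ(1)⁻¹ Σ_w χ(w) t^{dim V^w}
    IsPoincarePolynomial : (G r n → Carrier) → Poly → Set (c ⊔ ℓ₁)
    IsPoincarePolynomial {n} χ R =
      Σ[ dim ∈ (G r n → ℕ) ] (∀ w → HasDimension (FixedSpace w) (dim w)) ×
      Σ[ χ1⁻¹ ∈ Carrier ] (χ1⁻¹ * χ 1ᴳ ≈ 1#) ×
      (R ≈ₚ χ1⁻¹ ∙ₚ ∑ₚ (List.map (λ w → χ w ∙ₚ (t^ dim w)) (allG r n)))

    content : Box → Carrier
    content (i , j) = (j ×ⁿ 1#) - (i ×ⁿ 1#)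

    shift : Fin r → Carrier
    shift zero    = (r ×ⁿ 1#) - 1#
    shift (suc _) = - 1#

    contentProduct : MultiPartition r n → Poly
    contentProduct Λ =
      ∏ₚ (List.tabulate (λ k →
        ∏ₚ (List.map (λ b → t +ₚ constant (shift k + (r ×ⁿ 1#) * content b))
                     (boxes (MultiPartition.component Λ k)))))

{-# OPTIONS --safe #-}
module Submission where

-- Inducing from the block subgroup reduces the claim to one block G(r,1,m) with the character
-- g ↦ φ(ḡ) γₖ(π(g)).  Summing over the diagonal entries above a permutation σ gives the class function
-- ω(σ) = rᵐ⁻ᶜ sᶜ, where c is the number of cycles of σ and s = t + shift k, and it remains to see that
-- ω acts on the Specht module as the scalar ∏ (s + r content).  For f invariant under row permutations on the
-- left and alternating under column permutations on the right, ∑ ω(σ) f(σ) = ∏ (s + r content) f(1): adding the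
-- boxes of the tableau one at a time, ω gains the Jucys–Murphy factor s + r ∑ (i κ), and f((i κ)) is f(1), - f(1)
-- or 0 according to whether i lies in the row of κ, in its column, or in neither.
-- Polynomials are compared by evaluating t at the integers ≥ 2, where s is invertible.

open import Defs
open import Level using (_⊔_)
open import Algebra.Apartness.Bundles using (HeytingField)
open import Algebra.Bundles using (CommutativeRing)
open import Algebra.Definitions using (Invertible)
import Algebra.Properties.CommutativeMonoid.Sum as CommutativeMonoidSum
import Algebra.Properties.CommutativeSemiring.Exp as CommutativeSemiringExp
import Algebra.Properties.Monoid.Mult as MonoidMult
import Algebra.Properties.Ring as RingProperties
import Algebra.Properties.Semiring.Exp as SemiringExp
import Algebra.Properties.Semiring.Sum as SemiringSum
import Algebra.Solver.Ring.NaturalCoefficients.Default as Solver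
open import Data.Bool.Base using (if_then_else_)
open import Data.Empty using (⊥-elim)
open import Data.Fin.Base as Fin using (Fin; zero; suc; toℕ; fromℕ<; _↑ˡ_; _↑ʳ_)
open import Data.Fin.Permutation as Perm
  using (Permutation′; _⟨$⟩ʳ_; _⟨$⟩ˡ_; flip; insert; remove; transpose; lift₀; inverseˡ; inverseʳ; id)
  renaming (_≈_ to _≃_)
import Data.Fin.Properties as Fin
open import Data.List.Base as List using (List; []; _∷_; length; lookup; upTo; allFin; filter)
open import Data.List.Membership.Propositional using (_∈_)
open import Data.List.Membership.Propositional.Properties
  using (∈-allFin; ∈-cartesianProduct⁺; ∈-lookup; ∈-map⁺; ∈-map⁻; ∈-++⁺ˡ; ∈-++⁺ʳ; ∈-++⁻; ∈-upTo⁺; ∈-upTo⁻)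
open import Data.List.Properties using (filter-none; filter-≐; length-tabulate)
open import Data.List.Relation.Unary.All as All using (All)
open import Data.List.Relation.Unary.AllPairs as AllPairs using (AllPairs; _∷_)
import Data.List.Relation.Unary.AllPairs.Properties as AllPairs
open import Data.List.Relation.Unary.Any as Any using (here; there)
open import Data.List.Relation.Unary.Any.Properties using (lookup-index)
open import Data.List.Relation.Unary.Linked.Properties using (Linked⇒AllPairs)
open import Data.List.Relation.Unary.Unique.Propositional using (Unique)
open import Data.List.Relation.Unary.Unique.Propositional.Properties using (allFin⁺; cartesianProduct⁺)
open import Data.Nat.Base as ℕ using (ℕ; zero; suc; NonZero; _∸_)
open import Data.Nat.DivMod
  using (_%_; _/_; _mod_; m%n<n; m%n%n≡m%n; m<n⇒m%n≡m; n%n≡0; m≡m%n+[m/n]*n; %-distribˡ-+)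
import Data.Nat.Properties as ℕ
open import Data.Product.Base using (Σ-syntax; ∃-syntax; _×_; _,_; proj₁; proj₂)
open import Data.Sum.Base using (_⊎_; inj₁; inj₂)
import Data.Vec.Functional as Vector
open import Data.Vec.Functional.Properties using (lookup-++ˡ; lookup-++ʳ)
open import Function.Base using (_∘_)
open import Relation.Binary.Definitions using (tri<; tri≈; tri>)
open import Relation.Binary.PropositionalEquality.Core as ≡ using (_≡_; _≢_)
open import Relation.Binary.PropositionalEquality.Properties using (module ≡-Reasoning)
import Relation.Binary.Reasoning.Setoid as SetoidReasoning
open import Relation.Nullary using (¬_)
open import Relation.Nullary.Decidable using (Dec; does; yes; no; _×-dec_; _→-dec_)
open import Relation.Unary using (Pred; Decidable)

-- Equality in a Heyting field cannot be decided, so all cancellation goes through explicit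
-- inverses, and this shapes the argument. Adding a box yields an identity with a factor s on both
-- sides. As a polynomial in t this s has no inverse, hence the detour through integer values of t.
-- The number of cycles is never defined: ω enters only through ω(1) = sᵐ, its invariance under
-- conjugation, and the effect of cutting a point out of its cycle. Likewise dim Vʷ is computed by
-- deleting one coordinate at a time, and its invariance comes from the uniqueness of dimension.
-- That ω acts by a scalar is seen on the Young symmetrizer, which is an eigenvector; centrality of
-- ω carries this to the left ideal it generates. The invertibility of χ(1) has to be derived: the
-- induction formula is applied a second time with the indicator of the identity in place of the
-- power of t, which gives |H| χ(1) = |G| ∏ degrees. The same factor then cancels from the Poincaré
-- sum.

-- Arithmetic and invertibility in a Heyting field.

module FieldLaws {c ℓ₁ ℓ₂} (K : HeytingField c ℓ₁ ℓ₂) where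
  open Over K
  open CommutativeRing commutativeRing public
    using ( refl; sym; trans; reflexive; setoid; +-cong; +-congˡ; +-congʳ; *-cong; *-congˡ; *-congʳ; -‿cong
          ; +-assoc; +-comm; +-identityˡ; +-identityʳ; *-assoc; *-comm; *-identityˡ; *-identityʳ
          ; distribˡ; distribʳ; zeroˡ; zeroʳ; -‿inverseˡ; -‿inverseʳ; ring; +-monoid; +-commutativeMonoid; *-commutativeMonoid)
  open SetoidReasoning setoid public
  open Solver (CommutativeRing.commutativeSemiring commutativeRing) public using (solve; _:+_; _:*_; _:=_)
  open RingProperties ring public using (-‿distribˡ-*; -‿distribʳ-*; -‿involutive; -0#≈0#; -1*x≈-x)
  open SemiringExp semiring public using (^-congˡ; ^-homo-*; ^-assocʳ)
  private module S = SemiringSum semiring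
  open S public using (*-distribˡ-sum; *-distribʳ-sum)
    renaming (sum-replicate-zero to ∑-zero; sum-replicate to ∑-replicate)
  open CommutativeMonoidSum +-commutativeMonoid public using (∑-distrib-+; ∑-comm; ∑-permute)
  private module P = CommutativeMonoidSum *-commutativeMonoid
  open P public using ()
    renaming (∑-distrib-+ to ∏-distrib-*; ∑-permute to ∏-permute; sum-replicate to ∏-replicate; sum-replicate-zero to ∏-one)
  open MonoidMult +-monoid public using () renaming (×-homo-+ to ×ⁿ-homo-+)

  ∑-cong : ∀ {n} {f g : Fin n → Carrier} → (∀ i → f i ≈ g i) → ∑ f ≈ ∑ g
  ∑-cong = S.sum-cong-≋

  ∏-cong : ∀ {n} {f g : Fin n → Carrier} → (∀ i → f i ≈ g i) → ∏ f ≈ ∏ g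
  ∏-cong = P.sum-cong-≋

  1^n : ∀ n → 1# ^ n ≈ 1#
  1^n zero    = refl
  1^n (suc n) = trans (*-identityˡ _) (1^n n)

  ×ⁿ-* : ∀ n x → n ×ⁿ x ≈ (n ×ⁿ 1#) * x
  ×ⁿ-* zero    x = sym (zeroˡ x)
  ×ⁿ-* (suc n) x = begin
    x + n ×ⁿ x                ≈⟨ +-cong (sym (*-identityˡ x)) (×ⁿ-* n x) ⟩
    1# * x + (n ×ⁿ 1#) * x    ≈⟨ distribʳ x 1# (n ×ⁿ 1#) ⟨
    (1# + n ×ⁿ 1#) * x        ∎

  -- Invertibility replaces being nonzero throughout: cancellation consumes the inverse itself, and
  -- a one-sided one is enough because multiplication commutes.
  Unit : Carrier → Set _
  Unit x = ∃[ y ] (y * x ≈ 1#)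

  unit : ∀ {x} → x # 0# → Unit x
  unit {x} x#0 with HeytingField.#⇒invertible K x#0
  ... | y , yx≈1 , _ = y , trans (*-congˡ (sym x-0≈x)) yx≈1
    where
    x-0≈x : x - 0# ≈ x
    x-0≈x = trans (+-congˡ -0#≈0#) (+-identityʳ x)

  unit-- : ∀ {x y} → x # y → Unit (x - y)
  unit-- x#y with HeytingField.#⇒invertible K x#y
  ... | z , zx≈1 , _ = z , zx≈1

  unit-cong : ∀ {x y} → x ≈ y → Unit x → Unit y
  unit-cong x≈y (z , zx≈1) = z , trans (*-congˡ (sym x≈y)) zx≈1

  unit-* : ∀ {x y} → Unit x → Unit y → Unit (x * y)
  unit-* {x} {y} (x′ , x′x≈1) (y′ , y′y≈1) = x′ * y′ , (begin
    (x′ * y′) * (x * y)  ≈⟨ solve 4 (λ a b c d → (a :* b) :* (c :* d) := (a :* c) :* (b :* d)) refl x′ y′ x y ⟩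
    (x′ * x) * (y′ * y)  ≈⟨ *-cong x′x≈1 y′y≈1 ⟩
    1# * 1#              ≈⟨ *-identityˡ 1# ⟩
    1#                   ∎)

  -- Serves to extract the invertibility of χ(1) from that of the product |H| χ(1).
  unit-*ʳ : ∀ {x y} → Unit (x * y) → Unit y
  unit-*ʳ {x} {y} (z , zxy≈1) = z * x , trans (*-assoc z x y) zxy≈1

  unit-∏ : ∀ {n} {f : Fin n → Carrier} → (∀ i → Unit (f i)) → Unit (∏ f)
  unit-∏ {zero}  u = 1# , *-identityˡ 1#
  unit-∏ {suc n} u = unit-* (u zero) (unit-∏ (u ∘ suc))

  cancelˡ : ∀ {x y z} → Unit x → x * y ≈ x * z → y ≈ z
  cancelˡ {x} {y} {z} (x′ , x′x≈1) xy≈xz = begin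
    y             ≈⟨ *-identityˡ y ⟨
    1# * y        ≈⟨ *-congʳ x′x≈1 ⟨
    x′ * x * y    ≈⟨ *-assoc x′ x y ⟩
    x′ * (x * y)  ≈⟨ *-congˡ xy≈xz ⟩
    x′ * (x * z)  ≈⟨ *-assoc x′ x z ⟨
    x′ * x * z    ≈⟨ *-congʳ x′x≈1 ⟩
    1# * z        ≈⟨ *-identityˡ z ⟩
    z             ∎

  unit⇒zero : ∀ {x y} → Unit x → x * y ≈ 0# → y ≈ 0#
  unit⇒zero u xy≈0 = cancelˡ u (trans xy≈0 (sym (zeroʳ _)))

  x-y≈0⇒x≈y : ∀ {x y} → x - y ≈ 0# → x ≈ y
  x-y≈0⇒x≈y {x} {y} x-y≈0 = begin
    x              ≈⟨ +-identityʳ x ⟨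
    x + 0#         ≈⟨ +-congˡ (-‿inverseˡ y) ⟨
    x + (- y + y)  ≈⟨ +-assoc x (- y) y ⟨
    x - y + y      ≈⟨ +-congʳ x-y≈0 ⟩
    0# + y         ≈⟨ +-identityˡ y ⟩
    y              ∎

-- Finite sums, indicators and enumerations.

module FiniteSums {c ℓ₁ ℓ₂} (K : HeytingField c ℓ₁ ℓ₂) where
  open Over K
  open FieldLaws K

  module _ {A : Set} where

    sumOver-cong : ∀ {f g : A → Carrier} (xs : List A) → (∀ x → f x ≈ g x) → sumOver xs f ≈ sumOver xs g
    sumOver-cong []       f≈g = refl
    sumOver-cong (x ∷ xs) f≈g = +-cong (f≈g x) (sumOver-cong xs f≈g)

    sumOver-zero : ∀ (xs : List A) → sumOver xs (λ _ → 0#) ≈ 0#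
    sumOver-zero []       = refl
    sumOver-zero (x ∷ xs) = trans (+-identityˡ _) (sumOver-zero xs)

    sumOver-+ : ∀ (xs : List A) (f g : A → Carrier) → sumOver xs (λ x → f x + g x) ≈ sumOver xs f + sumOver xs g
    sumOver-+ []       f g = sym (+-identityˡ 0#)
    sumOver-+ (x ∷ xs) f g = trans (+-congˡ (sumOver-+ xs f g))
      (solve 4 (λ a b c d → (a :+ b) :+ (c :+ d) := (a :+ c) :+ (b :+ d)) refl (f x) (g x) _ _)

    sumOver-*ˡ : ∀ a (xs : List A) (f : A → Carrier) → a * sumOver xs f ≈ sumOver xs (λ x → a * f x)
    sumOver-*ˡ a []       f = zeroʳ a
    sumOver-*ˡ a (x ∷ xs) f = trans (distribˡ a _ _) (+-congˡ (sumOver-*ˡ a xs f))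

    sumOver-*ʳ : ∀ a (xs : List A) (f : A → Carrier) → sumOver xs f * a ≈ sumOver xs (λ x → f x * a)
    sumOver-*ʳ a xs f = trans (*-comm _ a) (trans (sumOver-*ˡ a xs f) (sumOver-cong xs (λ x → *-comm a (f x))))

    sumOver-const : ∀ (xs : List A) a → sumOver xs (λ _ → a) ≈ (length xs ×ⁿ 1#) * a
    sumOver-const []       a = sym (zeroˡ a)
    sumOver-const (x ∷ xs) a = trans (+-cong (sym (*-identityˡ a)) (sumOver-const xs a)) (sym (distribʳ a 1# _))

    sumOver-++ : ∀ (xs ys : List A) (f : A → Carrier) → sumOver (xs List.++ ys) f ≈ sumOver xs f + sumOver ys f
    sumOver-++ []       ys f = sym (+-identityˡ _)
    sumOver-++ (x ∷ xs) ys f = trans (+-congˡ (sumOver-++ xs ys f)) (sym (+-assoc _ _ _))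

    sumOver-tabulate : ∀ {n} (g : Fin n → A) (f : A → Carrier) → sumOver (List.tabulate g) f ≡ ∑ (λ i → f (g i))
    sumOver-tabulate {zero}  g f = ≡.refl
    sumOver-tabulate {suc n} g f = ≡.cong (f (g zero) +_) (sumOver-tabulate (g ∘ suc) f)

  sumOver-map : ∀ {A B : Set} (g : A → B) (xs : List A) (f : B → Carrier) → sumOver (List.map g xs) f ≡ sumOver xs (f ∘ g)
  sumOver-map g []       f = ≡.refl
  sumOver-map g (x ∷ xs) f = ≡.cong (f (g x) +_) (sumOver-map g xs f)

  sumOver-cartesianProductWith : ∀ {A B C : Set} (g : A → B → C) xs ys (f : C → Carrier) →
    sumOver (List.cartesianProductWith g xs ys) f ≈ sumOver xs (λ x → sumOver ys (λ y → f (g x y)))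
  sumOver-cartesianProductWith g []       ys f = refl
  sumOver-cartesianProductWith g (x ∷ xs) ys f = begin
    sumOver (List.map (g x) ys List.++ List.cartesianProductWith g xs ys) f
      ≈⟨ sumOver-++ (List.map (g x) ys) _ f ⟩
    sumOver (List.map (g x) ys) f + sumOver (List.cartesianProductWith g xs ys) f
      ≈⟨ +-cong (reflexive (sumOver-map (g x) ys f)) (sumOver-cartesianProductWith g xs ys f) ⟩
    sumOver ys (λ y → f (g x y)) + sumOver xs (λ x → sumOver ys (λ y → f (g x y))) ∎

  module _ {A B : Set} where

    sumOver-swap : ∀ (xs : List A) (ys : List B) (f : A → B → Carrier) →
                   sumOver xs (λ x → sumOver ys (f x)) ≈ sumOver ys (λ y → sumOver xs (λ x → f x y))
    sumOver-swap []       ys f = sym (sumOver-zero ys)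
    sumOver-swap (x ∷ xs) ys f = trans (+-congˡ (sumOver-swap xs ys f)) (sym (sumOver-+ ys _ _))

  ∑-sumOver-swap : ∀ {A : Set} {n} (xs : List A) (f : Fin n → A → Carrier) →
                   ∑ (λ i → sumOver xs (f i)) ≈ sumOver xs (λ x → ∑ (λ i → f i x))
  ∑-sumOver-swap {n = zero}  xs f = sym (sumOver-zero xs)
  ∑-sumOver-swap {n = suc n} xs f = trans (+-congˡ (∑-sumOver-swap xs (f ∘ suc))) (sym (sumOver-+ xs _ _))

  module _ {p} {P : Set p} {x y : Carrier} where

    if-yes : ∀ (P? : Dec P) → P → (if does P? then x else y) ≈ x
    if-yes (yes _) p = refl
    if-yes (no ¬p) p = ⊥-elim (¬p p)

    if-no : ∀ (P? : Dec P) → ¬ P → (if does P? then x else y) ≈ y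
    if-no (yes p) ¬p = ⊥-elim (¬p p)
    if-no (no _)  ¬p = refl

  indicator-yes : ∀ {p} {P : Set p} (P? : Dec P) → P → indicator P? ≈ 1#
  indicator-yes = if-yes

  indicator-no : ∀ {p} {P : Set p} (P? : Dec P) → ¬ P → indicator P? ≈ 0#
  indicator-no = if-no

  indicator-⇔ : ∀ {p q} {P : Set p} {Q : Set q} (P? : Dec P) (Q? : Dec Q) → (P → Q) → (Q → P) →
                indicator P? ≈ indicator Q?
  indicator-⇔ P? (yes q) f g = indicator-yes P? (g q)
  indicator-⇔ P? (no ¬q) f g = indicator-no P? (¬q ∘ f)

  indicator-× : ∀ {p q r} {P : Set p} {Q : Set q} {R : Set r} (P? : Dec P) (Q? : Dec Q) (R? : Dec R) →
                (P → Q × R) → (Q → R → P) → indicator P? ≈ indicator Q? * indicator R?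
  indicator-× P? (yes q) R? f g = trans (indicator-⇔ P? R? (proj₂ ∘ f) (g q)) (sym (*-identityˡ _))
  indicator-× P? (no ¬q) R? f g = trans (indicator-no P? (¬q ∘ proj₁ ∘ f)) (sym (zeroˡ _))

  indicator-cong : ∀ {p} {P : Set p} (P? : Dec P) {x y} → (P → x ≈ y) → indicator P? * x ≈ indicator P? * y
  indicator-cong (yes p) f = *-congˡ (f p)
  indicator-cong (no ¬p) f = trans (zeroˡ _) (sym (zeroˡ _))

  ∑-indicator : ∀ {n} (k : Fin n) → ∑ (λ i → indicator (i Fin.≟ k)) ≈ 1#
  ∑-indicator {suc n} zero = trans
    (+-congˡ (trans (∑-cong {n} (λ i → indicator-no (suc i Fin.≟ zero) λ ())) (∑-zero n))) (+-identityʳ 1#)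
  ∑-indicator {suc n} (suc k) = trans (+-identityˡ _)
    (trans (∑-cong (λ i → indicator-⇔ (suc i Fin.≟ suc k) (i Fin.≟ k) Fin.suc-injective (≡.cong suc))) (∑-indicator k))

  ∑-sift : ∀ {n} (k : Fin n) (f : Fin n → Carrier) → ∑ (λ i → indicator (i Fin.≟ k) * f i) ≈ f k
  ∑-sift k f = begin
    ∑ (λ i → indicator (i Fin.≟ k) * f i)  ≈⟨ ∑-cong (λ i → indicator-cong (i Fin.≟ k) (λ i≡k → reflexive (≡.cong f i≡k))) ⟩
    ∑ (λ i → indicator (i Fin.≟ k) * f k)  ≈⟨ *-distribʳ-sum (f k) (λ i → indicator (i Fin.≟ k)) ⟨
    ∑ (λ i → indicator (i Fin.≟ k)) * f k  ≈⟨ *-congʳ (∑-indicator k) ⟩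
    1# * f k                               ≈⟨ *-identityˡ _ ⟩
    f k                                    ∎

  -- Multiplicity is counted inside K, since a sum of indicators equal to 1 is the only form in
  -- which it is used. The relation is a parameter because functions and permutations are compared
  -- pointwise.
  record Enumerates {A : Set} (_~_ : A → A → Set) (xs : List A) : Set ℓ₁ where
    field
      _~?_ : ∀ x y → Dec (x ~ y)
      once : ∀ y → sumOver xs (λ x → indicator (x ~? y)) ≈ 1#

    -- `P?` may be any decision procedure for being related to `y`, because the condition met in a
    -- sum is often a reformulation, such as x h = w x or fixing every point.
    sift : ∀ {p} {P : A → Set p} (P? : ∀ x → Dec (P x)) y → (∀ {x} → P x → x ~ y) → (∀ {x} → x ~ y → P x) →
           (f : A → Carrier) → (∀ {x} → x ~ y → f x ≈ f y) →
           sumOver xs (λ x → indicator (P? x) * f x) ≈ f y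
    sift P? y to from f f-cong = begin
      sumOver xs (λ x → indicator (P? x) * f x)    ≈⟨ sumOver-cong xs (λ x → *-congʳ (indicator-⇔ (P? x) (x ~? y) to from)) ⟩
      sumOver xs (λ x → indicator (x ~? y) * f x)  ≈⟨ sumOver-cong xs (λ x → indicator-cong (x ~? y) f-cong) ⟩
      sumOver xs (λ x → indicator (x ~? y) * f y)  ≈⟨ sumOver-*ʳ (f y) xs _ ⟨
      sumOver xs (λ x → indicator (x ~? y)) * f y  ≈⟨ *-congʳ (once y) ⟩
      1# * f y                                     ≈⟨ *-identityˡ _ ⟩
      f y                                          ∎

  open Enumerates public

  -- Double counting: f (g x) is expanded as the sum over y of [y ≈′ g x] f y, and after exchanging
  -- the sums each y is met only by x ~ h y. The two implications say that g and h are mutually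
  -- inverse up to the relations.
  reindex : ∀ {A B : Set} {_~_ : A → A → Set} {_≈′_ : B → B → Set} {xs : List A} {ys : List B} →
            Enumerates _~_ xs → Enumerates _≈′_ ys → (g : A → B) (h : B → A) →
            (∀ {x y} → y ≈′ g x → x ~ h y) → (∀ {x y} → x ~ h y → y ≈′ g x) →
            (f : B → Carrier) → (∀ {x y} → x ≈′ y → f x ≈ f y) →
            sumOver xs (f ∘ g) ≈ sumOver ys f
  reindex {xs = xs} {ys} EA EB g h to from f f-cong = begin
    sumOver xs (f ∘ g)
      ≈⟨ sumOver-cong xs (λ x → sift EB (λ y → _~?_ EB y (g x)) (g x) (λ p → p) (λ p → p) f f-cong) ⟨
    sumOver xs (λ x → sumOver ys (λ y → indicator (_~?_ EB y (g x)) * f y))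
      ≈⟨ sumOver-swap xs ys _ ⟩
    sumOver ys (λ y → sumOver xs (λ x → indicator (_~?_ EB y (g x)) * f y))
      ≈⟨ sumOver-cong ys (λ y → sift EA (λ x → _~?_ EB y (g x)) (h y) to from (λ _ → f y) (λ _ → refl)) ⟩
    sumOver ys f ∎

  enumerates-allFin : ∀ n → Enumerates _≡_ (allFin n)
  enumerates-allFin n = record
    { _~?_ = Fin._≟_
    ; once = λ k → trans (reflexive (sumOver-tabulate (λ i → i) (λ i → indicator (i Fin.≟ k)))) (∑-indicator k) }

  -- The indicator of g x y ~ z factors as [x ~ p z] [y ~ q z], so the two counts multiply.
  enumerates-product : ∀ {A B C : Set} {_~A_ : A → A → Set} {_~B_ : B → B → Set} {_~C_ : C → C → Set}
    {xs : List A} {ys : List B} (g : A → B → C) (p : C → A) (q : C → B) →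
    Enumerates _~A_ xs → Enumerates _~B_ ys → (∀ x y → Dec (x ~C y)) →
    (∀ {x y z} → g x y ~C z → (x ~A p z) × (y ~B q z)) → (∀ {x y z} → x ~A p z → y ~B q z → g x y ~C z) →
    Enumerates _~C_ (List.cartesianProductWith g xs ys)
  enumerates-product {xs = xs} {ys} g p q EA EB _~C?_ to from = record
    { _~?_ = _~C?_
    ; once = λ z → begin
      sumOver (List.cartesianProductWith g xs ys) (λ x → indicator (x ~C? z))
        ≈⟨ sumOver-cartesianProductWith g xs ys _ ⟩
      sumOver xs (λ x → sumOver ys (λ y → indicator (g x y ~C? z)))
        ≈⟨ sumOver-cong xs (λ x → sumOver-cong ys (λ y → indicator-× (g x y ~C? z) (_~?_ EA x (p z)) (_~?_ EB y (q z)) to from)) ⟩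
      sumOver xs (λ x → sumOver ys (λ y → indicator (_~?_ EA x (p z)) * indicator (_~?_ EB y (q z))))
        ≈⟨ sumOver-cong xs (λ x → sym (sumOver-*ˡ _ ys _)) ⟩
      sumOver xs (λ x → indicator (_~?_ EA x (p z)) * sumOver ys (λ y → indicator (_~?_ EB y (q z))))
        ≈⟨ sumOver-cong xs (λ x → trans (*-congˡ (once EB (q z))) (*-identityʳ _)) ⟩
      sumOver xs (λ x → indicator (_~?_ EA x (p z)))
        ≈⟨ once EA (p z) ⟩
      1# ∎ }

  enumerates-allΠ : ∀ {n} {A : Fin n → Set} {_~_ : ∀ {k} → A k → A k → Set} {xs : ∀ k → List (A k)} →
    (∀ k → Enumerates (_~_ {k}) (xs k)) → Enumerates (λ f g → ∀ k → f k ~ g k) (allΠ xs)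
  enumerates-allΠ {zero} {A} E = record { _~?_ = λ f g → yes (λ ()) ; once = λ g → +-identityʳ 1# }
  enumerates-allΠ {suc n} {A} {_~_} E = enumerates-product (Fin.∀-cons {P = A}) (λ f → f zero) (λ f k → f (suc k)) (E zero)
    (enumerates-allΠ {n} {A ∘ suc} {λ {k} → _~_ {suc k}} (λ k → E (suc k)))
    (λ f g → Fin.all? (λ k → _~?_ (E k) (f k) (g k)))
    (λ eq → eq zero , λ k → eq (suc k))
    λ eq₀ eq → λ { zero → eq₀ ; (suc k) → eq k }

  -- Distributivity over a whole family. It turns the sum over the block subgroup into a product
  -- with one factor per block.
  sumOver-allΠ-∏ : ∀ {n} {A : Fin n → Set} (xs : ∀ k → List (A k)) (f : ∀ k → A k → Carrier) →
    sumOver (allΠ xs) (λ h → ∏ (λ k → f k (h k))) ≈ ∏ (λ k → sumOver (xs k) (f k))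
  sumOver-allΠ-∏ {zero}  xs f = +-identityʳ 1#
  sumOver-allΠ-∏ {suc n} {A} xs f = begin
    sumOver (allΠ xs) (λ h → ∏ (λ k → f k (h k)))
      ≈⟨ sumOver-cartesianProductWith (Fin.∀-cons {P = A}) (xs zero) (allΠ (xs ∘ suc)) (λ h → ∏ (λ k → f k (h k))) ⟩
    sumOver (xs zero) (λ x → sumOver (allΠ (xs ∘ suc)) (λ h → f zero x * ∏ (λ k → f (suc k) (h k))))
      ≈⟨ sumOver-cong (xs zero) (λ x → trans (sym (sumOver-*ˡ (f zero x) (allΠ (xs ∘ suc)) _))
           (*-congˡ (sumOver-allΠ-∏ (xs ∘ suc) (λ k → f (suc k))))) ⟩
    sumOver (xs zero) (λ x → f zero x * ∏ (λ k → sumOver (xs (suc k)) (f (suc k))))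
      ≈⟨ sumOver-*ʳ _ (xs zero) (f zero) ⟨
    sumOver (xs zero) (f zero) * ∏ (λ k → sumOver (xs (suc k)) (f (suc k))) ∎

-- Permutations and transpositions.

module _ {m : ℕ} where

  perm-injective : ∀ (σ : Permutation′ m) {i j} → σ ⟨$⟩ʳ i ≡ σ ⟨$⟩ʳ j → i ≡ j
  perm-injective σ {i} {j} eq = ≡.trans (≡.sym (inverseˡ σ)) (≡.trans (≡.cong (σ ⟨$⟩ˡ_) eq) (inverseˡ σ))

  ≡⟨$⟩ʳ⇒⟨$⟩ˡ≡ : ∀ (σ : Permutation′ m) {i j} → i ≡ σ ⟨$⟩ʳ j → σ ⟨$⟩ˡ i ≡ j
  ≡⟨$⟩ʳ⇒⟨$⟩ˡ≡ σ eq = ≡.trans (≡.cong (σ ⟨$⟩ˡ_) eq) (inverseˡ σ)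

  flip-cong : ∀ {σ τ : Permutation′ m} → σ ≃ τ → ∀ i → σ ⟨$⟩ˡ i ≡ τ ⟨$⟩ˡ i
  flip-cong {σ} {τ} eq i = ≡⟨$⟩ʳ⇒⟨$⟩ˡ≡ σ (≡.sym (≡.trans (eq (τ ⟨$⟩ˡ i)) (inverseʳ τ)))

  transpose-cases : ∀ (a b i : Fin m) → (i ≡ a × transpose a b ⟨$⟩ʳ i ≡ b) ⊎ (i ≡ b × transpose a b ⟨$⟩ʳ i ≡ a) ⊎
                                        (i ≢ a × i ≢ b × transpose a b ⟨$⟩ʳ i ≡ i)
  transpose-cases a b i with i Fin.≟ a
  ... | yes i≡a = inj₁ (i≡a , ≡.refl)
  ... | no  i≢a with i Fin.≟ b
  ...   | yes i≡b = inj₂ (inj₁ (i≡b , ≡.refl))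
  ...   | no  i≢b = inj₂ (inj₂ (i≢a , i≢b , ≡.refl))

  transpose-left : ∀ (a b : Fin m) → transpose a b ⟨$⟩ʳ a ≡ b
  transpose-left a b with transpose-cases a b a
  ... | inj₁ (_ , eq)                = eq
  ... | inj₂ (inj₁ (a≡b , eq))       = ≡.trans eq a≡b
  ... | inj₂ (inj₂ (a≢a , _ , _))    = ⊥-elim (a≢a ≡.refl)

  transpose-right : ∀ (a b : Fin m) → transpose a b ⟨$⟩ʳ b ≡ a
  transpose-right a b with transpose-cases a b b
  ... | inj₁ (b≡a , eq)              = ≡.trans eq b≡a
  ... | inj₂ (inj₁ (_ , eq))         = eq
  ... | inj₂ (inj₂ (_ , b≢b , _))    = ⊥-elim (b≢b ≡.refl)

  transpose-other : ∀ {a b i : Fin m} → i ≢ a → i ≢ b → transpose a b ⟨$⟩ʳ i ≡ i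
  transpose-other {a} {b} {i} i≢a i≢b with transpose-cases a b i
  ... | inj₁ (i≡a , _)               = ⊥-elim (i≢a i≡a)
  ... | inj₂ (inj₁ (i≡b , _))        = ⊥-elim (i≢b i≡b)
  ... | inj₂ (inj₂ (_ , _ , eq))     = eq

  transpose-involutive : ∀ (a b i : Fin m) → transpose a b ⟨$⟩ʳ (transpose a b ⟨$⟩ʳ i) ≡ i
  transpose-involutive a b i with transpose-cases a b i
  ... | inj₁ (≡.refl , eq)           = ≡.trans (≡.cong (transpose a b ⟨$⟩ʳ_) eq) (transpose-right a b)
  ... | inj₂ (inj₁ (≡.refl , eq))    = ≡.trans (≡.cong (transpose a b ⟨$⟩ʳ_) eq) (transpose-left a b)
  ... | inj₂ (inj₂ (_ , _ , eq))     = ≡.trans (≡.cong (transpose a b ⟨$⟩ʳ_) eq) eq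

  transpose-inverse : ∀ (a b i : Fin m) → transpose a b ⟨$⟩ˡ i ≡ transpose a b ⟨$⟩ʳ i
  transpose-inverse a b i = ≡⟨$⟩ʳ⇒⟨$⟩ˡ≡ (transpose a b) (≡.sym (transpose-involutive a b i))

  transpose-conj : ∀ (π : Permutation′ m) a b i →
                   π ⟨$⟩ʳ (transpose a b ⟨$⟩ʳ i) ≡ transpose (π ⟨$⟩ʳ a) (π ⟨$⟩ʳ b) ⟨$⟩ʳ (π ⟨$⟩ʳ i)
  transpose-conj π a b i with transpose-cases a b i
  ... | inj₁ (≡.refl , eq)           = ≡.trans (≡.cong (π ⟨$⟩ʳ_) eq) (≡.sym (transpose-left (π ⟨$⟩ʳ a) (π ⟨$⟩ʳ b)))
  ... | inj₂ (inj₁ (≡.refl , eq))    = ≡.trans (≡.cong (π ⟨$⟩ʳ_) eq) (≡.sym (transpose-right (π ⟨$⟩ʳ a) (π ⟨$⟩ʳ b)))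
  ... | inj₂ (inj₂ (i≢a , i≢b , eq)) = ≡.trans (≡.cong (π ⟨$⟩ʳ_) eq)
        (≡.sym (transpose-other (i≢a ∘ perm-injective π) (i≢b ∘ perm-injective π)))

  transpose-comm : ∀ (a b i : Fin m) → transpose a b ⟨$⟩ʳ i ≡ transpose b a ⟨$⟩ʳ i
  transpose-comm a b i with transpose-cases a b i
  ... | inj₁ (≡.refl , eq)           = ≡.trans eq (≡.sym (transpose-right b a))
  ... | inj₂ (inj₁ (≡.refl , eq))    = ≡.trans eq (≡.sym (transpose-left b a))
  ... | inj₂ (inj₂ (i≢a , i≢b , eq)) = ≡.trans eq (≡.sym (transpose-other i≢b i≢a))

insert-zero-cong : ∀ {m i j} {σ τ : Permutation′ m} → i ≡ j → σ ≃ τ → insert zero i σ ≃ insert zero j τ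
insert-zero-cong ≡.refl eq zero    = ≡.refl
insert-zero-cong {i = i} ≡.refl eq (suc k) = ≡.cong (Fin.punchIn i) (eq k)

remove-zero-cong : ∀ {m} {σ τ : Permutation′ (suc m)} → σ ≃ τ → remove zero σ ≃ remove zero τ
remove-zero-cong {σ = σ} {τ} eq k = Fin.punchIn-injective (σ ⟨$⟩ʳ zero) _ _ (begin
  Fin.punchIn (σ ⟨$⟩ʳ zero) (remove zero σ ⟨$⟩ʳ k)  ≡⟨ Perm.punchIn-permute σ zero k ⟨
  σ ⟨$⟩ʳ suc k                                    ≡⟨ eq (suc k) ⟩
  τ ⟨$⟩ʳ suc k                                    ≡⟨ Perm.punchIn-permute τ zero k ⟩
  Fin.punchIn (τ ⟨$⟩ʳ zero) (remove zero τ ⟨$⟩ʳ k)  ≡⟨ ≡.cong (λ i → Fin.punchIn i (remove zero τ ⟨$⟩ʳ k)) (≡.sym (eq zero)) ⟩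
  Fin.punchIn (σ ⟨$⟩ʳ zero) (remove zero τ ⟨$⟩ʳ k)  ∎)
  where open ≡-Reasoning

-- Sums over a symmetric group.

module PermutationSums {c ℓ₁ ℓ₂} (K : HeytingField c ℓ₁ ℓ₂) where
  open Over K
  open FieldLaws K
  open FiniteSums K

  enumerates-allPerms : ∀ m → Enumerates _≃_ (allPerms m)
  enumerates-allPerms zero    = record { _~?_ = λ σ τ → yes λ () ; once = λ τ → +-identityʳ 1# }
  enumerates-allPerms (suc m) = enumerates-product (insert zero) (_⟨$⟩ʳ zero) (remove zero)
    (enumerates-allFin (suc m)) (enumerates-allPerms m)
    (λ σ τ → Fin.all? (λ i → (σ ⟨$⟩ʳ i) Fin.≟ (τ ⟨$⟩ʳ i)))
    (λ {i} {π} {σ} eq → eq zero , λ k → ≡.trans (≡.sym (Perm.remove-insert zero i π k)) (remove-zero-cong {σ = insert zero i π} {σ} eq k))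
    λ {i} {π} {σ} eq₀ eq k → ≡.trans (insert-zero-cong {σ = π} {τ = remove zero σ} eq₀ eq k) (Perm.insert-remove zero σ k)

  -- A `Permutation′` carries its inverse and the inverse laws, so agreeing pointwise does not make
  -- two of them equal; every summand that is reindexed has to respect `_≃_`.
  Extensional : ∀ {m} → (Permutation′ m → Carrier) → Set ℓ₁
  Extensional f = ∀ {σ τ} → σ ≃ τ → f σ ≈ f τ

  module _ {m} (ρ : Permutation′ m) (f : Permutation′ m → Carrier) (ext : Extensional f) where

    sumPerms-left : sumOver (allPerms m) (λ σ → f (ρ · σ)) ≈ sumOver (allPerms m) f
    sumPerms-left = reindex (enumerates-allPerms m) (enumerates-allPerms m) (ρ ·_) (flip ρ ·_)
      (λ eq i → ≡.sym (≡⟨$⟩ʳ⇒⟨$⟩ˡ≡ ρ (eq i)))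
      (λ eq i → ≡.sym (≡.trans (≡.cong (ρ ⟨$⟩ʳ_) (eq i)) (inverseʳ ρ)))
      f ext

    sumPerms-right : sumOver (allPerms m) (λ σ → f (σ · ρ)) ≈ sumOver (allPerms m) f
    sumPerms-right = reindex (enumerates-allPerms m) (enumerates-allPerms m) (_· ρ) (_· flip ρ)
      (λ {σ} {τ} eq i → ≡.sym (≡.trans (eq (ρ ⟨$⟩ˡ i)) (≡.cong (σ ⟨$⟩ʳ_) (inverseʳ ρ))))
      (λ {σ} {τ} eq i → ≡.sym (≡.trans (eq (ρ ⟨$⟩ʳ i)) (≡.cong (τ ⟨$⟩ʳ_) (inverseˡ ρ))))
      f ext

-- Inversions and the sign of a permutation.

-- Made for inversions: `P` and `Q` hold for the inverted pairs before and after an adjacent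
-- transposition, and `z` is the single pair gained. As `xs` has no repetitions, it is counted once.
length-filter-insert : ∀ {A : Set} {p q} {P : Pred A p} {Q : Pred A q} (P? : Decidable P) (Q? : Decidable Q) {z : A} →
  (∀ x → Q x → P x ⊎ x ≡ z) → (∀ x → P x → Q x) → Q z → ¬ P z →
  ∀ {xs} → Unique xs → z ∈ xs → length (filter Q? xs) ≡ suc (length (filter P? xs))
length-filter-insert {P = P} {Q} P? Q? {z} QP PQ Qz ¬Pz {x ∷ xs} (x∉xs ∷ _) (here ≡.refl)
  with Q? x | P? x
... | _      | yes Px = ⊥-elim (¬Pz Px)
... | no ¬Qx | no _   = ⊥-elim (¬Qx Qz)
... | yes _  | no _   = ≡.cong suc (same x∉xs)
  where
  same : ∀ {ys} → All (z ≢_) ys → length (filter Q? ys) ≡ length (filter P? ys)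
  same All.[] = ≡.refl
  same {y ∷ _} (z≢y All.∷ z∉ys) with Q? y | P? y
  ... | yes _  | yes _  = ≡.cong suc (same z∉ys)
  ... | no _   | no _   = same z∉ys
  ... | no ¬Qy | yes Py = ⊥-elim (¬Qy (PQ y Py))
  ... | yes Qy | no ¬Py with QP y Qy
  ...   | inj₁ Py  = ⊥-elim (¬Py Py)
  ...   | inj₂ y≡z = ⊥-elim (z≢y (≡.sym y≡z))
length-filter-insert {P = P} {Q} P? Q? {z} QP PQ Qz ¬Pz {x ∷ xs} (x∉xs ∷ uniq) (there z∈xs)
  with Q? x | P? x
... | yes _  | yes _  = ≡.cong suc (length-filter-insert P? Q? QP PQ Qz ¬Pz uniq z∈xs)
... | no _   | no _   = length-filter-insert P? Q? QP PQ Qz ¬Pz uniq z∈xs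
... | no ¬Qx | yes Px = ⊥-elim (¬Qx (PQ x Px))
... | yes Qx | no ¬Px with QP x Qx
...   | inj₁ Px     = ⊥-elim (¬Px Px)
...   | inj₂ ≡.refl = ⊥-elim (All.lookup x∉xs z∈xs ≡.refl)

Inverted : ∀ {m} → Permutation′ m → Pred (Fin m × Fin m) _
Inverted σ (i , j) = i Fin.< j × (σ ⟨$⟩ʳ j) Fin.< (σ ⟨$⟩ʳ i)

inverted? : ∀ {m} (σ : Permutation′ m) → Decidable (Inverted σ)
inverted? σ (i , j) = (i Fin.<? j) ×-dec ((σ ⟨$⟩ʳ j) Fin.<? (σ ⟨$⟩ʳ i))

inversions-cong : ∀ {m} {σ τ : Permutation′ m} → σ ≃ τ → inversions σ ≡ inversions τ
inversions-cong {m} {σ} {τ} eq = ≡.cong length (filter-≐ (inverted? σ) (inverted? τ)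
  ( (λ {(i , j)} (i<j , lt) → i<j , ≡.subst₂ Fin._<_ (eq j) (eq i) lt)
  , (λ {(i , j)} (i<j , lt) → i<j , ≡.subst₂ Fin._<_ (≡.sym (eq j)) (≡.sym (eq i)) lt) )
  (List.cartesianProduct (allFin m) (allFin m)))

module _ {m} {a b : Fin m} (b≡1+a : toℕ b ≡ suc (toℕ a)) where
  private
    s = transpose a b

    <b⇒<a : ∀ {v} → v ≢ a → v Fin.< b → v Fin.< a
    <b⇒<a {v} v≢a v<b = ℕ.≤∧≢⇒< (ℕ.≤-pred (≡.subst (toℕ v ℕ.<_) b≡1+a v<b)) (v≢a ∘ Fin.toℕ-injective)

    a<⇒b< : ∀ {v} → v ≢ b → a Fin.< v → b Fin.< v
    a<⇒b< {v} v≢b a<v = ℕ.≤∧≢⇒< (≡.subst (ℕ._≤ toℕ v) (≡.sym b≡1+a) a<v) (λ eq → v≢b (Fin.toℕ-injective (≡.sym eq)))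

    a<b : a Fin.< b
    a<b = ≡.subst (toℕ a ℕ.<_) (≡.sym b≡1+a) ℕ.≤-refl

  -- No value lies strictly between a and b = a + 1, so exchanging the two can reverse no comparison
  -- except the one between themselves.
  transpose-adjacent-< : ∀ u v → ¬ (u ≡ a × v ≡ b) → v Fin.< u → u ≡ b × v ≡ a ⊎ (s ⟨$⟩ʳ v) Fin.< (s ⟨$⟩ʳ u)
  transpose-adjacent-< u v ¬ab v<u with transpose-cases a b u | transpose-cases a b v
  ... | inj₁ (≡.refl , _)          | inj₁ (≡.refl , _)              = ⊥-elim (ℕ.<-irrefl ≡.refl v<u)
  ... | inj₁ (≡.refl , _)          | inj₂ (inj₁ (≡.refl , _))       = ⊥-elim (¬ab (≡.refl , ≡.refl))
  ... | inj₁ (≡.refl , su)         | inj₂ (inj₂ (v≢a , v≢b , sv))   =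
        inj₂ (≡.subst₂ Fin._<_ (≡.sym sv) (≡.sym su) (ℕ.<-trans v<u a<b))
  ... | inj₂ (inj₁ (≡.refl , su))  | inj₁ (≡.refl , sv)             = inj₁ (≡.refl , ≡.refl)
  ... | inj₂ (inj₁ (≡.refl , su))  | inj₂ (inj₁ (≡.refl , sv))      = ⊥-elim (ℕ.<-irrefl ≡.refl v<u)
  ... | inj₂ (inj₁ (≡.refl , su))  | inj₂ (inj₂ (v≢a , v≢b , sv))   =
        inj₂ (≡.subst₂ Fin._<_ (≡.sym sv) (≡.sym su) (<b⇒<a v≢a v<u))
  ... | inj₂ (inj₂ (u≢a , u≢b , su)) | inj₁ (≡.refl , sv)           =
        inj₂ (≡.subst₂ Fin._<_ (≡.sym sv) (≡.sym su) (a<⇒b< u≢b v<u))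
  ... | inj₂ (inj₂ (u≢a , u≢b , su)) | inj₂ (inj₁ (≡.refl , sv))    =
        inj₂ (≡.subst₂ Fin._<_ (≡.sym sv) (≡.sym su) (ℕ.<-trans a<b v<u))
  ... | inj₂ (inj₂ (_ , _ , su))   | inj₂ (inj₂ (_ , _ , sv))       =
        inj₂ (≡.subst₂ Fin._<_ (≡.sym sv) (≡.sym su) v<u)

  -- Left multiplication by s exchanges the values a and b. Only the pair of positions where they
  -- stand changes status, and it becomes inverted because a stands first.
  inversions-adjacent : ∀ (σ : Permutation′ m) → (σ ⟨$⟩ˡ a) Fin.< (σ ⟨$⟩ˡ b) → inversions (s · σ) ≡ suc (inversions σ)
  inversions-adjacent σ a-before-b = length-filter-insert (inverted? σ) (inverted? (s · σ)) {σ ⟨$⟩ˡ a , σ ⟨$⟩ˡ b}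
    to from
    (a-before-b , ≡.subst₂ Fin._<_ (≡.sym (≡.trans (≡.cong (s ⟨$⟩ʳ_) (inverseʳ σ)) (transpose-right a b)))
                                  (≡.sym (≡.trans (≡.cong (s ⟨$⟩ʳ_) (inverseʳ σ)) (transpose-left a b))) a<b)
    (λ (_ , lt) → ℕ.<-asym a<b (≡.subst₂ Fin._<_ (inverseʳ σ) (inverseʳ σ) lt))
    (cartesianProduct⁺ (allFin⁺ m) (allFin⁺ m)) (∈-cartesianProduct⁺ (∈-allFin _) (∈-allFin _))
    where
    from : ∀ z → Inverted σ z → Inverted (s · σ) z
    from (i , j) (i<j , lt) with transpose-adjacent-< (σ ⟨$⟩ʳ i) (σ ⟨$⟩ʳ j)
      (λ (eq₁ , eq₂) → ℕ.<-asym a<b (≡.subst₂ Fin._<_ eq₂ eq₁ lt)) lt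
    ... | inj₁ (eq₁ , eq₂) = ⊥-elim (ℕ.<-asym i<j
          (≡.subst₂ Fin._<_ (≡⟨$⟩ʳ⇒⟨$⟩ˡ≡ σ (≡.sym eq₂)) (≡⟨$⟩ʳ⇒⟨$⟩ˡ≡ σ (≡.sym eq₁)) a-before-b))
    ... | inj₂ lt′ = i<j , lt′
    to : ∀ z → Inverted (s · σ) z → Inverted σ z ⊎ z ≡ (σ ⟨$⟩ˡ a , σ ⟨$⟩ˡ b)
    to (i , j) (i<j , lt) with (σ ⟨$⟩ʳ i) Fin.≟ a ×-dec (σ ⟨$⟩ʳ j) Fin.≟ b
    ... | yes (eq₁ , eq₂) = inj₂ (≡.cong₂ _,_ (≡.sym (≡⟨$⟩ʳ⇒⟨$⟩ˡ≡ σ (≡.sym eq₁))) (≡.sym (≡⟨$⟩ʳ⇒⟨$⟩ˡ≡ σ (≡.sym eq₂))))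
    -- Since s is its own inverse, the comparison rule applied to the exchanged values leads back to
    -- those of σ.
    ... | no ¬ab with transpose-adjacent-< (s ⟨$⟩ʳ (σ ⟨$⟩ʳ i)) (s ⟨$⟩ʳ (σ ⟨$⟩ʳ j))
          (λ (eq₁ , eq₂) → ℕ.<-asym a<b (≡.subst₂ Fin._<_ eq₂ eq₁ lt)) lt
    ...   | inj₁ (eq₁ , eq₂) = ⊥-elim (¬ab (back (transpose-right a b) eq₁ , back (transpose-left a b) eq₂))
      where
      back : ∀ {u v w} → s ⟨$⟩ʳ v ≡ w → s ⟨$⟩ʳ u ≡ v → u ≡ w
      back {u} sv≡w su≡v = ≡.trans (≡.sym (transpose-involutive a b u)) (≡.trans (≡.cong (s ⟨$⟩ʳ_) su≡v) sv≡w)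
    ...   | inj₂ lt′ = inj₁ (i<j , ≡.subst₂ Fin._<_ (transpose-involutive a b _) (transpose-involutive a b _) lt′)

module Sign {c ℓ₁ ℓ₂} (K : HeytingField c ℓ₁ ℓ₂) where
  open Over K
  open FieldLaws K

  sgn : ∀ {m} → Permutation′ m → Carrier
  sgn σ = (- 1#) ^ inversions σ

  sgn-cong : ∀ {m} {σ τ : Permutation′ m} → σ ≃ τ → sgn σ ≈ sgn τ
  sgn-cong {σ = σ} {τ} eq = reflexive (≡.cong ((- 1#) ^_) (inversions-cong {σ = σ} {τ} eq))

  module _ {m : ℕ} where

    sgn-adjacent : ∀ {a b : Fin m} → toℕ b ≡ suc (toℕ a) → ∀ σ → sgn (transpose a b · σ) ≈ - sgn σ
    sgn-adjacent {a} {b} b≡1+a σ with Fin.<-cmp (σ ⟨$⟩ˡ a) (σ ⟨$⟩ˡ b)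
    ... | tri< lt _ _ = trans (reflexive (≡.cong ((- 1#) ^_) (inversions-adjacent b≡1+a σ lt))) (-1*x≈-x _)
    ... | tri≈ _ eq _ = ⊥-elim (ℕ.1+n≢n (≡.trans (≡.sym b≡1+a)
          (≡.cong toℕ (≡.trans (≡.sym (inverseʳ σ)) (≡.trans (≡.cong (σ ⟨$⟩ʳ_) (≡.sym eq)) (inverseʳ σ))))))
    -- Here b stands first. In (a b) σ the order is the opposite one, so the count applies there,
    -- and (a b) (a b) σ = σ.
    ... | tri> _ _ gt = begin
      sgn (transpose a b · σ)                          ≈⟨ -‿involutive _ ⟨
      - - sgn (transpose a b · σ)                      ≈⟨ -‿cong (-1*x≈-x _) ⟨
      - ((- 1#) * sgn (transpose a b · σ))             ≈⟨ -‿cong (reflexive (≡.cong ((- 1#) ^_) (≡.sym (inversions-adjacent b≡1+a (transpose a b · σ) lt)))) ⟩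
      - sgn (transpose a b · (transpose a b · σ))      ≈⟨ -‿cong (sgn-cong {σ = transpose a b · (transpose a b · σ)} {σ} (λ i → transpose-involutive a b (σ ⟨$⟩ʳ i))) ⟩
      - sgn σ                                          ∎
      where
      lt : ((transpose a b · σ) ⟨$⟩ˡ a) Fin.< ((transpose a b · σ) ⟨$⟩ˡ b)
      lt = ≡.subst₂ (λ x y → (σ ⟨$⟩ˡ x) Fin.< (σ ⟨$⟩ˡ y))
        (≡.sym (≡.trans (transpose-inverse a b a) (transpose-left a b)))
        (≡.sym (≡.trans (transpose-inverse a b b) (transpose-right a b))) gt

    -- Conjugation by the adjacent transposition (b-1 b) brings b one step closer to a.
    sgn-ordered : ∀ d {a b : Fin m} → toℕ b ≡ suc d ℕ.+ toℕ a → ∀ σ → sgn (transpose a b · σ) ≈ - sgn σ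
    sgn-ordered zero    b≡ σ = sgn-adjacent b≡ σ
    sgn-ordered (suc d) {a} {b} b≡ σ = begin
      sgn (transpose a b · σ)      ≈⟨ sgn-cong {σ = transpose a b · σ} {u · (transpose a b′ · (u · σ))} conj ⟩
      sgn (u · (transpose a b′ · (u · σ)))  ≈⟨ sgn-adjacent b≡1+b′ (transpose a b′ · (u · σ)) ⟩
      - sgn (transpose a b′ · (u · σ))      ≈⟨ -‿cong (sgn-ordered d b′≡ (u · σ)) ⟩
      - - sgn (u · σ)                       ≈⟨ -‿involutive _ ⟩
      sgn (u · σ)                           ≈⟨ sgn-adjacent b≡1+b′ σ ⟩
      - sgn σ                               ∎
      where
      lt : suc d ℕ.+ toℕ a ℕ.< m
      lt = ℕ.<-trans (≡.subst (suc d ℕ.+ toℕ a ℕ.<_) (≡.sym b≡) ℕ.≤-refl) (Fin.toℕ<n b)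
      b′ : Fin m
      b′ = fromℕ< lt
      b′≡ : toℕ b′ ≡ suc d ℕ.+ toℕ a
      b′≡ = Fin.toℕ-fromℕ< lt
      b≡1+b′ : toℕ b ≡ suc (toℕ b′)
      b≡1+b′ = ≡.trans b≡ (≡.cong suc (≡.sym b′≡))
      u = transpose b′ b
      a≢b′ : a ≢ b′
      a≢b′ eq = ℕ.m≢1+n+m (toℕ a) (≡.trans (≡.cong toℕ eq) b′≡)
      a≢b : a ≢ b
      a≢b eq = ℕ.m≢1+n+m (toℕ a) (≡.trans (≡.cong toℕ eq) b≡)
      conj : (transpose a b · σ) ≃ (u · (transpose a b′ · (u · σ)))
      conj i = ≡.sym (≡.trans (transpose-conj u a b′ (u ⟨$⟩ʳ (σ ⟨$⟩ʳ i)))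
        (≡.trans (≡.cong₂ (λ x y → transpose x y ⟨$⟩ʳ (u ⟨$⟩ʳ (u ⟨$⟩ʳ (σ ⟨$⟩ʳ i)))) (transpose-other a≢b′ a≢b) (transpose-left b′ b))
          (≡.cong (transpose a b ⟨$⟩ʳ_) (transpose-involutive b′ b (σ ⟨$⟩ʳ i)))))

    sgn-transpose : ∀ {a b : Fin m} → a ≢ b → ∀ σ → sgn (transpose a b · σ) ≈ - sgn σ
    sgn-transpose {a} {b} a≢b σ with Fin.<-cmp a b
    ... | tri< lt _ _ = sgn-ordered (toℕ b ∸ suc (toℕ a)) (≡.sym (≡.trans (≡.sym (ℕ.+-suc _ (toℕ a))) (ℕ.m∸n+n≡m lt))) σ
    ... | tri≈ _ eq _ = ⊥-elim (a≢b eq)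
    ... | tri> _ _ gt = trans
      (sgn-cong {σ = transpose a b · σ} {transpose b a · σ} (λ i → transpose-comm a b (σ ⟨$⟩ʳ i)))
      (sgn-ordered (toℕ a ∸ suc (toℕ b)) (≡.sym (≡.trans (≡.sym (ℕ.+-suc _ (toℕ b))) (ℕ.m∸n+n≡m gt))) σ)

-- Pairing ω with a row-invariant, column-alternating function.

-- These are the only properties of a Young diagram, read row by row, on which the pairing rests.
-- `corner` supplies the box in the row of i and the column of j, already read before j.
record ShapeLabels {m} (row column : Fin m → ℕ) : Set where
  field
    separated : ∀ {i j} → row i ≡ row j → column i ≡ column j → i ≡ j
    corner    : ∀ {i j} → i Fin.< j → row i ≢ row j → ∃[ k ] (k Fin.< j × row k ≡ row i × column k ≡ column j)

module ContentPairing {c ℓ₁ ℓ₂} (K : HeytingField c ℓ₁ ℓ₂) where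
  open Over K
  open FieldLaws K
  open FiniteSums K
  open PermutationSums K

  ∏-single : ∀ {n} (k : Fin n) x → ∏ (λ i → if does (i Fin.≟ k) then x else 1#) ≈ x
  ∏-single {suc n} zero    x = trans (*-congˡ (∏-one n)) (*-identityʳ x)
  ∏-single {suc n} (suc k) x = trans (*-identityˡ _) (∏-single k x)

  x≈-x⇒x≈0 : Unit (1# + 1#) → ∀ {x} → x ≈ - x → x ≈ 0#
  x≈-x⇒x≈0 u {x} x≈-x = unit⇒zero u (begin
    (1# + 1#) * x    ≈⟨ distribʳ x 1# 1# ⟩
    1# * x + 1# * x  ≈⟨ +-cong (*-identityˡ x) (*-identityˡ x) ⟩
    x + x            ≈⟨ +-congˡ x≈-x ⟩
    x - x            ≈⟨ -‿inverseʳ x ⟩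
    0#               ∎)

  module _ {m} (row column : Fin m → ℕ) where

    -- The symmetries required of f shrink with k, because the Jucys-Murphy sum of κ commutes only
    -- with transpositions of labels below κ.
    record InvariantBelow (k : ℕ) (f : Permutation′ m → Carrier) : Set ℓ₁ where
      field
        extensional : Extensional f
        rows    : ∀ {a b} → toℕ a ℕ.< k → toℕ b ℕ.< k → row a ≡ row b →
                  ∀ σ → f (transpose a b · σ) ≈ f σ
        columns : ∀ {a b} → a ≢ b → toℕ a ℕ.< k → toℕ b ℕ.< k → column a ≡ column b →
                  ∀ σ → f (σ · transpose a b) ≈ - f σ

    -- This is the subgroup Sₖ of Sₘ. Keeping all permutations on m labels lets k vary without a
    -- change of type.
    FixesFrom : ℕ → Permutation′ m → Set
    FixesFrom k σ = ∀ i → k ℕ.≤ toℕ i → σ ⟨$⟩ʳ i ≡ i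

    fixesFrom? : ∀ k σ → Dec (FixesFrom k σ)
    fixesFrom? k σ = Fin.all? (λ i → (k ℕ.≤? toℕ i) →-dec ((σ ⟨$⟩ʳ i) Fin.≟ i))

    before : Fin m → Fin m → Carrier
    before κ i = indicator (i Fin.<? κ)

    -- The coefficient that the sum of the (i κ) with i below κ produces at the identity: 1 for each
    -- earlier box in the row of κ, -1 for each in its column. `relativeContent≈` identifies it with
    -- j - i.
    relativeContent : Fin m → Carrier
    relativeContent κ = ∑ (λ i → before κ i * (indicator (row i ℕ.≟ row κ) - indicator (column i ℕ.≟ column κ)))

    module _ (shape : ShapeLabels row column) (2-unit : Unit (1# + 1#)) where
      open ShapeLabels shape

      -- If i shares neither row nor column with κ, the corner box k gives
      -- (i k)(i κ) = (i κ)(k κ) with (i k) a row and (k κ) a column transposition.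
      invariant-transpose : ∀ {f} (κ : Fin m) → InvariantBelow (suc (toℕ κ)) f → ∀ i → i Fin.< κ →
        f (transpose i κ · id) ≈ (indicator (row i ℕ.≟ row κ) - indicator (column i ℕ.≟ column κ)) * f id
      invariant-transpose {f} κ inv i i<κ = cases (row i ℕ.≟ row κ) (column i ℕ.≟ column κ)
        where
        open InvariantBelow inv
        row? = indicator (row i ℕ.≟ row κ)
        column? = indicator (column i ℕ.≟ column κ)
        i<1+κ : toℕ i ℕ.< suc (toℕ κ)
        i<1+κ = ℕ.<-trans i<κ ℕ.≤-refl
        cases : Dec (row i ≡ row κ) → Dec (column i ≡ column κ) → f (transpose i κ · id) ≈ (row? - column?) * f id
        cases (yes same-row) (yes same-col) = ⊥-elim (ℕ.<⇒≢ i<κ (≡.cong toℕ (separated same-row same-col)))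
        cases (yes same-row) (no col≢) = begin
          f (transpose i κ · id)    ≈⟨ rows i<1+κ ℕ.≤-refl same-row id ⟩
          f id                      ≈⟨ *-identityˡ _ ⟨
          1# * f id                 ≈⟨ *-congʳ (trans (+-congˡ -0#≈0#) (+-identityʳ 1#)) ⟨
          (1# - 0#) * f id          ≈⟨ *-congʳ (+-cong (indicator-yes (row i ℕ.≟ row κ) same-row) (-‿cong (indicator-no (column i ℕ.≟ column κ) col≢))) ⟨
          (row? - column?) * f id   ∎
        cases (no row≢) (yes same-col) = begin
          f (transpose i κ · id)    ≈⟨ extensional {transpose i κ · id} {id · transpose i κ} (λ _ → ≡.refl) ⟩
          f (id · transpose i κ)    ≈⟨ columns (ℕ.<⇒≢ i<κ ∘ ≡.cong toℕ) i<1+κ ℕ.≤-refl same-col id ⟩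
          - f id                    ≈⟨ -1*x≈-x _ ⟨
          - 1# * f id               ≈⟨ *-congʳ (+-identityˡ _) ⟨
          (0# - 1#) * f id          ≈⟨ *-congʳ (+-cong (indicator-no (row i ℕ.≟ row κ) row≢) (-‿cong (indicator-yes (column i ℕ.≟ column κ) same-col))) ⟨
          (row? - column?) * f id   ∎
        cases (no row≢) (no col≢) with corner i<κ row≢
        ... | k , k<κ , same-row , same-col = begin
          f (transpose i κ · id)    ≈⟨ x≈-x⇒x≈0 2-unit antisymmetric ⟩
          0#                        ≈⟨ trans (*-congʳ (-‿inverseʳ 0#)) (zeroˡ _) ⟨
          (0# - 0#) * f id          ≈⟨ *-congʳ (+-cong (indicator-no (row i ℕ.≟ row κ) row≢) (-‿cong (indicator-no (column i ℕ.≟ column κ) col≢))) ⟨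
          (row? - column?) * f id   ∎
          where
          i≢k : i ≢ k
          i≢k ≡.refl = col≢ same-col
          i≢κ : i ≢ κ
          i≢κ ≡.refl = row≢ ≡.refl
          k≢κ : k ≢ κ
          k≢κ ≡.refl = row≢ (≡.sym same-row)
          swap-sides : (transpose i k · (transpose i κ · id)) ≃ ((transpose i κ · id) · transpose k κ)
          swap-sides x = ≡.trans (transpose-conj (transpose i k) i κ x) (≡.trans
            (≡.cong₂ (λ y z → transpose y z ⟨$⟩ʳ (transpose i k ⟨$⟩ʳ x)) (transpose-left i k) (transpose-other (i≢κ ∘ ≡.sym) (k≢κ ∘ ≡.sym)))
            (≡.sym (≡.trans (transpose-conj (transpose i κ) k κ x) (≡.trans
              (≡.cong₂ (λ y z → transpose y z ⟨$⟩ʳ (transpose i κ ⟨$⟩ʳ x)) (transpose-other (i≢k ∘ ≡.sym) k≢κ) (transpose-right i κ))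
              (braid x)))))
            where
            braid : ∀ x → transpose k i ⟨$⟩ʳ (transpose i κ ⟨$⟩ʳ x) ≡ transpose k κ ⟨$⟩ʳ (transpose i k ⟨$⟩ʳ x)
            braid x = ≡.trans (transpose-conj (transpose k i) i κ x) (≡.trans
              (≡.cong₂ (λ y z → transpose y z ⟨$⟩ʳ (transpose k i ⟨$⟩ʳ x)) (transpose-right k i) (transpose-other (k≢κ ∘ ≡.sym) (i≢κ ∘ ≡.sym)))
              (≡.cong (transpose k κ ⟨$⟩ʳ_) (transpose-comm k i x)))
          antisymmetric : f (transpose i κ · id) ≈ - f (transpose i κ · id)
          antisymmetric = begin
            f (transpose i κ · id)
              ≈⟨ rows i<1+κ (ℕ.<-trans k<κ ℕ.≤-refl) (≡.sym same-row) _ ⟨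
            f (transpose i k · (transpose i κ · id))
              ≈⟨ extensional {transpose i k · (transpose i κ · id)} {(transpose i κ · id) · transpose k κ} swap-sides ⟩
            f ((transpose i κ · id) · transpose k κ)
              ≈⟨ columns k≢κ (ℕ.<-trans k<κ ℕ.≤-refl) ℕ.≤-refl same-col _ ⟩
            - f (transpose i κ · id) ∎

      -- These conditions stand for ω(σ) = rᵐ⁻ᶜ sᶜ. Multiplying by (p σ(p)) on the left makes p a
      -- fixed point and closes up the rest of its cycle, so c grows by one and a factor r is traded
      -- for a factor s. With s on the left and r on the right no division occurs.
      module _ (s r : Carrier) (s-unit : Unit s)
               (ω : Permutation′ m → Carrier) (ω-ext : Extensional ω) (ω-id : ω id ≈ s ^ m)
               (ω-cut : ∀ σ p → σ ⟨$⟩ʳ p ≢ p → s * ω σ ≈ r * ω (transpose p (σ ⟨$⟩ʳ p) · σ)) where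

        weight : ℕ → Permutation′ m → Carrier
        weight k σ = indicator (fixesFrom? k σ) * ω σ

        weight-ext : ∀ k → Extensional (weight k)
        weight-ext k {σ} {τ} eq = *-cong (indicator-⇔ (fixesFrom? k σ) (fixesFrom? k τ)
          (λ fix i k≤i → ≡.trans (≡.sym (eq i)) (fix i k≤i)) (λ fix i k≤i → ≡.trans (eq i) (fix i k≤i)))
          (ω-ext {σ} {τ} eq)

        weight-yes : ∀ {k σ} → FixesFrom k σ → weight k σ ≈ ω σ
        weight-yes {k} {σ} fix = trans (*-congʳ (indicator-yes (fixesFrom? k σ) fix)) (*-identityˡ _)

        weight-no : ∀ {k σ} → ¬ FixesFrom k σ → weight k σ ≈ 0#
        weight-no {k} {σ} ¬fix = trans (*-congʳ (indicator-no (fixesFrom? k σ) ¬fix)) (zeroˡ _)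

        -- With k = toℕ κ, a σ in Sₖ₊₁ that fixes κ is already in Sₖ; otherwise (i κ) σ lies in Sₖ
        -- for i = σ(κ) alone, and there the cut rule applies with p = κ. In the group algebra, s
        -- times ω on Sₖ₊₁ is ω on Sₖ multiplied by s plus r times the Jucys-Murphy element of κ.
        weight-suc : ∀ κ σ → s * weight (suc (toℕ κ)) σ ≈
          s * weight (toℕ κ) σ + r * ∑ (λ i → before κ i * weight (toℕ κ) (transpose i κ · σ))
        weight-suc κ σ = cases (fixesFrom? (suc k) σ)
          where
          k = toℕ κ
          rest : ∀ i → Carrier
          rest i = before κ i * weight k (transpose i κ · σ)

          rest-no : (∀ i → i Fin.< κ → ¬ FixesFrom k (transpose i κ · σ)) → r * ∑ rest ≈ 0#
          rest-no ¬fix = trans (*-congˡ (trans (∑-cong (λ i → trans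
            (indicator-cong (i Fin.<? κ) (λ i<κ → weight-no {σ = transpose i κ · σ} (¬fix i i<κ))) (zeroʳ _))) (∑-zero m))) (zeroʳ r)

          mono : FixesFrom k σ → FixesFrom (suc k) σ
          mono fix i k<i = fix i (ℕ.<⇒≤ k<i)

          extend : σ ⟨$⟩ʳ κ ≡ κ → FixesFrom (suc k) σ → FixesFrom k σ
          extend σκ≡κ fix i k≤i with i Fin.≟ κ
          ... | yes ≡.refl = σκ≡κ
          ... | no  i≢κ    = fix i (ℕ.≤∧≢⇒< k≤i (λ eq → i≢κ (Fin.toℕ-injective (≡.sym eq))))

          untwist : ∀ {i j} → transpose i κ ⟨$⟩ʳ (σ ⟨$⟩ʳ j) ≡ j → σ ⟨$⟩ʳ j ≡ transpose i κ ⟨$⟩ʳ j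
          untwist {i} eq = ≡.trans (≡.sym (transpose-involutive i κ _)) (≡.cong (transpose i κ ⟨$⟩ʳ_) eq)

          cases : Dec (FixesFrom (suc k) σ) → s * weight (suc k) σ ≈ s * weight k σ + r * ∑ rest
          cases (no ¬fix) = begin
            s * weight (suc k) σ           ≈⟨ trans (*-congˡ (weight-no {σ = σ} ¬fix)) (zeroʳ s) ⟩
            0#                             ≈⟨ +-identityˡ 0# ⟨
            0# + 0#                        ≈⟨ +-cong (trans (*-congˡ (weight-no {σ = σ} (¬fix ∘ mono))) (zeroʳ s)) (rest-no twisted) ⟨
            s * weight k σ + r * ∑ rest    ∎
            where
            twisted : ∀ i → i Fin.< κ → ¬ FixesFrom k (transpose i κ · σ)
            twisted i i<κ fix = ¬fix (λ j k<j → ≡.trans (untwist (fix j (ℕ.<⇒≤ k<j)))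
              (transpose-other (ℕ.<⇒≢ (ℕ.<-trans i<κ k<j) ∘ ≡.cong toℕ ∘ ≡.sym) (ℕ.<⇒≢ k<j ∘ ≡.cong toℕ ∘ ≡.sym)))
          cases (yes fix) with (σ ⟨$⟩ʳ κ) Fin.≟ κ
          ... | yes σκ≡κ = begin
            s * weight (suc k) σ           ≈⟨ *-congˡ (trans (weight-yes {σ = σ} fix) (sym (weight-yes {σ = σ} (extend σκ≡κ fix)))) ⟩
            s * weight k σ                 ≈⟨ +-identityʳ _ ⟨
            s * weight k σ + 0#            ≈⟨ +-congˡ (rest-no (λ i i<κ fix′ → ℕ.<⇒≢ i<κ (≡.cong toℕ
                                                (≡.trans (≡.sym (transpose-right i κ)) (≡.trans (≡.cong (transpose i κ ⟨$⟩ʳ_) (≡.sym σκ≡κ)) (fix′ κ ℕ.≤-refl)))))) ⟨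
            s * weight k σ + r * ∑ rest    ∎
          ... | no  σκ≢κ = begin
            s * weight (suc k) σ           ≈⟨ *-congˡ (weight-yes {σ = σ} fix) ⟩
            s * ω σ                        ≈⟨ ω-cut σ κ σκ≢κ ⟩
            r * ω (transpose κ i₀ · σ)     ≈⟨ *-congˡ (ω-ext {transpose κ i₀ · σ} {transpose i₀ κ · σ} (λ i → transpose-comm κ i₀ (σ ⟨$⟩ʳ i))) ⟩
            r * ω (transpose i₀ κ · σ)     ≈⟨ *-congˡ (∑-sift i₀ (λ _ → ω (transpose i₀ κ · σ))) ⟨
            r * ∑ (λ i → indicator (i Fin.≟ i₀) * ω (transpose i₀ κ · σ))
                                           ≈⟨ *-congˡ (∑-cong select) ⟩
            r * ∑ rest                     ≈⟨ +-identityˡ _ ⟨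
            0# + r * ∑ rest                ≈⟨ +-congʳ (trans (*-congˡ (weight-no {σ = σ} (λ fix′ → σκ≢κ (fix′ κ ℕ.≤-refl)))) (zeroʳ s)) ⟨
            s * weight k σ + r * ∑ rest    ∎
            where
            i₀ = σ ⟨$⟩ʳ κ
            i₀<κ : i₀ Fin.< κ
            i₀<κ with i₀ Fin.<? κ
            ... | yes lt = lt
            -- An image other than κ and not below it would lie above κ and be fixed by σ, so κ and
            -- i₀ would have the same image.
            ... | no ¬lt = ⊥-elim (σκ≢κ (perm-injective σ
                  (fix i₀ (ℕ.≤∧≢⇒< (ℕ.≮⇒≥ ¬lt) (λ eq → σκ≢κ (Fin.toℕ-injective (≡.sym eq)))))))
            fix-cut : FixesFrom k (transpose i₀ κ · σ)
            fix-cut j k≤j with j Fin.≟ κ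
            ... | yes ≡.refl = transpose-left i₀ κ
            ... | no  j≢κ    = ≡.trans (≡.cong (transpose i₀ κ ⟨$⟩ʳ_) (fix j k<j))
                  (transpose-other (ℕ.<⇒≢ (ℕ.<-trans i₀<κ k<j) ∘ ≡.cong toℕ ∘ ≡.sym) j≢κ)
              where
              k<j : k ℕ.< toℕ j
              k<j = ℕ.≤∧≢⇒< k≤j (λ eq → j≢κ (Fin.toℕ-injective (≡.sym eq)))
            select : ∀ i → indicator (i Fin.≟ i₀) * ω (transpose i₀ κ · σ) ≈ rest i
            select i with i Fin.≟ i₀
            ... | yes ≡.refl = *-cong (sym (indicator-yes (i₀ Fin.<? κ) i₀<κ)) (sym (weight-yes {σ = transpose i₀ κ · σ} fix-cut))
            ... | no  i≢i₀   = trans (zeroˡ _) (sym (trans (*-congˡ (weight-no {σ = transpose i κ · σ}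
                  (λ fix′ → i≢i₀ (≡.sym (≡.trans (untwist (fix′ κ ℕ.≤-refl)) (transpose-right i κ)))))) (zeroʳ _)))

        -- The factor of `weight-suc` moved to the other side of the pairing; it keeps its form
        -- because each (i κ) is an involution.
        spread : Fin m → (Permutation′ m → Carrier) → Permutation′ m → Carrier
        spread κ f σ = s * f σ + r * ∑ (λ i → before κ i * f (transpose i κ · σ))

        -- Conjugation by (a b) with a and b below κ permutes the (i κ) among themselves, so a row
        -- transposition only rearranges the summands. Column transpositions act on the right and
        -- commute with left multiplication by (i κ).
        spread-invariant : ∀ κ {f} → InvariantBelow (suc (toℕ κ)) f → InvariantBelow (toℕ κ) (spread κ f)
        spread-invariant κ {f} inv = record
          { extensional = λ {σ} {τ} eq → +-cong (*-congˡ (extensional {σ} {τ} eq)) (*-congˡ (∑-cong (λ i →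
              *-congˡ (extensional {transpose i κ · σ} {transpose i κ · τ} (λ j → ≡.cong (transpose i κ ⟨$⟩ʳ_) (eq j))))))
          ; rows = λ {a} {b} a<κ b<κ same σ → +-cong (*-congˡ (rows (ℕ.<-trans a<κ ℕ.≤-refl) (ℕ.<-trans b<κ ℕ.≤-refl) same σ)) (*-congˡ (begin
              ∑ (λ i → before κ i * f (transpose i κ · (transpose a b · σ)))
                ≈⟨ ∑-cong (λ i → *-cong (before-permuted a<κ b<κ i) (trans
                     (extensional {transpose i κ · (transpose a b · σ)} {transpose a b · (transpose (transpose a b ⟨$⟩ʳ i) κ · σ)} (commute a<κ b<κ σ i))
                     (rows (ℕ.<-trans a<κ ℕ.≤-refl) (ℕ.<-trans b<κ ℕ.≤-refl) same _))) ⟩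
              ∑ (λ i → before κ (transpose a b ⟨$⟩ʳ i) * f (transpose (transpose a b ⟨$⟩ʳ i) κ · σ))
                ≈⟨ ∑-permute (λ i → before κ i * f (transpose i κ · σ)) (transpose a b) ⟨
              ∑ (λ i → before κ i * f (transpose i κ · σ)) ∎))
          ; columns = λ {a} {b} a≢b a<κ b<κ same σ →
              let neg = columns a≢b (ℕ.<-trans a<κ ℕ.≤-refl) (ℕ.<-trans b<κ ℕ.≤-refl) same in begin
              s * f (σ · transpose a b) + r * ∑ (λ i → before κ i * f (transpose i κ · (σ · transpose a b)))
                ≈⟨ +-cong (*-congˡ (neg σ)) (*-congˡ (∑-cong (λ i → *-congˡ (trans
                     (extensional {transpose i κ · (σ · transpose a b)} {(transpose i κ · σ) · transpose a b} (λ _ → ≡.refl))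
                     (trans (neg (transpose i κ · σ)) (sym (-1*x≈-x _))))))) ⟩
              s * - f σ + r * ∑ (λ i → before κ i * (- 1# * f (transpose i κ · σ)))
                ≈⟨ +-cong (*-congˡ (sym (-1*x≈-x _))) (*-congˡ (trans
                     (∑-cong (λ i → solve 3 (λ x y z → x :* (y :* z) := y :* (x :* z)) refl (before κ i) (- 1#) _))
                     (sym (*-distribˡ-sum (- 1#) (λ i → before κ i * f (transpose i κ · σ)))))) ⟩
              s * (- 1# * f σ) + r * (- 1# * ∑ (λ i → before κ i * f (transpose i κ · σ)))
                ≈⟨ solve 5 (λ s r z x y → s :* (z :* x) :+ r :* (z :* y) := z :* (s :* x :+ r :* y)) refl s r (- 1#) (f σ) _ ⟩
              - 1# * spread κ f σ
                ≈⟨ -1*x≈-x _ ⟩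
              - spread κ f σ ∎ }
          where
          open InvariantBelow inv
          bounded : ∀ {a b : Fin m} → a Fin.< κ → b Fin.< κ → ∀ i → i Fin.< κ → (transpose a b ⟨$⟩ʳ i) Fin.< κ
          bounded {a} {b} a<κ b<κ i i<κ with transpose-cases a b i
          ... | inj₁ (_ , eq)             = ≡.subst (Fin._< κ) (≡.sym eq) b<κ
          ... | inj₂ (inj₁ (_ , eq))      = ≡.subst (Fin._< κ) (≡.sym eq) a<κ
          ... | inj₂ (inj₂ (_ , _ , eq))  = ≡.subst (Fin._< κ) (≡.sym eq) i<κ
          before-permuted : ∀ {a b : Fin m} → a Fin.< κ → b Fin.< κ → ∀ i → before κ i ≈ before κ (transpose a b ⟨$⟩ʳ i)
          before-permuted {a} {b} a<κ b<κ i = indicator-⇔ (i Fin.<? κ) ((transpose a b ⟨$⟩ʳ i) Fin.<? κ) (bounded a<κ b<κ i)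
            (λ lt → ≡.subst (Fin._< κ) (transpose-involutive a b i) (bounded a<κ b<κ _ lt))
          commute : ∀ {a b : Fin m} → a Fin.< κ → b Fin.< κ → ∀ σ i →
            (transpose i κ · (transpose a b · σ)) ≃ (transpose a b · (transpose (transpose a b ⟨$⟩ʳ i) κ · σ))
          commute {a} {b} a<κ b<κ σ i j = ≡.sym (≡.trans (transpose-conj (transpose a b) (transpose a b ⟨$⟩ʳ i) κ (σ ⟨$⟩ʳ j))
            (≡.cong₂ (λ x y → transpose x y ⟨$⟩ʳ (transpose a b ⟨$⟩ʳ (σ ⟨$⟩ʳ j))) (transpose-involutive a b i)
              (transpose-other (ℕ.<⇒≢ a<κ ∘ ≡.cong toℕ ∘ ≡.sym) (ℕ.<⇒≢ b<κ ∘ ≡.cong toℕ ∘ ≡.sym))))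

        spread-id : ∀ κ {f} → InvariantBelow (suc (toℕ κ)) f → spread κ f id ≈ (s + r * relativeContent κ) * f id
        spread-id κ {f} inv = begin
          s * f id + r * ∑ (λ i → before κ i * f (transpose i κ · id))
            ≈⟨ +-congˡ (*-congˡ (∑-cong (λ i → trans (indicator-cong (i Fin.<? κ) (invariant-transpose κ inv i)) (sym (*-assoc _ _ _))))) ⟩
          s * f id + r * ∑ (λ i → before κ i * (indicator (row i ℕ.≟ row κ) - indicator (column i ℕ.≟ column κ)) * f id)
            ≈⟨ +-congˡ (*-congˡ (*-distribʳ-sum (f id) (λ i → before κ i * (indicator (row i ℕ.≟ row κ) - indicator (column i ℕ.≟ column κ))))) ⟨
          s * f id + r * (relativeContent κ * f id)
            ≈⟨ solve 4 (λ s r x y → s :* y :+ r :* (x :* y) := (s :+ r :* x) :* y) refl s r (relativeContent κ) (f id) ⟩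
          (s + r * relativeContent κ) * f id ∎

        pair : ℕ → (Permutation′ m → Carrier) → Carrier
        pair k f = sumOver (allPerms m) (λ σ → weight k σ * f σ)

        -- `weight-suc` is inserted into the pairing, and the substitution σ ↦ (i κ) σ then moves
        -- each transposition onto f.
        pair-suc : ∀ κ {f} → Extensional f → s * pair (suc (toℕ κ)) f ≈ pair (toℕ κ) (spread κ f)
        pair-suc κ {f} f-ext = begin
          s * pair (suc k) f
            ≈⟨ sumOver-*ˡ s Ps _ ⟩
          sumOver Ps (λ σ → s * (weight (suc k) σ * f σ))
            ≈⟨ sumOver-cong Ps (λ σ → trans (sym (*-assoc _ _ _)) (trans (*-congʳ (weight-suc κ σ)) (trans (distribʳ _ _ _)
                 (+-cong (solve 3 (λ x y z → x :* y :* z := y :* (x :* z)) refl s _ _)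
                   (trans (*-assoc _ _ _) (*-congˡ (trans (*-distribʳ-sum (f σ) (λ i → before κ i * weight k (transpose i κ · σ)))
                      (∑-cong {m} (λ i → *-assoc _ _ _))))))))) ⟩
          sumOver Ps (λ σ → weight k σ * (s * f σ) + r * ∑ (λ i → before κ i * (weight k (transpose i κ · σ) * f σ)))
            ≈⟨ trans (sumOver-+ Ps _ _) (+-congˡ (trans (sym (sumOver-*ˡ r Ps _)) (*-congˡ (trans
                 (sym (∑-sumOver-swap Ps (λ i σ → before κ i * (weight k (transpose i κ · σ) * f σ))))
                 (∑-cong (λ i → trans (sym (sumOver-*ˡ (before κ i) Ps _)) (*-congˡ (shift-left i)))))))) ⟩
          sumOver Ps (λ σ → weight k σ * (s * f σ)) + r * ∑ (λ i → before κ i * sumOver Ps (λ σ → weight k σ * f (transpose i κ · σ)))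
            ≈⟨ +-congˡ (*-congˡ (trans (∑-cong (λ i → trans (sumOver-*ˡ (before κ i) Ps _)
                 (sumOver-cong Ps (λ σ → solve 3 (λ x y z → x :* (y :* z) := y :* (x :* z)) refl (before κ i) (weight k σ) _))))
                 (trans (∑-sumOver-swap Ps (λ i σ → weight k σ * (before κ i * f (transpose i κ · σ)))) (sumOver-cong Ps (λ σ → sym (*-distribˡ-sum (weight k σ) (λ i → before κ i * f (transpose i κ · σ)))))))) ⟩
          sumOver Ps (λ σ → weight k σ * (s * f σ)) + r * sumOver Ps (λ σ → weight k σ * ∑ (λ i → before κ i * f (transpose i κ · σ)))
            ≈⟨ trans (+-congˡ (sumOver-*ˡ r Ps _)) (trans (sym (sumOver-+ Ps _ _)) (sumOver-cong Ps (λ σ →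
                 solve 4 (λ w r x y → w :* x :+ r :* (w :* y) := w :* (x :+ r :* y)) refl (weight k σ) r (s * f σ) _))) ⟩
          pair k (spread κ f) ∎
          where
          k = toℕ κ
          Ps = allPerms m
          shift-left : ∀ i → sumOver Ps (λ σ → weight k (transpose i κ · σ) * f σ) ≈ sumOver Ps (λ σ → weight k σ * f (transpose i κ · σ))
          shift-left i = trans
            (sumOver-cong Ps (λ σ → *-congˡ (f-ext {σ} {transpose i κ · (transpose i κ · σ)} (λ j → ≡.sym (transpose-involutive i κ (σ ⟨$⟩ʳ j))))))
            (sumPerms-left (transpose i κ) (λ σ → weight k σ * f (transpose i κ · σ))
              (λ {σ} {τ} eq → *-cong (weight-ext k {σ} {τ} eq)
                (f-ext {transpose i κ · σ} {transpose i κ · τ} (λ j → ≡.cong (transpose i κ ⟨$⟩ʳ_) (eq j)))))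

        -- Always a product of m factors: boxes not yet reached contribute s, so the start is sᵐ =
        -- ω(1) and each step exchanges one factor s for s + r content.
        partialProduct : ℕ → Carrier
        partialProduct k = ∏ {m} (λ i → if does (toℕ i ℕ.<? k) then s + r * relativeContent i else s)

        partialProduct-suc : ∀ κ → s * partialProduct (suc (toℕ κ)) ≈ partialProduct (toℕ κ) * (s + r * relativeContent κ)
        partialProduct-suc κ = begin
          s * partialProduct (suc k)
            ≈⟨ *-congʳ (∏-single κ s) ⟨
          ∏ (λ i → if does (i Fin.≟ κ) then s else 1#) * partialProduct (suc k)
            ≈⟨ ∏-distrib-* (λ i → if does (i Fin.≟ κ) then s else 1#) (λ i → if does (toℕ i ℕ.<? suc k) then value i else s) ⟨
          ∏ (λ i → (if does (i Fin.≟ κ) then s else 1#) * (if does (toℕ i ℕ.<? suc k) then value i else s))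
            ≈⟨ ∏-cong exchange ⟩
          ∏ (λ i → (if does (toℕ i ℕ.<? k) then value i else s) * (if does (i Fin.≟ κ) then value κ else 1#))
            ≈⟨ ∏-distrib-* (λ i → if does (toℕ i ℕ.<? k) then value i else s) (λ i → if does (i Fin.≟ κ) then value κ else 1#) ⟩
          partialProduct k * ∏ (λ i → if does (i Fin.≟ κ) then value κ else 1#)
            ≈⟨ *-congˡ (∏-single κ (value κ)) ⟩
          partialProduct k * value κ ∎
          where
          k = toℕ κ
          value : Fin m → Carrier
          value i = s + r * relativeContent i
          exchange : ∀ i → (if does (i Fin.≟ κ) then s else 1#) * (if does (toℕ i ℕ.<? suc k) then value i else s) ≈
                           (if does (toℕ i ℕ.<? k) then value i else s) * (if does (i Fin.≟ κ) then value κ else 1#)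
          exchange i with i Fin.≟ κ
          ... | yes ≡.refl = *-cong (sym (if-no (k ℕ.<? k) (ℕ.<-irrefl ≡.refl))) (if-yes (k ℕ.<? suc k) ℕ.≤-refl)
          ... | no  i≢κ with toℕ i ℕ.<? k
          ...   | yes lt = trans (*-congˡ (trans (if-yes (toℕ i ℕ.<? suc k) (ℕ.<-trans lt ℕ.≤-refl)) (sym (if-yes (toℕ i ℕ.<? k) lt)))) (*-comm _ _)
          ...   | no ¬lt = trans (*-congˡ (trans (if-no (toℕ i ℕ.<? suc k) (λ lt → ¬lt (ℕ.≤∧≢⇒< (ℕ.≤-pred lt) (i≢κ ∘ Fin.toℕ-injective))))
                  (sym (if-no (toℕ i ℕ.<? k) ¬lt)))) (*-comm _ _)

        -- Induction on the number of boxes read. Each step leaves a factor s on both sides, and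
        -- cancelling it is what requires s to be invertible.
        pair-partial : ∀ k → k ℕ.≤ m → ∀ {f} → InvariantBelow k f → pair k f ≈ partialProduct k * f id
        -- For k = 0 all labels are fixed, so the sum reduces to its term at the identity.
        pair-partial zero _ {f} inv = begin
          pair 0 f
            ≈⟨ sumOver-cong Ps (λ σ → *-assoc _ _ _) ⟩
          sumOver Ps (λ σ → indicator (fixesFrom? 0 σ) * (ω σ * f σ))
            ≈⟨ sift (enumerates-allPerms m) (fixesFrom? 0) id (λ fix i → fix i ℕ.z≤n) (λ eq i _ → eq i) (λ σ → ω σ * f σ)
                 (λ {σ} eq → *-cong (ω-ext {σ} {id} eq) (extensional {σ} {id} eq)) ⟩
          ω id * f id
            ≈⟨ *-congʳ (trans ω-id (sym (∏-replicate m))) ⟩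
          partialProduct 0 * f id ∎
          where
          Ps = allPerms m
          open InvariantBelow inv
        pair-partial (suc k) k<m {f} inv = cancelˡ s-unit (begin
          s * pair (suc k) f                   ≈⟨ ≡.subst (λ k → s * pair (suc k) f ≈ pair k (spread κ f)) κ≡k (pair-suc κ (InvariantBelow.extensional inv)) ⟩
          pair k (spread κ f)                  ≈⟨ pair-partial k (ℕ.<⇒≤ k<m) (≡.subst (λ k → InvariantBelow k (spread κ f)) κ≡k (spread-invariant κ inv′)) ⟩
          partialProduct k * spread κ f id     ≈⟨ *-congˡ (spread-id κ inv′) ⟩
          partialProduct k * ((s + r * relativeContent κ) * f id)  ≈⟨ *-assoc _ _ _ ⟨
          partialProduct k * (s + r * relativeContent κ) * f id
            ≈⟨ *-congʳ (≡.subst (λ k → s * partialProduct (suc k) ≈ partialProduct k * (s + r * relativeContent κ)) κ≡k (partialProduct-suc κ)) ⟨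
          s * partialProduct (suc k) * f id    ≈⟨ *-assoc _ _ _ ⟩
          s * (partialProduct (suc k) * f id)  ∎)
          where
          κ : Fin m
          κ = fromℕ< k<m
          κ≡k : toℕ κ ≡ k
          κ≡k = Fin.toℕ-fromℕ< k<m
          inv′ : InvariantBelow (suc (toℕ κ)) f
          inv′ = ≡.subst (λ k → InvariantBelow (suc k) f) (≡.sym κ≡k) inv

        pairing : ∀ {f} → InvariantBelow m f →
                  sumOver (allPerms m) (λ σ → ω σ * f σ) ≈ ∏ (λ i → s + r * relativeContent i) * f id
        pairing {f} inv = begin
          sumOver (allPerms m) (λ σ → ω σ * f σ)
            ≈⟨ sumOver-cong (allPerms m) (λ σ → *-congʳ (weight-yes {m} {σ} (λ i m≤i → ⊥-elim (ℕ.<⇒≱ (Fin.toℕ<n i) m≤i)))) ⟨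
          pair m f
            ≈⟨ pair-partial m ℕ.≤-refl inv ⟩
          partialProduct m * f id
            ≈⟨ *-congʳ (∏-cong full) ⟩
          ∏ (λ i → s + r * relativeContent i) * f id ∎
          where
          full : ∀ i → (if does (toℕ i ℕ.<? m) then s + r * relativeContent i else s) ≈ s + r * relativeContent i
          full i = if-yes (toℕ i ℕ.<? m) (Fin.toℕ<n i)

-- Young diagrams, reading order and contents.

_≺_ : Box → Box → Set
(x , y) ≺ (x′ , y′) = x ℕ.< x′ ⊎ (x ≡ x′ × y ℕ.< y′)

≺-irrefl : ∀ {b} → ¬ b ≺ b
≺-irrefl (inj₁ lt)       = ℕ.<-irrefl ≡.refl lt
≺-irrefl (inj₂ (_ , lt)) = ℕ.<-irrefl ≡.refl lt

≺-asym : ∀ {b b′} → b ≺ b′ → ¬ b′ ≺ b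
≺-asym (inj₁ lt)            (inj₁ gt)            = ℕ.<-asym lt gt
≺-asym (inj₁ lt)            (inj₂ (≡.refl , _))  = ℕ.<-irrefl ≡.refl lt
≺-asym (inj₂ (≡.refl , _))  (inj₁ gt)            = ℕ.<-irrefl ≡.refl gt
≺-asym (inj₂ (≡.refl , lt)) (inj₂ (_ , gt))      = ℕ.<-asym lt gt

AllPairs-lookup : ∀ {A : Set} {R : A → A → Set} {xs : List A} → AllPairs R xs →
                  ∀ {i j} → i Fin.< j → R (lookup xs i) (lookup xs j)
AllPairs-lookup (Rx AllPairs.∷ _)   {zero}  {suc j} _   = All.lookup Rx (∈-lookup j)
AllPairs-lookup (_ AllPairs.∷ Rxs)  {suc i} {suc j} i<j = AllPairs-lookup Rxs (ℕ.≤-pred i<j)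

-- The second component bounds the column by any upper bound of the parts; with decreasing parts it
-- places the column of a lower box inside an upper row.
∈-boxesFrom⁻ : ∀ i ps {x y} → (x , y) ∈ boxesFrom i ps → i ℕ.≤ x × (∀ {p} → All (ℕ._≤ p) ps → y ℕ.< p)
∈-boxesFrom⁻ i (p ∷ ps) b∈ with ∈-++⁻ (List.map (i ,_) (upTo p)) b∈
... | inj₁ b∈row with ∈-map⁻ (i ,_) b∈row
...   | _ , y∈ , ≡.refl = ℕ.≤-refl , λ { (p≤ All.∷ _) → ℕ.<-≤-trans (∈-upTo⁻ y∈) p≤ }
∈-boxesFrom⁻ i (p ∷ ps) b∈ | inj₂ b∈rest with ∈-boxesFrom⁻ (suc i) ps b∈rest
... | i<x , bound = ℕ.<⇒≤ i<x , λ { (_ All.∷ ps≤) → bound ps≤ }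

≺-boxesFrom : ∀ i ps → AllPairs _≺_ (boxesFrom i ps)
≺-boxesFrom i []       = AllPairs.[]
≺-boxesFrom i (p ∷ ps) = AllPairs.++⁺
  (AllPairs.map⁺ (AllPairs.applyUpTo⁺₁ (λ y → y) p (λ y<y′ _ → inj₂ (≡.refl , y<y′))))
  (≺-boxesFrom (suc i) ps)
  (All.tabulate λ b∈row → All.tabulate λ b′∈rest → earlier b∈row b′∈rest)
  where
  earlier : ∀ {b b′} → b ∈ List.map (i ,_) (upTo p) → b′ ∈ boxesFrom (suc i) ps → b ≺ b′
  earlier b∈row b′∈rest with ∈-map⁻ (i ,_) b∈row
  ... | _ , _ , ≡.refl = inj₁ (proj₁ (∈-boxesFrom⁻ (suc i) ps b′∈rest))

-- Moving left stays within a row, and moving up reaches a row at least as long because the parts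
-- decrease.
∈-boxesFrom-below : ∀ i ps → AllPairs ℕ._≥_ ps → ∀ {x y x′ y′} → (x , y) ∈ boxesFrom i ps →
                    i ℕ.≤ x′ → x′ ℕ.≤ x → y′ ℕ.≤ y → (x′ , y′) ∈ boxesFrom i ps
∈-boxesFrom-below i (p ∷ ps) (p≥ps AllPairs.∷ dec) {y = y} {x′} {y′} b∈ i≤x′ x′≤x y′≤y
  with ∈-++⁻ (List.map (i ,_) (upTo p)) b∈ | i ℕ.≟ x′
... | inj₁ b∈row  | yes ≡.refl with ∈-map⁻ (i ,_) b∈row
...   | _ , y∈ , ≡.refl = ∈-++⁺ˡ (∈-map⁺ (i ,_) (∈-upTo⁺ (ℕ.≤-<-trans y′≤y (∈-upTo⁻ y∈))))
∈-boxesFrom-below i (p ∷ ps) _ b∈ i≤x′ x′≤x y′≤y | inj₁ b∈row  | no i≢x′ with ∈-map⁻ (i ,_) b∈row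
...   | _ , _ , ≡.refl = ⊥-elim (i≢x′ (ℕ.≤-antisym i≤x′ x′≤x))
∈-boxesFrom-below i (p ∷ ps) (p≥ps AllPairs.∷ _) b∈ _ _ y′≤y | inj₂ b∈rest | yes ≡.refl =
  ∈-++⁺ˡ (∈-map⁺ (i ,_) (∈-upTo⁺ (ℕ.≤-<-trans y′≤y (proj₂ (∈-boxesFrom⁻ (suc i) ps b∈rest) p≥ps))))
∈-boxesFrom-below i (p ∷ ps) (_ AllPairs.∷ dec) b∈ i≤x′ x′≤x y′≤y | inj₂ b∈rest | no i≢x′ =
  ∈-++⁺ʳ (List.map (i ,_) (upTo p)) (∈-boxesFrom-below (suc i) ps dec b∈rest (ℕ.≤∧≢⇒< i≤x′ i≢x′) x′≤x y′≤y)

module _ (μ : Partition) where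
  open Tableau μ
  open Partition μ

  index-≺ : ∀ {i j : Fin (size μ)} → i Fin.< j → (row i , column i) ≺ (row j , column j)
  index-≺ = AllPairs-lookup (≺-boxesFrom 0 parts)

  -- The list of boxes increases strictly in reading order, so by trichotomy of the indices a
  -- comparison of boxes determines that of their positions.
  ≺-index : ∀ {i j : Fin (size μ)} → (row i , column i) ≺ (row j , column j) → i Fin.< j
  ≺-index {i} {j} lt with Fin.<-cmp i j
  ... | tri< i<j _ _      = i<j
  ... | tri≈ _ ≡.refl _   = ⊥-elim (≺-irrefl lt)
  ... | tri> _ _ i>j      = ⊥-elim (≺-asym lt (index-≺ i>j))

  boxAt : ∀ (κ : Fin (size μ)) {x y} → x ℕ.≤ row κ → y ℕ.≤ column κ → ∃[ i ] (row i ≡ x × column i ≡ y)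
  boxAt κ x≤ y≤ = Any.index b∈ , ≡.cong proj₁ (≡.sym (lookup-index b∈)) , ≡.cong proj₂ (≡.sym (lookup-index b∈))
    where
    b∈ = ∈-boxesFrom-below 0 parts (Linked⇒AllPairs (λ p≥q q≥r → ℕ.≤-trans q≥r p≥q) decreasing) (∈-lookup κ) ℕ.z≤n x≤ y≤

  tableau-separated : ∀ {i j} → row i ≡ row j → column i ≡ column j → i ≡ j
  tableau-separated {i} {j} same-row same-col with Fin.<-cmp i j
  ... | tri≈ _ eq _  = eq
  ... | tri< i<j _ _ = ⊥-elim (≺-irrefl (≡.subst (_≺ _) (≡.cong₂ _,_ same-row same-col) (index-≺ i<j)))
  ... | tri> _ _ i>j = ⊥-elim (≺-irrefl (≡.subst (_ ≺_) (≡.cong₂ _,_ same-row same-col) (index-≺ i>j)))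

  row-mono : ∀ {i j} → i Fin.< j → row i ℕ.≤ row j
  row-mono i<j with index-≺ i<j
  ... | inj₁ lt       = ℕ.<⇒≤ lt
  ... | inj₂ (eq , _) = ℕ.≤-reflexive eq

  -- The row of i is strictly above that of j, so the corner box, which lies in the row of i,
  -- precedes j in reading order.
  tableau-shape : ShapeLabels row column
  tableau-shape = record
    { separated = tableau-separated
    ; corner    = corner }
    where
    corner : ∀ {i j} → i Fin.< j → row i ≢ row j → ∃[ k ] (k Fin.< j × row k ≡ row i × column k ≡ column j)
    corner {i} {j} i<j row≢ with boxAt j (row-mono i<j) (ℕ.≤-refl {column j})
    ... | k , same-row , same-col = k , ≺-index (inj₁ (≡.subst (ℕ._< row j) (≡.sym same-row) (ℕ.≤∧≢⇒< (row-mono i<j) row≢))) , same-row , same-col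

module TableauContents {c ℓ₁ ℓ₂} (K : HeytingField c ℓ₁ ℓ₂) where
  open Over K
  open FieldLaws K
  open FiniteSums K
  open ContentPairing K

  -- Each indicator is expanded as the sum over x of [i = e x]; after exchanging the sums every x
  -- contributes 1.
  ∑-count : ∀ {m n} {P : Fin m → Set} (P? : ∀ i → Dec (P i)) (e : Fin n → Fin m) →
            (∀ {x y} → e x ≡ e y → x ≡ y) → (∀ x → P (e x)) → (∀ {i} → P i → ∃[ x ] (e x ≡ i)) →
            ∑ (λ i → indicator (P? i)) ≈ n ×ⁿ 1#
  ∑-count {m} {n} {P} P? e injective into onto = begin
    ∑ (λ i → indicator (P? i))                          ≈⟨ ∑-cong split ⟩
    ∑ {m} (λ i → ∑ {n} (λ x → indicator (i Fin.≟ e x))) ≈⟨ ∑-comm (λ i x → indicator (i Fin.≟ e x)) ⟩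
    ∑ {n} (λ x → ∑ {m} (λ i → indicator (i Fin.≟ e x))) ≈⟨ ∑-cong (λ x → ∑-indicator (e x)) ⟩
    ∑ {n} (λ x → 1#)                                    ≈⟨ ∑-replicate n ⟩
    n ×ⁿ 1#                                             ∎
    where
    split : ∀ i → indicator (P? i) ≈ ∑ {n} (λ x → indicator (i Fin.≟ e x))
    split i with P? i
    ... | no ¬Pi = sym (trans (∑-cong (λ x → indicator-no (i Fin.≟ e x) (λ eq → ¬Pi (≡.subst P (≡.sym eq) (into x))))) (∑-zero n))
    ... | yes Pi with onto Pi
    ...   | x₀ , ≡.refl = sym (trans
            (∑-cong (λ x → indicator-⇔ (e x₀ Fin.≟ e x) (x Fin.≟ x₀) (≡.sym ∘ injective) (≡.cong e ∘ ≡.sym))) (∑-indicator x₀))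

  module _ (μ : Partition) where
    open Tableau μ

    -- In reading order, the earlier boxes in the row of κ are those to its left, and the earlier
    -- boxes in its column are those above it. The former are indexed by the smaller columns, the
    -- latter by the smaller rows.
    relativeContent≈ : ∀ κ → relativeContent row column κ ≈ (column κ ×ⁿ 1#) - (row κ ×ⁿ 1#)
    relativeContent≈ κ = begin
      relativeContent row column κ
        ≈⟨ ∑-cong (λ i → trans (distribˡ (indicator (i Fin.<? κ)) _ _) (+-cong
             (sym (indicator-× (i Fin.<? κ ×-dec row i ℕ.≟ row κ) (i Fin.<? κ) (row i ℕ.≟ row κ) (λ p → p) _,_))
             (trans (trans (sym (-‿distribʳ-* _ _)) (-‿cong (sym (indicator-× (i Fin.<? κ ×-dec column i ℕ.≟ column κ) (i Fin.<? κ) (column i ℕ.≟ column κ) (λ p → p) _,_))))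
               (sym (-1*x≈-x _))))) ⟩
      ∑ (λ i → in-row i + - 1# * in-column i)
        ≈⟨ ∑-distrib-+ in-row (λ i → - 1# * in-column i) ⟩
      ∑ in-row + ∑ (λ i → - 1# * in-column i)
        ≈⟨ +-congˡ (trans (sym (*-distribˡ-sum (- 1#) in-column)) (-1*x≈-x _)) ⟩
      ∑ in-row - ∑ in-column
        ≈⟨ +-cong
             (∑-count (λ i → i Fin.<? κ ×-dec row i ℕ.≟ row κ) (proj₁ ∘ rowBox) rowBox-injective
               (λ y → ≺-index μ (inj₂ (proj₁ (proj₂ (rowBox y)) , ≡.subst (ℕ._< column κ) (≡.sym (proj₂ (proj₂ (rowBox y)))) (Fin.toℕ<n y))) , proj₁ (proj₂ (rowBox y)))
               rowBox-onto)
             (-‿cong (∑-count (λ i → i Fin.<? κ ×-dec column i ℕ.≟ column κ) (proj₁ ∘ columnBox) columnBox-injective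
               (λ x → ≺-index μ (inj₁ (≡.subst (ℕ._< row κ) (≡.sym (proj₁ (proj₂ (columnBox x)))) (Fin.toℕ<n x))) , proj₂ (proj₂ (columnBox x)))
               columnBox-onto)) ⟩
      (column κ ×ⁿ 1#) - (row κ ×ⁿ 1#) ∎
      where
      in-row in-column : Fin (size μ) → Carrier
      in-row    i = indicator (i Fin.<? κ ×-dec row i ℕ.≟ row κ)
      in-column i = indicator (i Fin.<? κ ×-dec column i ℕ.≟ column κ)

      rowBox : ∀ (y : Fin (column κ)) → ∃[ i ] (row i ≡ row κ × column i ≡ toℕ y)
      rowBox y = boxAt μ κ ℕ.≤-refl (ℕ.<⇒≤ (Fin.toℕ<n y))

      rowBox-injective : ∀ {y y′} → proj₁ (rowBox y) ≡ proj₁ (rowBox y′) → y ≡ y′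
      rowBox-injective {y} {y′} eq = Fin.toℕ-injective
        (≡.trans (≡.sym (proj₂ (proj₂ (rowBox y)))) (≡.trans (≡.cong column eq) (proj₂ (proj₂ (rowBox y′)))))

      rowBox-onto : ∀ {i} → i Fin.< κ × row i ≡ row κ → ∃[ y ] (proj₁ (rowBox y) ≡ i)
      rowBox-onto {i} (i<κ , same-row) with index-≺ μ i<κ
      ... | inj₁ lt = ⊥-elim (ℕ.<⇒≢ lt same-row)
      ... | inj₂ (_ , lt) = fromℕ< lt , tableau-separated μ
            (≡.trans (proj₁ (proj₂ (rowBox (fromℕ< lt)))) (≡.sym same-row))
            (≡.trans (proj₂ (proj₂ (rowBox (fromℕ< lt)))) (Fin.toℕ-fromℕ< lt))

      columnBox : ∀ (x : Fin (row κ)) → ∃[ i ] (row i ≡ toℕ x × column i ≡ column κ)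
      columnBox x = boxAt μ κ (ℕ.<⇒≤ (Fin.toℕ<n x)) ℕ.≤-refl

      columnBox-injective : ∀ {x x′} → proj₁ (columnBox x) ≡ proj₁ (columnBox x′) → x ≡ x′
      columnBox-injective {x} {x′} eq = Fin.toℕ-injective
        (≡.trans (≡.sym (proj₁ (proj₂ (columnBox x)))) (≡.trans (≡.cong row eq) (proj₁ (proj₂ (columnBox x′)))))

      columnBox-onto : ∀ {i} → i Fin.< κ × column i ≡ column κ → ∃[ x ] (proj₁ (columnBox x) ≡ i)
      columnBox-onto {i} (i<κ , same-col) with index-≺ μ i<κ
      ... | inj₂ (_ , lt) = ⊥-elim (ℕ.<⇒≢ lt same-col)
      ... | inj₁ lt = fromℕ< lt , tableau-separated μ
            (≡.trans (proj₁ (proj₂ (columnBox (fromℕ< lt)))) (Fin.toℕ-fromℕ< lt))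
            (≡.trans (proj₂ (proj₂ (columnBox (fromℕ< lt)))) (≡.sym same-col))

-- Coordinates with respect to a basis.

module Bases {c ℓ₁ ℓ₂} (K : HeytingField c ℓ₁ ℓ₂) where
  open Over K
  open FieldLaws K
  open FiniteSums K

  module _ {X : Set} where

    combination-cong : ∀ {d} {a b : Fin d → Carrier} (v : Fin d → X → Carrier) → (∀ i → a i ≈ b i) →
                       combination a v ≋ combination b v
    combination-cong v a≈b x = ∑-cong (λ i → *-congʳ (a≈b i))

    combination-unit : ∀ {d} (j : Fin d) (v : Fin d → X → Carrier) →
                       combination (λ i → indicator (i Fin.≟ j)) v ≋ v j
    combination-unit j v x = ∑-sift j (λ i → v i x)

    combination-- : ∀ {d} (a b : Fin d → Carrier) (v : Fin d → X → Carrier) x →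
                    combination (λ i → a i - b i) v x ≈ combination a v x - combination b v x
    combination-- a b v x = begin
      combination (λ i → a i - b i) v x
        ≈⟨ ∑-cong (λ i → trans (distribʳ (v i x) (a i) (- b i)) (+-congˡ (trans (sym (-‿distribˡ-* (b i) (v i x))) (sym (-1*x≈-x _))))) ⟩
      ∑ (λ i → a i * v i x + - 1# * (b i * v i x))
        ≈⟨ ∑-distrib-+ (λ i → a i * v i x) (λ i → - 1# * (b i * v i x)) ⟩
      combination a v x + ∑ (λ i → - 1# * (b i * v i x))
        ≈⟨ +-congˡ (trans (sym (*-distribˡ-sum (- 1#) (λ i → b i * v i x))) (-1*x≈-x _)) ⟩
      combination a v x - combination b v x ∎

    module _ {p} {W : (X → Carrier) → Set p} {d} (basis : Basis W d) where
      open Basis basis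

      coordinates-unique : ∀ {a b} → combination a vec ≋ combination b vec → ∀ i → a i ≈ b i
      coordinates-unique {a} {b} eq i = x-y≈0⇒x≈y (independent (λ i → a i - b i)
        (λ x → trans (combination-- a b vec x) (trans (+-congʳ (eq x)) (-‿inverseʳ _))) i)

-- Specht modules: the scalar by which ω acts, and its trace.

module SpechtModules {c ℓ₁ ℓ₂} (K : HeytingField c ℓ₁ ℓ₂) where
  open Over K
  open FieldLaws K
  open FiniteSums K
  open PermutationSums K
  open Sign K
  open Bases K
  open ContentPairing K
  open TableauContents K

  module _ (μ : Partition) where
    open Tableau μ
    private
      m = size μ
      P = allPerms m
      R = rowSymmetrizer μ
      C = columnAntisymmetrizer μ

    R-transpose : ∀ {a b} → row a ≡ row b → ∀ ρ → R (ρ · transpose a b) ≈ R ρ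
    R-transpose {a} {b} same ρ = indicator-⇔ (preservesRows? (ρ · transpose a b)) (preservesRows? ρ)
      (λ pres i → ≡.trans (≡.cong (row ∘ (ρ ⟨$⟩ʳ_)) (≡.sym (transpose-involutive a b i))) (≡.trans (pres (transpose a b ⟨$⟩ʳ i)) (row-transpose i)))
      (λ pres i → ≡.trans (pres (transpose a b ⟨$⟩ʳ i)) (row-transpose i))
      where
      row-transpose : ∀ i → row (transpose a b ⟨$⟩ʳ i) ≡ row i
      row-transpose i with transpose-cases a b i
      ... | inj₁ (≡.refl , eq)          = ≡.trans (≡.cong row eq) (≡.sym same)
      ... | inj₂ (inj₁ (≡.refl , eq))   = ≡.trans (≡.cong row eq) same
      ... | inj₂ (inj₂ (_ , _ , eq))    = ≡.cong row eq

    C-ext : Extensional C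
    C-ext {σ} {τ} eq = *-cong
      (indicator-⇔ (preservesColumns? σ) (preservesColumns? τ)
        (λ pres i → ≡.trans (≡.cong column (≡.sym (eq i))) (pres i)) (λ pres i → ≡.trans (≡.cong column (eq i)) (pres i)))
      (sgn-cong {σ = σ} {τ} eq)

    C-transpose : ∀ {a b} → a ≢ b → column a ≡ column b → ∀ σ → C (transpose a b · σ) ≈ - C σ
    C-transpose {a} {b} a≢b same σ = begin
      C (transpose a b · σ)
        ≈⟨ *-cong (indicator-⇔ (preservesColumns? (transpose a b · σ)) (preservesColumns? σ)
             (λ pres i → ≡.trans (≡.sym (column-transpose (σ ⟨$⟩ʳ i))) (pres i)) (λ pres i → ≡.trans (column-transpose (σ ⟨$⟩ʳ i)) (pres i)))
             (sgn-transpose a≢b σ) ⟩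
      indicator (preservesColumns? σ) * - sgn σ  ≈⟨ -‿distribʳ-* _ _ ⟨
      - C σ                                      ∎
      where
      column-transpose : ∀ i → column (transpose a b ⟨$⟩ʳ i) ≡ column i
      column-transpose i with transpose-cases a b i
      ... | inj₁ (≡.refl , eq)          = ≡.trans (≡.cong column eq) (≡.sym same)
      ... | inj₂ (inj₁ (≡.refl , eq))   = ≡.trans (≡.cong column eq) same
      ... | inj₂ (inj₂ (_ , _ , eq))    = ≡.cong column eq

    -- The argument enters a product only through `y`, so every element of the left ideal is
    -- extensional, whatever `x` produces it.
    ⊛-ext : ∀ (x : GroupAlgebra m) {y} → Extensional y → Extensional (x ⊛ y)
    ⊛-ext x {y} y-ext {σ} {τ} eq = sumOver-cong P (λ ρ → *-congˡ
      (y-ext {flip ρ · σ} {flip ρ · τ} (λ i → ≡.cong (ρ ⟨$⟩ˡ_) (eq i))))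

    young-ext : Extensional (youngSymmetrizer μ)
    young-ext {σ} {τ} = ⊛-ext R (λ {σ} {τ} → C-ext {σ} {τ}) {σ} {τ}

    -- The coefficient of π in R σ C, as a function of σ.
    sandwich : Permutation′ m → GroupAlgebra m
    sandwich π σ = sumOver P (λ ρ → R ρ * C (flip σ · (flip ρ · π)))

    -- After the substitution ρ ↦ ρ (a b), a row transposition to the left of σ disappears into R. A
    -- column transposition to its right lands in front of the argument of C, which changes sign.
    sandwich-invariant : ∀ π → InvariantBelow row column m (sandwich π)
    sandwich-invariant π = record
      { extensional = λ {σ} {τ} eq → sumOver-cong P (λ ρ → *-congˡ (C-ext {flip σ · (flip ρ · π)} {flip τ · (flip ρ · π)}
          (λ i → flip-cong {σ = σ} {τ} eq _)))
      ; rows = λ {a} {b} _ _ same σ → begin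
          sumOver P (λ ρ → R ρ * C (flip (transpose a b · σ) · (flip ρ · π)))
            ≈⟨ sumOver-cong P (λ ρ → *-cong (sym (R-transpose same ρ))
                 (C-ext {flip (transpose a b · σ) · (flip ρ · π)} {flip σ · (flip (ρ · transpose a b) · π)} (λ _ → ≡.refl))) ⟩
          sumOver P (λ ρ → R (ρ · transpose a b) * C (flip σ · (flip (ρ · transpose a b) · π)))
            ≈⟨ sumPerms-right (transpose a b) (λ ρ → R ρ * C (flip σ · (flip ρ · π))) (λ {ρ} {τ} eq → *-cong
                 (indicator-⇔ (preservesRows? ρ) (preservesRows? τ)
                   (λ pres i → ≡.trans (≡.cong row (≡.sym (eq i))) (pres i)) (λ pres i → ≡.trans (≡.cong row (eq i)) (pres i)))
                 (C-ext {flip σ · (flip ρ · π)} {flip σ · (flip τ · π)} (λ i → ≡.cong (σ ⟨$⟩ˡ_) (flip-cong {σ = ρ} {τ} eq _)))) ⟩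
          sandwich π σ ∎
      ; columns = λ {a} {b} a≢b _ _ same σ → begin
          sumOver P (λ ρ → R ρ * C (flip (σ · transpose a b) · (flip ρ · π)))
            ≈⟨ sumOver-cong P (λ ρ → *-congˡ (trans
                 (C-ext {flip (σ · transpose a b) · (flip ρ · π)} {transpose a b · (flip σ · (flip ρ · π))} (λ i → transpose-inverse a b (σ ⟨$⟩ˡ (ρ ⟨$⟩ˡ (π ⟨$⟩ʳ i)))))
                 (C-transpose a≢b same (flip σ · (flip ρ · π))))) ⟩
          sumOver P (λ ρ → R ρ * - C (flip σ · (flip ρ · π)))
            ≈⟨ sumOver-cong P (λ ρ → trans (sym (-‿distribʳ-* _ _)) (sym (-1*x≈-x _))) ⟩
          sumOver P (λ ρ → - 1# * (R ρ * C (flip σ · (flip ρ · π))))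
            ≈⟨ trans (sym (sumOver-*ˡ (- 1#) P _)) (-1*x≈-x _) ⟩
          - sandwich π σ ∎ }

    -- Only the identity preserves both rows and columns.
    young-id : youngSymmetrizer μ id ≈ 1#
    young-id = begin
      sumOver P (λ ρ → R ρ * C (flip ρ · id))
        ≈⟨ sumOver-cong P (λ ρ → sym (*-assoc _ _ _)) ⟩
      sumOver P (λ ρ → R ρ * indicator (preservesColumns? (flip ρ · id)) * sgn (flip ρ · id))
        ≈⟨ sumOver-cong P (λ ρ → *-congʳ (sym (indicator-× (both? ρ) (preservesRows? ρ) (preservesColumns? (flip ρ · id)) (λ p → p) _,_))) ⟩
      sumOver P (λ ρ → indicator (both? ρ) * sgn (flip ρ · id))
        ≈⟨ sift (enumerates-allPerms m) both? id
             (λ {ρ} (rows , cols) i → tableau-separated μ (rows i) (≡.trans (≡.sym (cols (ρ ⟨$⟩ʳ i))) (≡.cong column (inverseˡ ρ))))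
             (λ {ρ} eq → (λ i → ≡.cong row (eq i)) , λ i → ≡.cong column (flip-cong {σ = ρ} {id} eq i))
             (λ ρ → sgn (flip ρ · id)) (λ {ρ} eq → sgn-cong {σ = flip ρ · id} {id} (flip-cong {σ = ρ} {id} eq)) ⟩
      sgn (id {m})
        ≈⟨ reflexive (≡.cong (λ k → (- 1#) ^ length k) (filter-none (inverted? (id {m})) (All.universal (λ (i , j) (i<j , j<i) → ℕ.<-asym i<j j<i) (List.cartesianProduct (allFin m) (allFin m))))) ⟩
      1# ∎
      where
      both? : ∀ ρ → Dec ((∀ i → row (ρ ⟨$⟩ʳ i) ≡ row i) × (∀ i → column ((flip ρ · id) ⟨$⟩ʳ i) ≡ column i))
      both? ρ = preservesRows? ρ ×-dec preservesColumns? (flip ρ · id)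

    act : GroupAlgebra m → GroupAlgebra m → GroupAlgebra m
    act w x π = sumOver P (λ σ → w σ * x (flip σ · π))

    -- By uniqueness of coordinates the matrix of w in the basis is κ times the identity matrix; the
    -- left side is its trace.
    trace : ∀ {φ} (char : IsSymmetricCharacter μ φ) w κ → (∀ {x} → SpechtModule μ x → ∀ π → act w x π ≈ κ * x π) →
            sumOver P (λ σ → w σ * φ σ) ≈ (proj₁ char ×ⁿ 1#) * κ
    trace {φ} (d , basis , rep) w κ scalar = begin
      sumOver P (λ σ → w σ * φ σ)
        ≈⟨ sumOver-cong P (λ σ → trans (*-congˡ (proj₂ (proj₂ (rep σ)))) (*-distribˡ-sum (w σ) (λ i → A σ i i))) ⟩
      sumOver P (λ σ → ∑ (λ i → w σ * A σ i i))
        ≈⟨ ∑-sumOver-swap P (λ i σ → w σ * A σ i i) ⟨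
      ∑ (λ i → sumOver P (λ σ → w σ * A σ i i))
        ≈⟨ ∑-cong diagonal ⟩
      ∑ {d} (λ i → κ)
        ≈⟨ ∑-replicate d ⟩
      d ×ⁿ κ
        ≈⟨ ×ⁿ-* d κ ⟩
      (d ×ⁿ 1#) * κ ∎
      where
      open Basis basis
      A : Permutation′ m → Fin d → Fin d → Carrier
      A σ = proj₁ (rep σ)
      column-sum : ∀ j → combination (λ i → sumOver P (λ σ → w σ * A σ i j)) vec ≋ combination (λ i → indicator (i Fin.≟ j) * κ) vec
      column-sum j π = begin
        ∑ (λ i → sumOver P (λ σ → w σ * A σ i j) * vec i π)
          ≈⟨ ∑-cong (λ i → trans (sumOver-*ʳ (vec i π) P _) (sumOver-cong P (λ σ → *-assoc _ _ _))) ⟩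
        ∑ (λ i → sumOver P (λ σ → w σ * (A σ i j * vec i π)))
          ≈⟨ ∑-sumOver-swap P (λ i σ → w σ * (A σ i j * vec i π)) ⟩
        sumOver P (λ σ → ∑ (λ i → w σ * (A σ i j * vec i π)))
          ≈⟨ sumOver-cong P (λ σ → trans (sym (*-distribˡ-sum (w σ) (λ i → A σ i j * vec i π))) (*-congˡ (sym (proj₁ (proj₂ (rep σ)) j π)))) ⟩
        act w (vec j) π
          ≈⟨ scalar (vec∈ j) π ⟩
        κ * vec j π
          ≈⟨ *-congˡ (combination-unit j vec π) ⟨
        κ * combination (λ i → indicator (i Fin.≟ j)) vec π
          ≈⟨ trans (*-distribˡ-sum κ (λ i → indicator (i Fin.≟ j) * vec i π))
               (∑-cong (λ i → solve 3 (λ k x v → k :* (x :* v) := x :* k :* v) refl κ _ (vec i π))) ⟩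
        combination (λ i → indicator (i Fin.≟ j) * κ) vec π ∎
      diagonal : ∀ j → sumOver P (λ σ → w σ * A σ j j) ≈ κ
      diagonal j = trans (coordinates-unique basis (column-sum j) j)
        (trans (*-congʳ (indicator-yes (j Fin.≟ j) ≡.refl)) (*-identityˡ κ))

    -- The left side is φ(1), kept as a sum because it arises in this form from the indicator of the
    -- identity of G.
    trace-id : ∀ {φ} (char : IsSymmetricCharacter μ φ) →
               sumOver P (λ σ → indicator (_~?_ (enumerates-allPerms m) σ id) * φ σ) ≈ proj₁ char ×ⁿ 1#
    trace-id char = trans (trace char (λ σ → indicator (_~?_ (enumerates-allPerms m) σ id)) 1# unit-scalar) (*-identityʳ _)
      where
      unit-scalar : ∀ {x} → SpechtModule μ x → ∀ π → act (λ σ → indicator (_~?_ (enumerates-allPerms m) σ id)) x π ≈ 1# * x π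
      unit-scalar {x} (y , x≋) π = trans
        (sift (enumerates-allPerms m) (λ σ → _~?_ (enumerates-allPerms m) σ id) id (λ p → p) (λ p → p)
          (λ σ → x (flip σ · π)) (λ {σ} eq → trans (x≋ _) (trans
            (⊛-ext y (λ {σ} {τ} → young-ext {σ} {τ}) {flip σ · π} {flip id · π} (λ i → flip-cong {σ = σ} {id} eq (π ⟨$⟩ʳ i))) (sym (x≋ _)))))
        (trans (trans (x≋ _) (trans (⊛-ext y (λ {σ} {τ} → young-ext {σ} {τ}) {flip id · π} {π} (λ _ → ≡.refl)) (sym (x≋ π)))) (sym (*-identityˡ _)))

    -- In dimension zero the Young symmetrizer would be an empty combination, hence zero, but its
    -- coefficient at the identity is 1.
    dimension-unit : CharacteristicZero → ∀ {φ} (char : IsSymmetricCharacter μ φ) → Unit (proj₁ char ×ⁿ 1#)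
    dimension-unit char0 (suc d , _) = unit (char0 (suc d))
    dimension-unit char0 (zero , basis , _) = ⊥-elim (HeytingField.#-irrefl K (begin
      1 ×ⁿ 1#                          ≈⟨ +-identityʳ 1# ⟩
      1#                               ≈⟨ young-id ⟨
      youngSymmetrizer μ id            ≈⟨ sift (enumerates-allPerms m) (λ σ → _~?_ (enumerates-allPerms m) σ id) id (λ p → p) (λ p → p)
                                            (λ σ → youngSymmetrizer μ (flip σ · id)) (λ {σ} eq → young-ext {flip σ · id} {id} (flip-cong {σ = σ} {id} eq)) ⟨
      (δ ⊛ youngSymmetrizer μ) id      ≈⟨ proj₂ (Basis.spanning basis (δ , λ _ → refl)) id ⟩
      0#                               ∎) (char0 1))
      where
      δ : GroupAlgebra m
      δ σ = indicator (_~?_ (enumerates-allPerms m) σ id)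

    module _ (2-unit : Unit (1# + 1#)) (s r : Carrier) (s-unit : Unit s)
             (ω : Permutation′ m → Carrier) (ω-ext : Extensional ω) (ω-id : ω id ≈ s ^ m)
             (ω-cut : ∀ σ p → σ ⟨$⟩ʳ p ≢ p → s * ω σ ≈ r * ω (transpose p (σ ⟨$⟩ʳ p) · σ))
             (ω-conj : ∀ ρ σ → ω ((ρ · σ) · flip ρ) ≈ ω σ) where

      -- A class function is central in the group algebra; the substitution behind this is σ ↦ ρ σ
      -- ρ⁻¹.
      ω-central : ∀ {h} → Extensional h → ∀ ρ π →
        sumOver P (λ σ → ω σ * h (flip ρ · (flip σ · π))) ≈ sumOver P (λ σ → ω σ * h (flip σ · (flip ρ · π)))
      ω-central {h} h-ext ρ π = begin
        sumOver P g                              ≈⟨ sumPerms-left ρ g g-ext ⟨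
        sumOver P (λ σ → g (ρ · σ))              ≈⟨ sumPerms-right (flip ρ) (λ σ → g (ρ · σ)) (λ {σ} {τ} eq → g-ext {ρ · σ} {ρ · τ} (λ i → ≡.cong (ρ ⟨$⟩ʳ_) (eq i))) ⟨
        sumOver P (λ σ → g (ρ · (σ · flip ρ)))   ≈⟨ sumOver-cong P (λ σ → *-cong
             (trans (ω-ext {ρ · (σ · flip ρ)} {(ρ · σ) · flip ρ} (λ _ → ≡.refl)) (ω-conj ρ σ))
             (h-ext {flip ρ · (flip (ρ · (σ · flip ρ)) · π)} {flip σ · (flip ρ · π)} (λ i → inverseˡ ρ))) ⟩
        sumOver P (λ σ → ω σ * h (flip σ · (flip ρ · π))) ∎
        where
        g : GroupAlgebra m
        g σ = ω σ * h (flip ρ · (flip σ · π))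
        g-ext : Extensional g
        g-ext {σ} {τ} eq = *-cong (ω-ext {σ} {τ} eq) (h-ext {flip ρ · (flip σ · π)} {flip ρ · (flip τ · π)}
          (λ i → ≡.cong (ρ ⟨$⟩ˡ_) (flip-cong {σ = σ} {τ} eq (π ⟨$⟩ʳ i))))

      eigenvalue : Carrier
      eigenvalue = ∏ (λ i → s + r * relativeContent row column i)

      -- Centrality lets ω pass the left factor `x` and act on `h` alone.
      act-⊛ : ∀ (x h : GroupAlgebra m) → Extensional h → ∀ π →
              act ω (x ⊛ h) π ≈ sumOver P (λ ρ → x ρ * act ω h (flip ρ · π))
      act-⊛ x h h-ext π = begin
        sumOver P (λ σ → ω σ * sumOver P (λ ρ → x ρ * h (flip ρ · (flip σ · π))))
          ≈⟨ sumOver-cong P (λ σ → trans (sumOver-*ˡ (ω σ) P _) (sumOver-cong P (λ ρ →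
               solve 3 (λ a b c → a :* (b :* c) := b :* (a :* c)) refl (ω σ) (x ρ) _))) ⟩
        sumOver P (λ σ → sumOver P (λ ρ → x ρ * (ω σ * h (flip ρ · (flip σ · π)))))
          ≈⟨ sumOver-swap P P _ ⟩
        sumOver P (λ ρ → sumOver P (λ σ → x ρ * (ω σ * h (flip ρ · (flip σ · π)))))
          ≈⟨ sumOver-cong P (λ ρ → trans (sym (sumOver-*ˡ (x ρ) P _)) (*-congˡ (ω-central (λ {σ} {τ} → h-ext {σ} {τ}) ρ π))) ⟩
        sumOver P (λ ρ → x ρ * act ω h (flip ρ · π)) ∎

      -- Once ω has passed the row symmetrizer, what remains is its pairing with `sandwich π`, whose
      -- value at the identity is the coefficient of π in R C.
      young-eigen : ∀ π → act ω (youngSymmetrizer μ) π ≈ eigenvalue * youngSymmetrizer μ π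
      young-eigen π = begin
        act ω (R ⊛ C) π
          ≈⟨ act-⊛ R C (λ {σ} {τ} → C-ext {σ} {τ}) π ⟩
        sumOver P (λ ρ → R ρ * sumOver P (λ σ → ω σ * C (flip σ · (flip ρ · π))))
          ≈⟨ sumOver-cong P (λ ρ → trans (sumOver-*ˡ (R ρ) P _) (sumOver-cong P (λ σ →
               solve 3 (λ a b c → a :* (b :* c) := b :* (a :* c)) refl (R ρ) (ω σ) _))) ⟩
        sumOver P (λ ρ → sumOver P (λ σ → ω σ * (R ρ * C (flip σ · (flip ρ · π)))))
          ≈⟨ sumOver-swap P P _ ⟩
        sumOver P (λ σ → sumOver P (λ ρ → ω σ * (R ρ * C (flip σ · (flip ρ · π)))))
          ≈⟨ sumOver-cong P (λ σ → sym (sumOver-*ˡ (ω σ) P _)) ⟩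
        sumOver P (λ σ → ω σ * sandwich π σ)
          ≈⟨ pairing row column (tableau-shape μ) 2-unit s r s-unit ω (λ {σ} {τ} → ω-ext {σ} {τ}) ω-id ω-cut (sandwich-invariant π) ⟩
        eigenvalue * sandwich π id
          ≈⟨ *-congˡ (sumOver-cong P (λ ρ → *-congˡ (C-ext {flip id · (flip ρ · π)} {flip ρ · π} (λ _ → ≡.refl)))) ⟩
        eigenvalue * youngSymmetrizer μ π ∎

      -- ω passes the left factor `y` of an element of the ideal and meets the Young symmetrizer, an
      -- eigenvector by `young-eigen`.
      specht-eigen : ∀ {x} → SpechtModule μ x → ∀ π → act ω x π ≈ eigenvalue * x π
      specht-eigen {x} (y , x≋) π = begin
        act ω x π
          ≈⟨ sumOver-cong P (λ σ → *-congˡ (x≋ (flip σ · π))) ⟩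
        act ω (y ⊛ youngSymmetrizer μ) π
          ≈⟨ act-⊛ y (youngSymmetrizer μ) (λ {σ} {τ} → young-ext {σ} {τ}) π ⟩
        sumOver P (λ ρ → y ρ * act ω (youngSymmetrizer μ) (flip ρ · π))
          ≈⟨ sumOver-cong P (λ ρ → trans (*-congˡ (young-eigen (flip ρ · π)))
               (solve 3 (λ a b c → a :* (b :* c) := b :* (a :* c)) refl (y ρ) eigenvalue _)) ⟩
        sumOver P (λ ρ → eigenvalue * (y ρ * youngSymmetrizer μ (flip ρ · π)))
          ≈⟨ sumOver-*ˡ eigenvalue P _ ⟨
        eigenvalue * (y ⊛ youngSymmetrizer μ) π
          ≈⟨ *-congˡ (x≋ π) ⟨
        eigenvalue * x π ∎

      trace-content : ∀ {φ} (char : IsSymmetricCharacter μ φ) →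
        sumOver P (λ σ → ω σ * φ σ) ≈ (proj₁ char ×ⁿ 1#) * ∏ (λ i → s + r * ((column i ×ⁿ 1#) - (row i ×ⁿ 1#)))
      trace-content char = trans (trace char ω eigenvalue specht-eigen)
        (*-congˡ (∏-cong (λ i → +-congˡ (*-congˡ (relativeContent≈ μ i)))))

-- Exponents modulo r and conjugation in G(r,1,n).

module _ {r} .{{_ : NonZero r}} where

  infixl 6 _⊞_
  _⊞_ : Fin r → Fin r → Fin r
  a ⊞ b = (toℕ a ℕ.+ toℕ b) mod r

  0ᶠ : Fin r
  0ᶠ = 0 mod r

  -- The final `mod` matters for a = 0, where r ∸ 0 = r is out of range.
  ⊟_ : Fin r → Fin r
  ⊟ a = (r ∸ toℕ a) mod r

  toℕ-mod : ∀ k → toℕ (k mod r) ≡ k % r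
  toℕ-mod k = Fin.toℕ-fromℕ< (m%n<n k r)

  [m%r+n]%r : ∀ m n → (m % r ℕ.+ n) % r ≡ (m ℕ.+ n) % r
  [m%r+n]%r m n = begin
    (m % r ℕ.+ n) % r          ≡⟨ %-distribˡ-+ (m % r) n r ⟩
    (m % r % r ℕ.+ n % r) % r  ≡⟨ ≡.cong (λ k → (k ℕ.+ n % r) % r) (m%n%n≡m%n m r) ⟩
    (m % r ℕ.+ n % r) % r      ≡⟨ %-distribˡ-+ m n r ⟨
    (m ℕ.+ n) % r              ∎
    where open ≡-Reasoning

  ⊞-comm : ∀ a b → a ⊞ b ≡ b ⊞ a
  ⊞-comm a b = ≡.cong (_mod r) (ℕ.+-comm (toℕ a) (toℕ b))

  ⊞-assoc : ∀ a b c → (a ⊞ b) ⊞ c ≡ a ⊞ (b ⊞ c)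
  ⊞-assoc a b c = Fin.toℕ-injective (begin
    toℕ ((a ⊞ b) ⊞ c)                      ≡⟨ toℕ-mod _ ⟩
    (toℕ (a ⊞ b) ℕ.+ toℕ c) % r            ≡⟨ ≡.cong (λ k → (k ℕ.+ toℕ c) % r) (toℕ-mod _) ⟩
    ((toℕ a ℕ.+ toℕ b) % r ℕ.+ toℕ c) % r  ≡⟨ [m%r+n]%r (toℕ a ℕ.+ toℕ b) (toℕ c) ⟩
    (toℕ a ℕ.+ toℕ b ℕ.+ toℕ c) % r        ≡⟨ ≡.cong (_% r) (≡.trans (ℕ.+-assoc (toℕ a) _ _) (ℕ.+-comm (toℕ a) _)) ⟩
    (toℕ b ℕ.+ toℕ c ℕ.+ toℕ a) % r        ≡⟨ [m%r+n]%r (toℕ b ℕ.+ toℕ c) (toℕ a) ⟨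
    ((toℕ b ℕ.+ toℕ c) % r ℕ.+ toℕ a) % r  ≡⟨ ≡.cong (_% r) (≡.trans (≡.cong (ℕ._+ toℕ a) (≡.sym (toℕ-mod _))) (ℕ.+-comm _ (toℕ a))) ⟩
    (toℕ a ℕ.+ toℕ (b ⊞ c)) % r            ≡⟨ toℕ-mod _ ⟨
    toℕ (a ⊞ (b ⊞ c))                      ∎)
    where open ≡-Reasoning

  toℕ-0ᶠ : toℕ 0ᶠ ≡ 0
  toℕ-0ᶠ = ≡.trans (toℕ-mod 0) (m<n⇒m%n≡m (ℕ.>-nonZero⁻¹ r))

  ⊞-identityʳ : ∀ a → a ⊞ 0ᶠ ≡ a
  ⊞-identityʳ a = Fin.toℕ-injective (begin
    toℕ (a ⊞ 0ᶠ)             ≡⟨ toℕ-mod _ ⟩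
    (toℕ a ℕ.+ toℕ 0ᶠ) % r   ≡⟨ ≡.cong (λ k → (toℕ a ℕ.+ k) % r) toℕ-0ᶠ ⟩
    (toℕ a ℕ.+ 0) % r        ≡⟨ ≡.cong (_% r) (ℕ.+-identityʳ (toℕ a)) ⟩
    toℕ a % r                ≡⟨ m<n⇒m%n≡m (Fin.toℕ<n a) ⟩
    toℕ a                    ∎)
    where open ≡-Reasoning

  ⊞-inverseˡ : ∀ a → ⊟ a ⊞ a ≡ 0ᶠ
  ⊞-inverseˡ a = Fin.toℕ-injective (begin
    toℕ (⊟ a ⊞ a)                      ≡⟨ toℕ-mod _ ⟩
    (toℕ (⊟ a) ℕ.+ toℕ a) % r          ≡⟨ ≡.cong (λ k → (k ℕ.+ toℕ a) % r) (toℕ-mod _) ⟩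
    ((r ∸ toℕ a) % r ℕ.+ toℕ a) % r    ≡⟨ [m%r+n]%r (r ∸ toℕ a) (toℕ a) ⟩
    (r ∸ toℕ a ℕ.+ toℕ a) % r          ≡⟨ ≡.cong (_% r) (ℕ.m∸n+n≡m (ℕ.<⇒≤ (Fin.toℕ<n a))) ⟩
    r % r                              ≡⟨ n%n≡0 r ⟩
    0                                  ≡⟨ toℕ-0ᶠ ⟨
    toℕ 0ᶠ                             ∎)
    where open ≡-Reasoning

  ⊞-cancel : ∀ a b → (a ⊞ ⊟ b) ⊞ b ≡ a
  ⊞-cancel a b = ≡.trans (⊞-assoc a (⊟ b) b) (≡.trans (≡.cong (a ⊞_) (⊞-inverseˡ b)) (⊞-identityʳ a))

  ⊟-cancel : ∀ a b → (a ⊞ b) ⊞ ⊟ b ≡ a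
  ⊟-cancel a b = ≡.trans (⊞-assoc a b (⊟ b))
    (≡.trans (≡.cong (a ⊞_) (≡.trans (⊞-comm b (⊟ b)) (⊞-inverseˡ b))) (⊞-identityʳ a))

  module _ {n : ℕ} where

    ≐-refl : ∀ {g : G r n} → g ≐ g
    ≐-refl = (λ _ → ≡.refl) , λ _ → ≡.refl

    ≐-sym : ∀ {g h : G r n} → g ≐ h → h ≐ g
    ≐-sym (p , q) = (λ i → ≡.sym (p i)) , λ i → ≡.sym (q i)

    -- This is x h x⁻¹ written out: the exponent of x is added at i and subtracted at the preimage
    -- of i under σ τ σ⁻¹. The next two lemmas make it the only w with x h = w x.
    conjugate : G r n → G r n → G r n
    conjugate (σ , a) (τ , b) = ((σ · τ) · flip σ) , λ i → (a i ⊞ b (σ ⟨$⟩ˡ i)) ⊞ ⊟ a (σ ⟨$⟩ʳ (τ ⟨$⟩ˡ (σ ⟨$⟩ˡ i)))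

    commutes⇒conjugate : ∀ {x h w : G r n} → (x ∙ h) ≐ (w ∙ x) → w ≐ conjugate x h
    commutes⇒conjugate {σ , a} {τ , b} {υ , c} (p , q) = υ≃ , λ i → begin
      c i                                                        ≡⟨ ⊟-cancel (c i) (a (υ ⟨$⟩ˡ i)) ⟨
      c i ⊞ a (υ ⟨$⟩ˡ i) ⊞ ⊟ a (υ ⟨$⟩ˡ i)                        ≡⟨ ≡.cong (_⊞ ⊟ a (υ ⟨$⟩ˡ i)) (q i) ⟨
      a i ⊞ b (σ ⟨$⟩ˡ i) ⊞ ⊟ a (υ ⟨$⟩ˡ i)                        ≡⟨ ≡.cong (λ j → a i ⊞ b (σ ⟨$⟩ˡ i) ⊞ ⊟ a j) (flip-cong {σ = υ} {(σ · τ) · flip σ} υ≃ i) ⟩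
      a i ⊞ b (σ ⟨$⟩ˡ i) ⊞ ⊟ a (σ ⟨$⟩ʳ (τ ⟨$⟩ˡ (σ ⟨$⟩ˡ i)))      ∎
      where
      open ≡-Reasoning
      υ≃ : υ ≃ ((σ · τ) · flip σ)
      υ≃ i = ≡.sym (≡.trans (p (σ ⟨$⟩ˡ i)) (≡.cong (υ ⟨$⟩ʳ_) (inverseʳ σ)))

    conjugate⇒commutes : ∀ {x h w : G r n} → w ≐ conjugate x h → (x ∙ h) ≐ (w ∙ x)
    conjugate⇒commutes {σ , a} {τ , b} {υ , c} (p , q) =
      (λ i → ≡.sym (≡.trans (p (σ ⟨$⟩ʳ i)) (≡.cong (λ j → σ ⟨$⟩ʳ (τ ⟨$⟩ʳ j)) (inverseˡ σ)))) , λ i → begin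
      a i ⊞ b (σ ⟨$⟩ˡ i)                       ≡⟨ ⊞-cancel (a i ⊞ b (σ ⟨$⟩ˡ i)) (a (j i)) ⟨
      a i ⊞ b (σ ⟨$⟩ˡ i) ⊞ ⊟ a (j i) ⊞ a (j i)  ≡⟨ ≡.cong₂ _⊞_ (≡.sym (q i)) (≡.cong a (≡.sym (flip-cong {σ = υ} {(σ · τ) · flip σ} p i))) ⟩
      c i ⊞ a (υ ⟨$⟩ˡ i)                       ∎
      where
      open ≡-Reasoning
      j : Fin n → Fin n
      j i = σ ⟨$⟩ʳ (τ ⟨$⟩ˡ (σ ⟨$⟩ˡ i))

  IsIdentity : ∀ {n} → G r n → Set
  IsIdentity g = g ≐ 1ᴳ

  identity-conj : ∀ {n} (x h w : G r n) → (x ∙ h) ≐ (w ∙ x) → IsIdentity h → IsIdentity w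
  identity-conj (σ , a) (τ , b) (υ , c) (p , q) (τ≃id , b≡0) = υ≃id , λ i → begin
    c i                                      ≡⟨ ⊟-cancel (c i) (a i) ⟨
    c i ⊞ a i ⊞ ⊟ a i                        ≡⟨ ≡.cong (λ j → c i ⊞ a j ⊞ ⊟ a i) (flip-cong {σ = υ} {id} υ≃id i) ⟨
    c i ⊞ a (υ ⟨$⟩ˡ i) ⊞ ⊟ a i               ≡⟨ ≡.cong (_⊞ ⊟ a i) (q i) ⟨
    a i ⊞ b (σ ⟨$⟩ˡ i) ⊞ ⊟ a i               ≡⟨ ≡.cong (_⊞ ⊟ a i) (⊞-comm (a i) (b (σ ⟨$⟩ˡ i))) ⟩
    b (σ ⟨$⟩ˡ i) ⊞ a i ⊞ ⊟ a i               ≡⟨ ⊟-cancel (b (σ ⟨$⟩ˡ i)) (a i) ⟩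
    b (σ ⟨$⟩ˡ i)                             ≡⟨ b≡0 (σ ⟨$⟩ˡ i) ⟩
    0ᶠ                                       ∎
    where
    open ≡-Reasoning
    υ≃id : υ ≃ id
    υ≃id i = ≡.trans (≡.cong (υ ⟨$⟩ʳ_) (≡.sym (inverseʳ σ)))
      (≡.trans (≡.sym (p (σ ⟨$⟩ˡ i))) (≡.trans (≡.cong (σ ⟨$⟩ʳ_) (τ≃id (σ ⟨$⟩ˡ i))) (inverseʳ σ)))

  identity-conj⁻ : ∀ {n} (x h w : G r n) → (x ∙ h) ≐ (w ∙ x) → IsIdentity w → IsIdentity h
  identity-conj⁻ (σ , a) (τ , b) (υ , c) (p , q) (υ≃id , c≡0) =
    (λ i → perm-injective σ (≡.trans (p i) (υ≃id (σ ⟨$⟩ʳ i)))) , λ i → begin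
    b i                                      ≡⟨ ≡.cong b (inverseˡ σ) ⟨
    b (σ ⟨$⟩ˡ j i)                           ≡⟨ ⊟-cancel (b (σ ⟨$⟩ˡ j i)) (a (j i)) ⟨
    b (σ ⟨$⟩ˡ j i) ⊞ a (j i) ⊞ ⊟ a (j i)     ≡⟨ ≡.cong (_⊞ ⊟ a (j i)) (⊞-comm _ (a (j i))) ⟩
    a (j i) ⊞ b (σ ⟨$⟩ˡ j i) ⊞ ⊟ a (j i)     ≡⟨ ≡.cong (_⊞ ⊟ a (j i)) (q (j i)) ⟩
    c (j i) ⊞ a (υ ⟨$⟩ˡ j i) ⊞ ⊟ a (j i)     ≡⟨ ≡.cong (λ l → c (j i) ⊞ a l ⊞ ⊟ a (j i)) (flip-cong {σ = υ} {id} υ≃id (j i)) ⟩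
    c (j i) ⊞ a (j i) ⊞ ⊟ a (j i)            ≡⟨ ⊟-cancel (c (j i)) (a (j i)) ⟩
    c (j i)                                  ≡⟨ c≡0 (j i) ⟩
    0ᶠ                                       ∎
    where
    open ≡-Reasoning
    j : Fin _ → Fin _
    j i = σ ⟨$⟩ʳ i

-- Sums over G(r,1,n).

module GroupSums {c ℓ₁ ℓ₂} (K : HeytingField c ℓ₁ ℓ₂) where
  open Over K
  open FiniteSums K
  open PermutationSums K

  Exps : ∀ r n → List (Fin n → Fin r)
  Exps r n = allΠ (λ _ → allFin r)

  enumerates-Exps : ∀ r n → Enumerates (λ a b → ∀ i → a i ≡ b i) (Exps r n)
  enumerates-Exps r n = enumerates-allΠ (λ _ → enumerates-allFin r)

  enumerates-allG : ∀ r n → Enumerates _≐_ (allG r n)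
  enumerates-allG r n = enumerates-product _,_ perm exps (enumerates-allPerms n) (enumerates-Exps r n) _≐?_ (λ p → p) _,_

  sumOver-allG : ∀ r n (f : G r n → Carrier) →
    sumOver (allG r n) f ≈ sumOver (allPerms n) (λ σ → sumOver (Exps r n) (λ a → f (σ , a)))
  sumOver-allG r n = sumOver-cartesianProductWith _,_ (allPerms n) (Exps r n)

-- Linear maps, direct sums and the uniqueness of dimension.

module Dimensions {c ℓ₁ ℓ₂} (K : HeytingField c ℓ₁ ℓ₂) where
  open Over K
  open FieldLaws K
  open FiniteSums K
  open Bases K

  -- Linearity is stated for finite combinations, the shape in which bases use it; the empty
  -- combination gives `map-zero`.
  record LinearMap (X Y : Set) : Set (c ⊔ ℓ₁) where
    field
      map    : (X → Carrier) → (Y → Carrier)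
      cong   : ∀ {v w} → v ≋ w → map v ≋ map w
      linear : ∀ {d} a (v : Fin d → X → Carrier) → map (combination a v) ≋ combination a (map ∘ v)

    map-zero : map (λ _ → 0#) ≋ (λ _ → 0#)
    map-zero = linear {0} (λ ()) (λ ())

  module _ {X : Set} {p q} {W : (X → Carrier) → Set p} {W′ : (X → Carrier) → Set q} where

    basis-⇔ : ∀ {d} → (∀ {v} → W v → W′ v) → (∀ {v} → W′ v → W v) → Basis W d → Basis W′ d
    basis-⇔ to from basis = record
      { vec = vec ; vec∈ = to ∘ vec∈ ; spanning = spanning ∘ from ; independent = independent }
      where open Basis basis

  module _ {X Y : Set} {p q} {W : (X → Carrier) → Set p} {W′ : (Y → Carrier) → Set q}
           (f : LinearMap X Y) (g : LinearMap Y X) where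
    private
      module f = LinearMap f
      module g = LinearMap g

    -- The maps are inverse to each other only on the subspaces. This is what removing a coordinate
    -- needs: the lost coordinate can be recovered for fixed vectors but not in general.
    basis-transport : (∀ {v} → W v → W′ (f.map v)) → (∀ {v} → W′ v → W (g.map v)) →
                      (∀ {v} → W v → g.map (f.map v) ≋ v) → (∀ {v} → W′ v → f.map (g.map v) ≋ v) →
                      ∀ {d} → Basis W d → Basis W′ d
    basis-transport f∈ g∈ gf fg basis = record
      { vec         = f.map ∘ vec
      ; vec∈        = f∈ ∘ vec∈
      ; spanning    = λ {v} v∈ → let a , eq = spanning (g∈ v∈) in
          a , λ y → trans (sym (fg v∈ y)) (trans (f.cong eq y) (f.linear a vec y))
      ; independent = λ a eq → independent a (λ x → begin
          combination a vec x                          ≈⟨ ∑-cong (λ i → *-congˡ (gf (vec∈ i) x)) ⟨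
          combination a (g.map ∘ f.map ∘ vec) x        ≈⟨ g.linear a (f.map ∘ vec) x ⟨
          g.map (combination a (f.map ∘ vec)) x        ≈⟨ g.cong eq x ⟩
          g.map (λ _ → 0#) x                           ≈⟨ g.map-zero x ⟩
          0#                                           ∎) }
      where open Basis basis

  ×ⁿ-apart : CharacteristicZero → ∀ {m n} → m ℕ.< n → (n ×ⁿ 1#) # (m ×ⁿ 1#)
  -- The difference n - m is written as a successor, to which characteristic zero applies.
  ×ⁿ-apart char0 {m} {n} m<n = HeytingField.invertible⇒# K (HeytingField.#⇒invertible K (char0 (suc (n ℕ.∸ suc m))) ▹ difference)
    where
    difference : suc (n ℕ.∸ suc m) ×ⁿ 1# - 0# ≈ n ×ⁿ 1# - m ×ⁿ 1#
    difference = begin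
      suc (n ℕ.∸ suc m) ×ⁿ 1# - 0#                     ≈⟨ +-congˡ (trans -0#≈0# (sym (-‿inverseʳ (m ×ⁿ 1#)))) ⟩
      suc (n ℕ.∸ suc m) ×ⁿ 1# + (m ×ⁿ 1# - m ×ⁿ 1#)    ≈⟨ +-assoc _ _ _ ⟨
      suc (n ℕ.∸ suc m) ×ⁿ 1# + m ×ⁿ 1# - m ×ⁿ 1#      ≈⟨ +-congʳ (×ⁿ-homo-+ 1# (suc (n ℕ.∸ suc m)) m) ⟨
      (suc (n ℕ.∸ suc m) ℕ.+ m) ×ⁿ 1# - m ×ⁿ 1#        ≈⟨ +-congʳ (reflexive (≡.cong (_×ⁿ 1#) (≡.trans (≡.sym (ℕ.+-suc _ m)) (ℕ.m∸n+n≡m m<n)))) ⟩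
      n ×ⁿ 1# - m ×ⁿ 1#                                ∎
    _▹_ : ∀ {x y} → Invertible _≈_ 1# _*_ x → x ≈ y → Invertible _≈_ 1# _*_ y
    (z , zx≈1 , xz≈1) ▹ x≈y = z , trans (*-congˡ (sym x≈y)) zx≈1 , trans (*-congʳ (sym x≈y)) xz≈1

  #⇒≉ : ∀ {x y} → x # y → ¬ (x ≈ y)
  #⇒≉ x#y x≈y = HeytingField.#-irrefl K x≈y x#y

  ×ⁿ-injective : CharacteristicZero → ∀ {m n} → m ×ⁿ 1# ≈ n ×ⁿ 1# → m ≡ n
  ×ⁿ-injective char0 {m} {n} eq with ℕ.<-cmp m n
  ... | tri≈ _ m≡n _ = m≡n
  ... | tri< m<n _ _ = ⊥-elim (#⇒≉ (×ⁿ-apart char0 m<n) (sym eq))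
  ... | tri> _ _ n<m = ⊥-elim (#⇒≉ (×ⁿ-apart char0 n<m) eq)

  -- The matrices P and Q of a change of basis satisfy tr (PQ) = tr (QP).
  dimension-unique : CharacteristicZero → ∀ {X : Set} {p} {W : (X → Carrier) → Set p} {d e} →
                     Basis W d → Basis W e → d ≡ e
  dimension-unique char0 {W = W} {d} {e} B B′ = ×ⁿ-injective char0 (begin
    d ×ⁿ 1#                                        ≈⟨ trace-one B B′ ⟨
    ∑ {d} (λ i → ∑ {e} (λ k → P B B′ k i * P B′ B i k))  ≈⟨ ∑-comm (λ i k → P B B′ k i * P B′ B i k) ⟩
    ∑ {e} (λ k → ∑ {d} (λ i → P B B′ k i * P B′ B i k))  ≈⟨ ∑-cong (λ k → ∑-cong (λ i → *-comm (P B B′ k i) (P B′ B i k))) ⟩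
    ∑ {e} (λ k → ∑ {d} (λ i → P B′ B i k * P B B′ k i))  ≈⟨ trace-one B′ B ⟩
    e ×ⁿ 1#                                        ∎)
    where
    P : ∀ {d e} → Basis W d → Basis W e → Fin e → Fin d → Carrier
    P B B′ k i = proj₁ (Basis.spanning B′ (Basis.vec∈ B i)) k
    trace-one : ∀ {d e} (B : Basis W d) (B′ : Basis W e) → ∑ {d} (λ i → ∑ {e} (λ k → P B B′ k i * P B′ B i k)) ≈ d ×ⁿ 1#
    trace-one {d} {e} B B′ = trans (∑-cong diagonal) (∑-replicate d)
      where
      open Basis B
      open Basis B′ using () renaming (vec to vec′)
      diagonal : ∀ i → ∑ {e} (λ k → P B B′ k i * P B′ B i k) ≈ 1#
      diagonal i = trans (coordinates-unique B expand i) (indicator-yes (i Fin.≟ i) ≡.refl)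
        where
        expand : combination (λ j → ∑ (λ k → P B B′ k i * P B′ B j k)) vec ≋ combination (λ j → indicator (j Fin.≟ i)) vec
        expand x = begin
          ∑ (λ j → ∑ (λ k → P B B′ k i * P B′ B j k) * vec j x)
            ≈⟨ ∑-cong (λ j → trans (*-distribʳ-sum (vec j x) (λ k → P B B′ k i * P B′ B j k)) (∑-cong {e} (λ k → *-assoc _ _ _))) ⟩
          ∑ (λ j → ∑ (λ k → P B B′ k i * (P B′ B j k * vec j x)))
            ≈⟨ ∑-comm (λ j k → P B B′ k i * (P B′ B j k * vec j x)) ⟩
          ∑ (λ k → ∑ (λ j → P B B′ k i * (P B′ B j k * vec j x)))
            ≈⟨ ∑-cong (λ k → trans (sym (*-distribˡ-sum (P B B′ k i) (λ j → P B′ B j k * vec j x)))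
                 (*-congˡ (sym (proj₂ (Basis.spanning B (Basis.vec∈ B′ k)) x)))) ⟩
          ∑ (λ k → P B B′ k i * vec′ k x)
            ≈⟨ proj₂ (Basis.spanning B′ (vec∈ i)) x ⟨
          vec i x
            ≈⟨ combination-unit i vec x ⟨
          combination (λ j → indicator (j Fin.≟ i)) vec x ∎

  ∑-split : ∀ m {n} (f : Fin (m ℕ.+ n) → Carrier) → ∑ f ≈ ∑ (λ i → f (i ↑ˡ n)) + ∑ (λ j → f (m ↑ʳ j))
  ∑-split zero    f = sym (+-identityˡ _)
  ∑-split (suc m) f = trans (+-congˡ (∑-split m (f ∘ suc))) (sym (+-assoc _ _ _))

  ∏-split : ∀ m {n} (f : Fin (m ℕ.+ n) → Carrier) → ∏ f ≈ ∏ (λ i → f (i ↑ˡ n)) * ∏ (λ j → f (m ↑ʳ j))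
  ∏-split zero    f = sym (*-identityˡ _)
  ∏-split (suc m) f = trans (*-congˡ (∏-split m (f ∘ suc))) (sym (*-assoc _ _ _))

  ↑-elim : ∀ {m n p} (P : Fin (m ℕ.+ n) → Set p) → (∀ i → P (i ↑ˡ n)) → (∀ j → P (m ↑ʳ j)) → ∀ x → P x
  ↑-elim {m} {n} P left right x with Fin.splitAt m x in eq
  ... | inj₁ i = ≡.subst P (Fin.splitAt⁻¹-↑ˡ eq) (left i)
  ... | inj₂ j = ≡.subst P (Fin.splitAt⁻¹-↑ʳ eq) (right j)

  module _ {m n p q} {W₁ : (Fin m → Carrier) → Set p} {W₂ : (Fin n → Carrier) → Set q}
           (resp₁ : ∀ {v w} → v ≋ w → W₁ v → W₁ w) (resp₂ : ∀ {v w} → v ≋ w → W₂ v → W₂ w)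
           (zero₁ : W₁ (λ _ → 0#)) (zero₂ : W₂ (λ _ → 0#)) where

    DirectSum : (Fin (m ℕ.+ n) → Carrier) → Set (p ⊔ q)
    DirectSum v = W₁ (v ∘ (_↑ˡ n)) × W₂ (v ∘ (m ↑ʳ_))

    basis-⊕ : ∀ {d e} → Basis W₁ d → Basis W₂ e → Basis DirectSum (d ℕ.+ e)
    basis-⊕ {d} {e} B₁ B₂ = record
      { vec = vec
      ; vec∈ = ↑-elim (DirectSum ∘ vec)
          (λ i → resp₁ (λ x → sym (ll i x)) (B₁.vec∈ i) , resp₂ (λ y → sym (lr i y)) zero₂)
          (λ j → resp₁ (λ x → sym (rl j x)) zero₁ , resp₂ (λ y → sym (rr j y)) (B₂.vec∈ j))
      ; spanning = λ {v} (v₁∈ , v₂∈) → let a₁ , eq₁ = B₁.spanning v₁∈ ; a₂ , eq₂ = B₂.spanning v₂∈ in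
          (a₁ Vector.++ a₂) , ↑-elim (λ x → v x ≈ combination (a₁ Vector.++ a₂) vec x)
          (λ x → trans (eq₁ x) (trans (combination-cong B₁.vec (λ i → reflexive (≡.sym (lookup-++ˡ a₁ a₂ i))) x) (sym (left (a₁ Vector.++ a₂) x))))
          (λ y → trans (eq₂ y) (trans (combination-cong B₂.vec (λ j → reflexive (≡.sym (lookup-++ʳ a₁ a₂ j))) y) (sym (right (a₁ Vector.++ a₂) y))))
      ; independent = λ a eq → ↑-elim (λ i → a i ≈ 0#)
          (B₁.independent (a ∘ (_↑ˡ e)) (λ x → trans (sym (left a x)) (eq (x ↑ˡ n))))
          (B₂.independent (a ∘ (d ↑ʳ_)) (λ y → trans (sym (right a y)) (eq (m ↑ʳ y)))) }
      where
      module B₁ = Basis B₁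
      module B₂ = Basis B₂
      pad₁ : (Fin m → Carrier) → Fin (m ℕ.+ n) → Carrier
      pad₁ v = v Vector.++ (λ _ → 0#)
      pad₂ : (Fin n → Carrier) → Fin (m ℕ.+ n) → Carrier
      pad₂ v = (λ _ → 0#) Vector.++ v
      vec : Fin (d ℕ.+ e) → Fin (m ℕ.+ n) → Carrier
      vec = (pad₁ ∘ B₁.vec) Vector.++ (pad₂ ∘ B₂.vec)
      ll : ∀ i x → vec (i ↑ˡ e) (x ↑ˡ n) ≈ B₁.vec i x
      ll i x = reflexive (≡.trans (≡.cong (λ v → v (x ↑ˡ n)) (lookup-++ˡ (pad₁ ∘ B₁.vec) (pad₂ ∘ B₂.vec) i)) (lookup-++ˡ (B₁.vec i) (λ _ → 0#) x))
      lr : ∀ i y → vec (i ↑ˡ e) (m ↑ʳ y) ≈ 0#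
      lr i y = reflexive (≡.trans (≡.cong (λ v → v (m ↑ʳ y)) (lookup-++ˡ (pad₁ ∘ B₁.vec) (pad₂ ∘ B₂.vec) i)) (lookup-++ʳ (B₁.vec i) (λ _ → 0#) y))
      rl : ∀ j x → vec (d ↑ʳ j) (x ↑ˡ n) ≈ 0#
      rl j x = reflexive (≡.trans (≡.cong (λ v → v (x ↑ˡ n)) (lookup-++ʳ (pad₁ ∘ B₁.vec) (pad₂ ∘ B₂.vec) j)) (lookup-++ˡ (λ _ → 0#) (B₂.vec j) x))
      rr : ∀ j y → vec (d ↑ʳ j) (m ↑ʳ y) ≈ B₂.vec j y
      rr j y = reflexive (≡.trans (≡.cong (λ v → v (m ↑ʳ y)) (lookup-++ʳ (pad₁ ∘ B₁.vec) (pad₂ ∘ B₂.vec) j)) (lookup-++ʳ {m = m} (λ _ → 0#) (B₂.vec j) y))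
      left : ∀ a x → combination a vec (x ↑ˡ n) ≈ combination (a ∘ (_↑ˡ e)) B₁.vec x
      left a x = trans (∑-split d (λ i → a i * vec i (x ↑ˡ n))) (trans
        (+-cong (∑-cong (λ i → *-congˡ (ll i x))) (trans (∑-cong {e} (λ j → trans (*-congˡ (rl j x)) (zeroʳ _))) (∑-zero e))) (+-identityʳ _))
      right : ∀ a y → combination a vec (m ↑ʳ y) ≈ combination (a ∘ (d ↑ʳ_)) B₂.vec y
      right a y = trans (∑-split d (λ i → a i * vec i (m ↑ʳ y))) (trans
        (+-cong (trans (∑-cong {d} (λ i → trans (*-congˡ (lr i y)) (zeroʳ _))) (∑-zero d)) (∑-cong (λ j → *-congˡ (rr j y)))) (+-identityˡ _))

-- Fixed spaces and their dimensions.

module FixedSpaceBases {c ℓ₁ ℓ₂} (K : HeytingField c ℓ₁ ℓ₂) (r : ℕ) .{{_ : NonZero r}}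
                   (ζ : Over.Carrier K) (ζ-primitive : Over.IsPrimitiveRoot K r ζ) where
  open Over K
  open FieldLaws K
  open FiniteSums K
  open Dimensions K
  open Reflection r ζ

  ^-% : ∀ k → ζ ^ (k % r) ≈ ζ ^ k
  ^-% k = begin
    ζ ^ (k % r)                        ≈⟨ *-identityʳ _ ⟨
    ζ ^ (k % r) * 1#                   ≈⟨ *-congˡ (trans (^-congˡ (k / r) (proj₁ ζ-primitive)) (1^n (k / r))) ⟨
    ζ ^ (k % r) * (ζ ^ r) ^ (k / r)    ≈⟨ *-congˡ (trans (^-assocʳ ζ r (k / r)) (reflexive (≡.cong (ζ ^_) (ℕ.*-comm r (k / r))))) ⟩
    ζ ^ (k % r) * ζ ^ (k / r ℕ.* r)    ≈⟨ ^-homo-* ζ (k % r) (k / r ℕ.* r) ⟨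
    ζ ^ (k % r ℕ.+ k / r ℕ.* r)        ≈⟨ reflexive (≡.cong (ζ ^_) (m≡m%n+[m/n]*n k r)) ⟨
    ζ ^ k                              ∎

  root : Fin r → Carrier
  root a = ζ ^ toℕ a

  root-⊞ : ∀ a b → root (a ⊞ b) ≈ root a * root b
  root-⊞ a b = trans (reflexive (≡.cong (ζ ^_) (toℕ-mod (toℕ a ℕ.+ toℕ b))))
    (trans (^-% (toℕ a ℕ.+ toℕ b)) (^-homo-* ζ (toℕ a) (toℕ b)))

  root-0 : root 0ᶠ ≈ 1#
  root-0 = reflexive (≡.cong (ζ ^_) toℕ-0ᶠ)

  root-⊟ : ∀ a → root (⊟ a) * root a ≈ 1#
  root-⊟ a = trans (sym (root-⊞ (⊟ a) a)) (trans (reflexive (≡.cong root (⊞-inverseˡ a))) root-0)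

  module _ {n : ℕ} where

    monomial : (Fin n → Carrier) → (Fin n → Fin n) → LinearMap (Fin n) (Fin n)
    monomial u f = record
      { map    = λ v i → u i * v (f i)
      ; cong   = λ v≋w i → *-congˡ (v≋w (f i))
      ; linear = λ a v i → trans (*-distribˡ-sum (u i) (λ j → a j * v j (f i)))
          (∑-cong (λ j → solve 3 (λ x y z → x :* (y :* z) := y :* (x :* z)) refl (u i) (a j) (v j (f i)))) }

    -- `unmove g` is the action of g⁻¹, again monomial: the exponent is negated and read off at the
    -- image of the index.
    move unmove : G r n → LinearMap (Fin n) (Fin n)
    move   g = monomial (λ i → root (exps g i)) (perm g ⟨$⟩ˡ_)
    unmove g = monomial (λ i → root (⊟ exps g (perm g ⟨$⟩ʳ i))) (perm g ⟨$⟩ʳ_)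

    infixr 8 _▷_
    _▷_ : G r n → (Fin n → Carrier) → Fin n → Carrier
    g ▷ v = LinearMap.map (move g) v

    Fixed : G r n → (Fin n → Carrier) → Set ℓ₁
    Fixed g v = g ▷ v ≋ v

    -- Row i of a monomial matrix has its only nonzero entry in column σ⁻¹(i), so the matrix product
    -- collapses to one term.
    fixed⇔ : ∀ g → (∀ {v} → Fixed g v → FixedSpace g v) × (∀ {v} → FixedSpace g v → Fixed g v)
    fixed⇔ g = (λ {v} fix i → trans (rows v i) (fix i)) , (λ {v} fix i → trans (sym (rows v i)) (fix i))
      where
      rows : ∀ v i → ∑ (λ j → matrix g i j * v j) ≈ (g ▷ v) i
      rows v i = trans
        (∑-cong (λ j → trans (*-assoc _ _ _) (*-congʳ (indicator-⇔ ((perm g ⟨$⟩ʳ j) Fin.≟ i) (j Fin.≟ (perm g ⟨$⟩ˡ i))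
          (λ eq → ≡.sym (≡⟨$⟩ʳ⇒⟨$⟩ˡ≡ (perm g) (≡.sym eq))) (λ eq → ≡.trans (≡.cong (perm g ⟨$⟩ʳ_) eq) (inverseʳ (perm g)))))))
        (∑-sift (perm g ⟨$⟩ˡ i) (λ j → root (exps g i) * v j))

    ▷-≐ : ∀ {g h} → g ≐ h → ∀ v → g ▷ v ≋ h ▷ v
    ▷-≐ {g} {h} (p , q) v i = *-cong (reflexive (≡.cong root (q i))) (reflexive (≡.cong v (flip-cong {σ = perm g} {perm h} p i)))

    ▷-∙ : ∀ g h v → (g ∙ h) ▷ v ≋ g ▷ h ▷ v
    ▷-∙ g h v i = trans (*-congʳ (root-⊞ (exps g i) (exps h (perm g ⟨$⟩ˡ i)))) (*-assoc _ _ _)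

    fixed-≋ : ∀ g {v w} → v ≋ w → Fixed g v → Fixed g w
    fixed-≋ g v≋w fix i = trans (*-congˡ (sym (v≋w _))) (trans (fix i) (v≋w i))

    fixed-zero : ∀ g → Fixed g (λ _ → 0#)
    fixed-zero g i = zeroʳ _

    fixed-≐ : ∀ {g h} → g ≐ h → ∀ {d} → Basis (Fixed g) d → Basis (Fixed h) d
    fixed-≐ {g} {h} eq = basis-⇔ (λ {v} fix i → trans (sym (▷-≐ {g} {h} eq v i)) (fix i)) (λ {v} fix i → trans (▷-≐ {g} {h} eq v i) (fix i))

    -- From x h = w x it follows that x carries the fixed vectors of h to those of w, and x⁻¹
    -- carries them back.
    fixed-conjugate : ∀ x h w → (x ∙ h) ≐ (w ∙ x) → ∀ {d} → Basis (Fixed h) d → Basis (Fixed w) d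
    fixed-conjugate x h w eq = basis-transport (move x) (unmove x)
      (λ {v} fix i → begin
        (w ▷ x ▷ v) i       ≈⟨ ▷-∙ w x v i ⟨
        ((w ∙ x) ▷ v) i     ≈⟨ ▷-≐ {x ∙ h} {w ∙ x} eq v i ⟨
        ((x ∙ h) ▷ v) i     ≈⟨ ▷-∙ x h v i ⟩
        (x ▷ h ▷ v) i       ≈⟨ *-congˡ (fix _) ⟩
        (x ▷ v) i           ∎)
      (λ {v} fix i → begin
        (h ▷ x◁ v) i              ≈⟨ left (h ▷ x◁ v) i ⟨
        x◁ (x ▷ h ▷ x◁ v) i       ≈⟨ *-congˡ (▷-∙ x h (x◁ v) _) ⟨
        x◁ ((x ∙ h) ▷ x◁ v) i     ≈⟨ *-congˡ (▷-≐ {x ∙ h} {w ∙ x} eq (x◁ v) _) ⟩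
        x◁ ((w ∙ x) ▷ x◁ v) i     ≈⟨ *-congˡ (▷-∙ w x (x◁ v) _) ⟩
        x◁ (w ▷ x ▷ x◁ v) i       ≈⟨ *-congˡ (*-congˡ (right v _)) ⟩
        x◁ (w ▷ v) i              ≈⟨ *-congˡ (fix _) ⟩
        x◁ v i                    ∎)
      (λ {v} _ → left v) (λ {v} _ → right v)
      where
      x◁ : (Fin n → Carrier) → Fin n → Carrier
      x◁ = LinearMap.map (unmove x)
      left : ∀ v → x◁ (x ▷ v) ≋ v
      left v i = trans (sym (*-assoc _ _ _)) (trans (*-cong (root-⊟ (exps x (perm x ⟨$⟩ʳ i))) (reflexive (≡.cong v (inverseˡ (perm x))))) (*-identityˡ _))
      right : ∀ v → x ▷ x◁ v ≋ v
      right v i = trans (sym (*-assoc _ _ _)) (trans (*-cong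
        (trans (*-congˡ (reflexive (≡.cong (λ j → root (⊟ exps x j)) (inverseʳ (perm x))))) (trans (*-comm _ _) (root-⊟ (exps x i))))
        (reflexive (≡.cong v (inverseʳ (perm x))))) (*-identityˡ _))

  module _ {m n} (g : G r m) (h : G r n) where

    ⊕-invˡ : ∀ i → perm (g ⊕ h) ⟨$⟩ˡ (i ↑ˡ n) ≡ (perm g ⟨$⟩ˡ i) ↑ˡ n
    ⊕-invˡ i rewrite Fin.splitAt-↑ˡ m i n = ≡.refl

    ⊕-invʳ : ∀ j → perm (g ⊕ h) ⟨$⟩ˡ (m ↑ʳ j) ≡ m ↑ʳ (perm h ⟨$⟩ˡ j)
    ⊕-invʳ j rewrite Fin.splitAt-↑ʳ m n j = ≡.refl

    ⊕-permˡ : ∀ i → perm (g ⊕ h) ⟨$⟩ʳ (i ↑ˡ n) ≡ (perm g ⟨$⟩ʳ i) ↑ˡ n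
    ⊕-permˡ i rewrite Fin.splitAt-↑ˡ m i n = ≡.refl

    ⊕-permʳ : ∀ j → perm (g ⊕ h) ⟨$⟩ʳ (m ↑ʳ j) ≡ m ↑ʳ (perm h ⟨$⟩ʳ j)
    ⊕-permʳ j rewrite Fin.splitAt-↑ʳ m n j = ≡.refl

    ▷-⊕ˡ : ∀ v i → ((g ⊕ h) ▷ v) (i ↑ˡ n) ≈ (g ▷ (v ∘ (_↑ˡ n))) i
    ▷-⊕ˡ v i = *-cong (reflexive (≡.cong root (lookup-++ˡ (exps g) (exps h) i))) (reflexive (≡.cong v (⊕-invˡ i)))

    ▷-⊕ʳ : ∀ v j → ((g ⊕ h) ▷ v) (m ↑ʳ j) ≈ (h ▷ (v ∘ (m ↑ʳ_))) j
    ▷-⊕ʳ v j = *-cong (reflexive (≡.cong root (lookup-++ʳ (exps g) (exps h) j))) (reflexive (≡.cong v (⊕-invʳ j)))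

    fixed-⊕ : ∀ {d e} → Basis (Fixed g) d → Basis (Fixed h) e → Basis (Fixed (g ⊕ h)) (d ℕ.+ e)
    fixed-⊕ B₁ B₂ = basis-⇔
      (λ {v} (fix₁ , fix₂) → ↑-elim (λ x → ((g ⊕ h) ▷ v) x ≈ v x) (λ i → trans (▷-⊕ˡ v i) (fix₁ i)) (λ j → trans (▷-⊕ʳ v j) (fix₂ j)))
      (λ {v} fix → (λ i → trans (sym (▷-⊕ˡ v i)) (fix (i ↑ˡ n))) , λ j → trans (sym (▷-⊕ʳ v j)) (fix (m ↑ʳ j)))
      (basis-⊕ (fixed-≋ g) (fixed-≋ h) (fixed-zero g) (fixed-zero h) B₁ B₂)

  scalar : Fin r → G r 1
  scalar a = id , λ _ → a

  fixed-scalar-0 : ∀ {a} → a ≡ 0ᶠ → Basis (Fixed (scalar a)) 1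
  fixed-scalar-0 {a} a≡0 = record
    { vec         = λ _ _ → 1#
    ; vec∈        = λ _ _ → trans (*-congʳ (trans (reflexive (≡.cong root a≡0)) root-0)) (*-identityˡ 1#)
    ; spanning    = λ {v} _ → v , λ { zero → sym (trans (+-identityʳ _) (*-identityʳ _)) }
    ; independent = λ a eq → λ { zero → trans (sym (trans (+-identityʳ _) (*-identityʳ _))) (eq zero) } }

  -- Primitivity makes ζᵃ apart from 1, so the factor ζᵃ - 1 can be cancelled from (ζᵃ - 1) v = 0.
  fixed-scalar-≢0 : ∀ {a} → a ≢ 0ᶠ → Basis (Fixed (scalar a)) 0
  fixed-scalar-≢0 {a} a≢0 = record
    { vec         = λ ()
    ; vec∈        = λ ()
    ; spanning    = λ {v} fix → (λ ()) , λ { zero → unit⇒zero (unit-- root#1) (begin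
        (root a - 1#) * v zero              ≈⟨ trans (distribʳ _ _ _) (+-congˡ (-1*x≈-x _)) ⟩
        root a * v zero - v zero            ≈⟨ +-congʳ (fix zero) ⟩
        v zero - v zero                     ≈⟨ -‿inverseʳ _ ⟩
        0#                                  ∎) }
    ; independent = λ a eq () }
    where
    root#1 : root a # 1#
    root#1 = proj₂ ζ-primitive (toℕ a) (ℕ.n≢0⇒n>0 (λ eq → a≢0 (Fin.toℕ-injective (≡.trans eq (≡.sym toℕ-0ᶠ))))) (Fin.toℕ<n a)

  module _ {n} (σ : Permutation′ (suc n)) (a : Fin (suc n) → Fin r) where

    fixed-remove : σ ⟨$⟩ʳ zero ≡ zero → ∀ {d e} → Basis (Fixed (scalar (a zero))) d → Basis (Fixed (remove zero σ , a ∘ suc)) e →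
                   Basis (Fixed (σ , a)) (d ℕ.+ e)
    fixed-remove σ0≡0 B₁ B₂ = fixed-≐ {g = scalar (a zero) ⊕ (remove zero σ , a ∘ suc)} {σ , a}
      ((λ { zero → ≡.sym σ0≡0 ; (suc j) → Perm.lift₀-remove σ σ0≡0 (suc j) }) , λ { zero → ≡.refl ; (suc j) → ≡.refl })
      (fixed-⊕ (scalar (a zero)) (remove zero σ , a ∘ suc) B₁ B₂)

    module _ {q : Fin n} (σ0≡1+q : σ ⟨$⟩ʳ zero ≡ suc q) where

      -- Removing 0 from its cycle; its entry is multiplied onto that of its successor 1 + q.
      contract : Permutation′ n
      contract = remove zero (transpose zero (suc q) · σ)

      absorb : Fin n → Fin r
      absorb j = a (suc j) ⊞ (if does (j Fin.≟ q) then a zero else 0ᶠ)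

      contract-inv : ∀ j → suc (contract ⟨$⟩ˡ j) ≡ σ ⟨$⟩ˡ (transpose zero (suc q) ⟨$⟩ʳ suc j)
      contract-inv j = ≡.trans (flip-cong {σ = lift₀ contract} {transpose zero (suc q) · σ} (Perm.lift₀-remove (transpose zero (suc q) · σ) fixes) (suc j))
        (≡.cong (σ ⟨$⟩ˡ_) (transpose-inverse zero (suc q) (suc j)))
        where
        fixes : (transpose zero (suc q) · σ) ⟨$⟩ʳ zero ≡ zero
        fixes = ≡.trans (≡.cong (transpose zero (suc q) ⟨$⟩ʳ_) σ0≡1+q) (transpose-right zero (suc q))

      contract-inv-q : suc (contract ⟨$⟩ˡ q) ≡ σ ⟨$⟩ˡ zero
      contract-inv-q = ≡.trans (contract-inv q) (≡.cong (σ ⟨$⟩ˡ_) (transpose-right zero (suc q)))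

      contract-inv-≢q : ∀ {j} → j ≢ q → suc (contract ⟨$⟩ˡ j) ≡ σ ⟨$⟩ˡ suc j
      contract-inv-≢q {j} j≢q = ≡.trans (contract-inv j) (≡.cong (σ ⟨$⟩ˡ_) (transpose-other {a = zero} {suc q} {suc j} (λ ()) (j≢q ∘ Fin.suc-injective)))

      absorb-q : root (absorb q) ≈ root (a (suc q)) * root (a zero)
      absorb-q with q Fin.≟ q
      ... | yes _  = root-⊞ (a (suc q)) (a zero)
      ... | no q≢q = ⊥-elim (q≢q ≡.refl)

      absorb-≢q : ∀ {j} → j ≢ q → root (absorb j) ≈ root (a (suc j))
      absorb-≢q {j} j≢q with j Fin.≟ q
      ... | yes j≡q = ⊥-elim (j≢q j≡q)
      ... | no _    = reflexive (≡.cong root (⊞-identityʳ _))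

      -- The coordinate of a fixed vector at 0 is the entry at 0 times its coordinate at σ⁻¹(0), so
      -- the others determine it. The index `contract ⟨$⟩ˡ q` is σ⁻¹(0) in the numbering without 0.
      extend : LinearMap (Fin n) (Fin (suc n))
      extend = record
        { map    = λ v → λ { zero → root (a zero) * v (contract ⟨$⟩ˡ q) ; (suc j) → v j }
        ; cong   = λ v≋w → λ { zero → *-congˡ (v≋w _) ; (suc j) → v≋w j }
        ; linear = λ a′ v → λ { zero → trans (*-distribˡ-sum (root (a zero)) (λ i → a′ i * v i (contract ⟨$⟩ˡ q)))
            (∑-cong (λ i → solve 3 (λ x y z → x :* (y :* z) := y :* (x :* z)) refl (root (a zero)) (a′ i) (v i (contract ⟨$⟩ˡ q)))) ; (suc j) → refl } }

      restrict : LinearMap (Fin (suc n)) (Fin n)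
      restrict = record
        { map    = λ v → v ∘ suc
        ; cong   = λ v≋w → v≋w ∘ suc
        ; linear = λ a′ v j → refl }

      fixed-contract : ∀ {d} → Basis (Fixed (contract , absorb)) d → Basis (Fixed (σ , a)) d
      fixed-contract = basis-transport extend restrict extend-fixed restrict-fixed (λ _ _ → refl)
        λ {v} fix → λ { zero → trans (*-congˡ (reflexive (≡.cong v contract-inv-q))) (fix zero) ; (suc j) → refl }
        where
        extend-fixed : ∀ {v} → Fixed (contract , absorb) v → Fixed (σ , a) (LinearMap.map extend v)
        extend-fixed {v} fix zero = *-congˡ (reflexive (≡.cong (LinearMap.map extend v) (≡.sym contract-inv-q)))
        extend-fixed {v} fix (suc j) with j Fin.≟ q
        ... | no j≢q = begin
          root (a (suc j)) * LinearMap.map extend v (σ ⟨$⟩ˡ suc j)  ≈⟨ *-cong (sym (absorb-≢q j≢q)) (reflexive (≡.cong (LinearMap.map extend v) (≡.sym (contract-inv-≢q j≢q)))) ⟩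
          root (absorb j) * v (contract ⟨$⟩ˡ j)                     ≈⟨ fix j ⟩
          v j                                                      ∎
        ... | yes ≡.refl = begin
          root (a (suc q)) * LinearMap.map extend v (σ ⟨$⟩ˡ suc q)  ≈⟨ *-congˡ (reflexive (≡.cong (LinearMap.map extend v) (≡⟨$⟩ʳ⇒⟨$⟩ˡ≡ σ (≡.sym σ0≡1+q)))) ⟩
          root (a (suc q)) * (root (a zero) * v (contract ⟨$⟩ˡ q))  ≈⟨ *-assoc _ _ _ ⟨
          root (a (suc q)) * root (a zero) * v (contract ⟨$⟩ˡ q)    ≈⟨ *-congʳ absorb-q ⟨
          root (absorb q) * v (contract ⟨$⟩ˡ q)                     ≈⟨ fix q ⟩
          v q                                                      ∎
        restrict-fixed : ∀ {v} → Fixed (σ , a) v → Fixed (contract , absorb) (v ∘ suc)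
        restrict-fixed {v} fix j = cases (j Fin.≟ q)
          where
          cases : Dec (j ≡ q) → ((contract , absorb) ▷ (v ∘ suc)) j ≈ v (suc j)
          cases (no j≢q) = begin
            root (absorb j) * v (suc (contract ⟨$⟩ˡ j))  ≈⟨ *-cong (absorb-≢q j≢q) (reflexive (≡.cong v (contract-inv-≢q j≢q))) ⟩
            root (a (suc j)) * v (σ ⟨$⟩ˡ suc j)          ≈⟨ fix (suc j) ⟩
            v (suc j)                                    ∎
          cases (yes ≡.refl) = begin
            root (absorb q) * v (suc (contract ⟨$⟩ˡ q))            ≈⟨ *-cong absorb-q (reflexive (≡.cong v contract-inv-q)) ⟩
            root (a (suc q)) * root (a zero) * v (σ ⟨$⟩ˡ zero)     ≈⟨ *-assoc _ _ _ ⟩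
            root (a (suc q)) * (root (a zero) * v (σ ⟨$⟩ˡ zero))   ≈⟨ *-congˡ (fix zero) ⟩
            root (a (suc q)) * v zero                             ≈⟨ *-congˡ (reflexive (≡.cong v (≡⟨$⟩ʳ⇒⟨$⟩ˡ≡ σ (≡.sym σ0≡1+q)))) ⟨
            root (a (suc q)) * v (σ ⟨$⟩ˡ suc q)                    ≈⟨ fix (suc q) ⟩
            v (suc q)                                             ∎

  -- Deleting 0 repeatedly contracts each cycle to a point that carries the exponent of its
  -- cycle-product. The dimension grows exactly when this exponent is 0, so it counts the cycles
  -- with product 1.
  fixedBasis : ∀ {n} (g : G r n) → Σ[ d ∈ ℕ ] Basis (Fixed g) d
  fixedBasis {zero}  g = 0 , record
    { vec = λ () ; vec∈ = λ () ; spanning = λ _ → (λ ()) , λ () ; independent = λ _ _ () }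
  fixedBasis {suc n} (σ , a) with σ ⟨$⟩ʳ zero in eq
  ... | suc q = let d , B = fixedBasis (contract σ a eq , absorb σ a eq) in d , fixed-contract σ a eq B
  ... | zero with a zero Fin.≟ 0ᶠ | fixedBasis (remove zero σ , a ∘ suc)
  ...   | yes a0≡0 | d , B = suc d , fixed-remove σ a eq (fixed-scalar-0 a0≡0) B
  ...   | no  a0≢0 | d , B = d     , fixed-remove σ a eq (fixed-scalar-≢0 a0≢0) B

  fixedDim : ∀ {n} → G r n → ℕ
  fixedDim g = proj₁ (fixedBasis g)

  hasDimension : ∀ {n} (g : G r n) → HasDimension (FixedSpace g) (fixedDim g)
  hasDimension g = basis-⇔ (proj₁ (fixed⇔ g)) (proj₂ (fixed⇔ g)) (proj₂ (fixedBasis g))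

  module _ (char0 : CharacteristicZero) where

    -- The recursion defining `fixedDim` displays none of its invariance; each property below is
    -- obtained by exhibiting a second basis of the same space.
    fixedDim-unique : ∀ {n} (g : G r n) {d} → Basis (Fixed g) d → fixedDim g ≡ d
    fixedDim-unique g B = dimension-unique char0 (proj₂ (fixedBasis g)) B

    fixedDim-conjugate : ∀ {n} (x h w : G r n) → (x ∙ h) ≐ (w ∙ x) → fixedDim w ≡ fixedDim h
    fixedDim-conjugate x h w eq = fixedDim-unique w (fixed-conjugate x h w eq (proj₂ (fixedBasis h)))

    fixedDim-≐ : ∀ {n} (g h : G r n) → g ≐ h → fixedDim g ≡ fixedDim h
    fixedDim-≐ g h eq = fixedDim-unique g (fixed-≐ {g = h} {g} (≐-sym {g = g} {h} eq) (proj₂ (fixedBasis h)))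

    fixedDim-⊕ : ∀ {m n} (g : G r m) (h : G r n) → fixedDim (g ⊕ h) ≡ fixedDim g ℕ.+ fixedDim h
    fixedDim-⊕ g h = fixedDim-unique (g ⊕ h) (fixed-⊕ g h (proj₂ (fixedBasis g)) (proj₂ (fixedBasis h)))

    fixedDim-remove : ∀ {n} (σ : Permutation′ (suc n)) a → σ ⟨$⟩ʳ zero ≡ zero →
                      fixedDim (σ , a) ≡ fixedDim (scalar (a zero)) ℕ.+ fixedDim (remove zero σ , a ∘ suc)
    fixedDim-remove σ a eq = fixedDim-unique (σ , a)
      (fixed-remove σ a eq (proj₂ (fixedBasis (scalar (a zero)))) (proj₂ (fixedBasis (remove zero σ , a ∘ suc))))

    fixedDim-contract : ∀ {n} (σ : Permutation′ (suc n)) a {q} (eq : σ ⟨$⟩ʳ zero ≡ suc q) →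
                        fixedDim (σ , a) ≡ fixedDim (contract σ a eq , absorb σ a eq)
    fixedDim-contract σ a eq = fixedDim-unique (σ , a) (fixed-contract σ a eq (proj₂ (fixedBasis (contract σ a eq , absorb σ a eq))))

    fixedDim-scalar-0 : ∀ {a} → a ≡ 0ᶠ → fixedDim (scalar a) ≡ 1
    fixedDim-scalar-0 {a} a≡0 = fixedDim-unique (scalar a) (fixed-scalar-0 a≡0)

    fixedDim-scalar-≢0 : ∀ {a} → a ≢ 0ᶠ → fixedDim (scalar a) ≡ 0
    fixedDim-scalar-≢0 {a} a≢0 = fixedDim-unique (scalar a) (fixed-scalar-≢0 a≢0)

-- Geometric sums of roots of unity.

module RootsOfUnity {c ℓ₁ ℓ₂} (K : HeytingField c ℓ₁ ℓ₂) where
  open Over K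
  open FieldLaws K

  -- Both sides are 1 + x + ... + xⁿ; this form of the geometric sum avoids subtraction.
  1+x∑ : ∀ x n → 1# + x * ∑ {n} (λ i → x ^ toℕ i) ≈ ∑ {n} (λ i → x ^ toℕ i) + x ^ n
  1+x∑ x zero    = trans (+-congˡ (zeroʳ x)) (+-comm 1# 0#)
  1+x∑ x (suc n) = begin
    1# + x * S′                     ≈⟨ +-congˡ (*-congˡ unfold) ⟩
    1# + x * (1# + x * S)           ≈⟨ +-congˡ (*-congˡ (1+x∑ x n)) ⟩
    1# + x * (S + x ^ n)            ≈⟨ +-congˡ (distribˡ x S (x ^ n)) ⟩
    1# + (x * S + x * x ^ n)        ≈⟨ +-assoc _ _ _ ⟨
    1# + x * S + x * x ^ n          ≈⟨ +-congʳ unfold ⟨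
    S′ + x ^ suc n                  ∎
    where
    S S′ : Carrier
    S  = ∑ {n} (λ i → x ^ toℕ i)
    S′ = ∑ {suc n} (λ i → x ^ toℕ i)
    unfold : S′ ≈ 1# + x * S
    unfold = +-congˡ (sym (*-distribˡ-sum x (λ (i : Fin n) → x ^ toℕ i)))

  -- Multiplied by the invertible x - 1, the sum telescopes to xⁿ - 1 = 0.
  geometric-zero : ∀ {x n} → x ^ n ≈ 1# → x # 1# → ∑ {n} (λ i → x ^ toℕ i) ≈ 0#
  geometric-zero {x} {n} xⁿ≈1 x#1 = unit⇒zero (unit-- x#1) (begin
    (x - 1#) * S              ≈⟨ trans (distribʳ _ _ _) (+-congˡ (-1*x≈-x S)) ⟩
    x * S - S                 ≈⟨ +-congʳ (+-identityˡ _) ⟨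
    0# + x * S - S            ≈⟨ +-congʳ (+-congʳ (-‿inverseˡ 1#)) ⟨
    - 1# + 1# + x * S - S     ≈⟨ +-congʳ (+-assoc _ _ _) ⟩
    - 1# + (1# + x * S) - S   ≈⟨ +-congʳ (+-congˡ (trans (1+x∑ x n) (+-congˡ xⁿ≈1))) ⟩
    - 1# + (S + 1#) - S       ≈⟨ solve 4 (λ m s o n → m :+ (s :+ o) :+ n := (m :+ o) :+ (s :+ n)) refl (- 1#) S 1# (- S) ⟩
    (- 1# + 1#) + (S - S)     ≈⟨ +-cong (-‿inverseˡ 1#) (-‿inverseʳ S) ⟩
    0# + 0#                   ≈⟨ +-identityˡ 0# ⟩
    0#                        ∎)
    where
    S : Carrier
    S = ∑ {n} (λ i → x ^ toℕ i)

-- The class function ω, its cut rule and the value of s.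

module CycleWeights {c ℓ₁ ℓ₂} (K : HeytingField c ℓ₁ ℓ₂) (char0 : Over.CharacteristicZero K) (r : ℕ) .{{_ : NonZero r}}
               (ζ : Over.Carrier K) (ζ-primitive : Over.IsPrimitiveRoot K r ζ) (k : Fin r) (τ : Over.Carrier K) where
  open Over K
  open FieldLaws K
  open FiniteSums K
  open PermutationSums K
  open ContentPairing K using (∏-single)
  open GroupSums K
  open FixedSpaceBases K r ζ ζ-primitive
  open Reflection r ζ
  open CommutativeSemiringExp (CommutativeRing.commutativeSemiring commutativeRing) using (^-distrib-*)

  e : Fin r → Carrier
  e a = γ k (root a)

  e-⊞ : ∀ a b → e (a ⊞ b) ≈ e a * e b
  e-⊞ a b = trans (^-congˡ (toℕ k) (root-⊞ a b)) (^-distrib-* (root a) (root b) (toℕ k))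

  e-0 : e 0ᶠ ≈ 1#
  e-0 = trans (^-congˡ (toℕ k) root-0) (1^n (toℕ k))

  ∏-e : ∀ {n} (a : Fin n → Fin r) → γ k (∏ (root ∘ a)) ≈ ∏ (e ∘ a)
  ∏-e {zero}  a = 1^n (toℕ k)
  ∏-e {suc n} a = trans (^-distrib-* (root (a zero)) _ (toℕ k)) (*-congˡ (∏-e (a ∘ suc)))

  term : ∀ {n} → G r n → Carrier
  term g = ∏ (e ∘ exps g) * τ ^ fixedDim g

  ω : ∀ {n} → Permutation′ n → Carrier
  ω {n} σ = sumOver (Exps r n) (λ a → term (σ , a))

  -- The weight of a cycle of length one; longer cycles contribute it too, once contracted to a
  -- point.
  s : Carrier
  s = sumOver (allFin r) (λ a → e a * τ ^ fixedDim (scalar a))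

  τ^-cong : ∀ {m n} → m ≡ n → τ ^ m ≈ τ ^ n
  τ^-cong eq = reflexive (≡.cong (τ ^_) eq)

  term-≐ : ∀ {n} (g h : G r n) → g ≐ h → term g ≈ term h
  term-≐ g h eq = *-cong (∏-cong (λ i → reflexive (≡.cong e (proj₂ eq i)))) (τ^-cong (fixedDim-≐ char0 g h eq))

  ω-ext : ∀ {n} → Extensional (ω {n})
  ω-ext {n} {σ} {τ′} eq = sumOver-cong (Exps r n) (λ a → term-≐ (σ , a) (τ′ , a) (eq , λ _ → ≡.refl))

  -- Conjugation by the permutation matrix of ρ rearranges the diagonal entries, which changes
  -- neither their product nor the dimension of the fixed space.
  ω-conj : ∀ {n} (ρ σ : Permutation′ n) → ω ((ρ · σ) · flip ρ) ≈ ω σ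
  ω-conj {n} ρ σ = begin
    sumOver (Exps r n) (λ a → term (σ′ , a))
      ≈⟨ reindex (enumerates-Exps r n) (enumerates-Exps r n) (_∘ (ρ ⟨$⟩ˡ_)) (_∘ (ρ ⟨$⟩ʳ_))
           (λ {a} {b} eq i → ≡.sym (≡.trans (eq (ρ ⟨$⟩ʳ i)) (≡.cong a (inverseˡ ρ))))
           (λ {a} {b} eq i → ≡.sym (≡.trans (eq (ρ ⟨$⟩ˡ i)) (≡.cong b (inverseʳ ρ))))
           (λ a → term (σ′ , a)) (λ {a} {b} eq → term-≐ (σ′ , a) (σ′ , b) ((λ _ → ≡.refl) , eq)) ⟨
    sumOver (Exps r n) (λ a → term (σ′ , a ∘ (ρ ⟨$⟩ˡ_)))
      ≈⟨ sumOver-cong (Exps r n) (λ a → *-cong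
           (sym (∏-permute (e ∘ a) (flip ρ)))
           (τ^-cong (fixedDim-conjugate char0 (ρ , λ _ → 0ᶠ) (σ , a) (σ′ , a ∘ (ρ ⟨$⟩ˡ_)) (commutes a)))) ⟩
    sumOver (Exps r n) (λ a → term (σ , a)) ∎
    where
    σ′ = (ρ · σ) · flip ρ
    commutes : ∀ a → ((ρ , λ _ → 0ᶠ) ∙ (σ , a)) ≐ ((σ′ , a ∘ (ρ ⟨$⟩ˡ_)) ∙ (ρ , λ _ → 0ᶠ))
    commutes a = (λ i → ≡.cong (λ j → ρ ⟨$⟩ʳ (σ ⟨$⟩ʳ j)) (≡.sym (inverseˡ ρ))) , λ i → ⊞-comm 0ᶠ (a (ρ ⟨$⟩ˡ i))

  sumOver-Exps-suc : ∀ n (f : (Fin (suc n) → Fin r) → Carrier) →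
    sumOver (Exps r (suc n)) f ≈ sumOver (allFin r) (λ a₀ → sumOver (Exps r n) (λ a → f (Fin.∀-cons a₀ a)))
  sumOver-Exps-suc n = sumOver-cartesianProductWith Fin.∀-cons (allFin r) (Exps r n)

  -- The fixed point 0 forms a 1 × 1 block: the character value is multiplicative and the dimension
  -- additive over the two blocks.
  ω-remove : ∀ {n} (σ : Permutation′ (suc n)) → σ ⟨$⟩ʳ zero ≡ zero → ω σ ≈ s * ω (remove zero σ)
  ω-remove {n} σ σ0≡0 = begin
    ω σ
      ≈⟨ sumOver-Exps-suc n (λ a → term (σ , a)) ⟩
    sumOver (allFin r) (λ a₀ → sumOver (Exps r n) (λ a → e a₀ * ∏ (e ∘ a) * τ ^ fixedDim (σ , Fin.∀-cons a₀ a)))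
      ≈⟨ sumOver-cong (allFin r) (λ a₀ → sumOver-cong (Exps r n) (λ a → trans
           (*-congˡ (trans (τ^-cong (fixedDim-remove char0 σ (Fin.∀-cons a₀ a) σ0≡0)) (^-homo-* τ (fixedDim (scalar a₀)) _)))
           (solve 4 (λ x y z w → x :* y :* (z :* w) := x :* z :* (y :* w)) refl (e a₀) _ _ _))) ⟩
    sumOver (allFin r) (λ a₀ → sumOver (Exps r n) (λ a → e a₀ * τ ^ fixedDim (scalar a₀) * term (remove zero σ , a)))
      ≈⟨ sumOver-cong (allFin r) (λ a₀ → sym (sumOver-*ˡ _ (Exps r n) _)) ⟩
    sumOver (allFin r) (λ a₀ → e a₀ * τ ^ fixedDim (scalar a₀) * ω (remove zero σ))
      ≈⟨ sumOver-*ʳ (ω (remove zero σ)) (allFin r) _ ⟨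
    s * ω (remove zero σ) ∎

  shiftAt : ∀ {n} → Fin n → Fin r → (Fin n → Fin r) → Fin n → Fin r
  shiftAt q b a j = a j ⊞ (if does (j Fin.≟ q) then b else 0ᶠ)

  shiftAt-inverse : ∀ {n} (q : Fin n) b b′ → b ⊞ b′ ≡ 0ᶠ → ∀ a j → shiftAt q b′ (shiftAt q b a) j ≡ a j
  shiftAt-inverse q b b′ eq a j with j Fin.≟ q
  ... | yes _ = ≡.trans (⊞-assoc (a j) b b′) (≡.trans (≡.cong (a j ⊞_) eq) (⊞-identityʳ (a j)))
  ... | no  _ = ≡.trans (⊞-identityʳ (a j ⊞ 0ᶠ)) (⊞-identityʳ (a j))

  ∏-shiftAt : ∀ {n} (q : Fin n) b a → ∏ (e ∘ shiftAt q b a) ≈ e b * ∏ (e ∘ a)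
  ∏-shiftAt {n} q b a = begin
    ∏ (e ∘ shiftAt q b a)
      ≈⟨ ∏-cong (λ j → trans (e-⊞ (a j) _) (*-congˡ (split j))) ⟩
    ∏ (λ j → e (a j) * (if does (j Fin.≟ q) then e b else 1#))
      ≈⟨ ∏-distrib-* (e ∘ a) (λ j → if does (j Fin.≟ q) then e b else 1#) ⟩
    ∏ (e ∘ a) * ∏ (λ j → if does (j Fin.≟ q) then e b else 1#)
      ≈⟨ trans (*-congˡ (∏-single q (e b))) (*-comm _ _) ⟩
    e b * ∏ (e ∘ a) ∎
    where
    split : ∀ j → e (if does (j Fin.≟ q) then b else 0ᶠ) ≈ (if does (j Fin.≟ q) then e b else 1#)
    split j with j Fin.≟ q
    ... | yes _ = refl
    ... | no  _ = e-0

  -- For each exponent a₀ at 0, moving it onto the entry at q is a bijection on the remaining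
  -- exponents. The inner sum therefore does not depend on a₀, whose r values give the factor r.
  ω-contract : ∀ {n} (σ : Permutation′ (suc n)) {q} → σ ⟨$⟩ʳ zero ≡ suc q →
               ω σ ≈ (r ×ⁿ 1#) * ω (remove zero (transpose zero (suc q) · σ))
  ω-contract {n} σ {q} σ0≡1+q = begin
    ω σ
      ≈⟨ sumOver-Exps-suc n (λ a → term (σ , a)) ⟩
    sumOver (allFin r) (λ a₀ → sumOver (Exps r n) (λ a → e a₀ * ∏ (e ∘ a) * τ ^ fixedDim (σ , Fin.∀-cons a₀ a)))
      -- For the exponents with a₀ put in front of a, `absorb` unfolds to `shiftAt q a₀ a`.
      ≈⟨ sumOver-cong (allFin r) (λ a₀ → sumOver-cong (Exps r n) (λ a → *-cong (sym (∏-shiftAt q a₀ a))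
           (τ^-cong (fixedDim-contract char0 σ (Fin.∀-cons a₀ a) σ0≡1+q)))) ⟩
    sumOver (allFin r) (λ a₀ → sumOver (Exps r n) (λ a → term (ρ , shiftAt q a₀ a)))
      ≈⟨ sumOver-cong (allFin r) (λ a₀ → reindex (enumerates-Exps r n) (enumerates-Exps r n) (shiftAt q a₀) (shiftAt q (⊟ a₀))
           (λ {a} {b} eq j → ≡.sym (≡.trans (≡.cong (_⊞ _) (eq j)) (shiftAt-inverse q a₀ (⊟ a₀) (≡.trans (⊞-comm a₀ (⊟ a₀)) (⊞-inverseˡ a₀)) a j)))
           (λ {a} {b} eq j → ≡.sym (≡.trans (≡.cong (_⊞ _) (eq j)) (shiftAt-inverse q (⊟ a₀) a₀ (⊞-inverseˡ a₀) b j)))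
           (λ a → term (ρ , a)) (λ {a} {b} eq → term-≐ (ρ , a) (ρ , b) ((λ _ → ≡.refl) , eq))) ⟩
    sumOver (allFin r) (λ a₀ → ω ρ)
      ≈⟨ sumOver-const (allFin r) (ω ρ) ⟩
    (length (allFin r) ×ⁿ 1#) * ω ρ
      ≈⟨ *-congʳ (reflexive (≡.cong (_×ⁿ 1#) (length-tabulate {n = r} (λ i → i)))) ⟩
    (r ×ⁿ 1#) * ω ρ ∎
    where
    ρ = remove zero (transpose zero (suc q) · σ)

  ω-id : ∀ n → ω (id {n}) ≈ s ^ n
  ω-id zero    = trans (+-identityʳ _) (*-identityˡ 1#)
  ω-id (suc n) = trans (ω-remove id ≡.refl) (*-congˡ (trans (ω-ext {n} {remove zero id} {id} (λ _ → ≡.refl)) (ω-id n)))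

  -- Both sides reduce to the same smaller permutation: contracting 0 in σ costs a factor r,
  -- removing the fixed point 0 after the cut costs a factor s.
  ω-cut-zero : ∀ {n} (σ : Permutation′ (suc n)) {q} → σ ⟨$⟩ʳ zero ≡ suc q →
               s * ω σ ≈ (r ×ⁿ 1#) * ω (transpose zero (suc q) · σ)
  ω-cut-zero σ {q} σ0≡1+q = begin
    s * ω σ                                                   ≈⟨ *-congˡ (ω-contract σ σ0≡1+q) ⟩
    s * ((r ×ⁿ 1#) * ω (remove zero (transpose zero (suc q) · σ)))
      ≈⟨ solve 3 (λ x y z → x :* (y :* z) := y :* (x :* z)) refl s (r ×ⁿ 1#) _ ⟩
    (r ×ⁿ 1#) * (s * ω (remove zero (transpose zero (suc q) · σ)))
      ≈⟨ *-congˡ (ω-remove (transpose zero (suc q) · σ) (≡.trans (≡.cong (transpose zero (suc q) ⟨$⟩ʳ_) σ0≡1+q) (transpose-right zero (suc q)))) ⟨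
    (r ×ⁿ 1#) * ω (transpose zero (suc q) · σ)                ∎

  -- Conjugation by (0 p) reduces to p = 0.
  ω-cut : ∀ {n} (σ : Permutation′ n) p → σ ⟨$⟩ʳ p ≢ p → s * ω σ ≈ (r ×ⁿ 1#) * ω (transpose p (σ ⟨$⟩ʳ p) · σ)
  ω-cut {suc n} σ p σp≢p = cases (σ′ ⟨$⟩ʳ zero) ≡.refl
    where
    ρ σ′ : Permutation′ (suc n)
    ρ  = transpose zero p
    σ′ = (ρ · σ) · flip ρ
    ρ⁻¹0≡p : ρ ⟨$⟩ˡ zero ≡ p
    ρ⁻¹0≡p = ≡⟨$⟩ʳ⇒⟨$⟩ˡ≡ ρ (≡.sym (transpose-right zero p))
    cases : ∀ x → σ′ ⟨$⟩ʳ zero ≡ x → s * ω σ ≈ (r ×ⁿ 1#) * ω (transpose p (σ ⟨$⟩ʳ p) · σ)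
    cases zero    eq = ⊥-elim (σp≢p (perm-injective ρ (≡.trans
      (≡.trans (≡.cong (λ j → ρ ⟨$⟩ʳ (σ ⟨$⟩ʳ j)) (≡.sym ρ⁻¹0≡p)) eq) (≡.sym (transpose-right zero p)))))
    cases (suc q) eq = begin
      s * ω σ                                        ≈⟨ *-congˡ (ω-conj ρ σ) ⟨
      s * ω σ′                                       ≈⟨ ω-cut-zero σ′ eq ⟩
      (r ×ⁿ 1#) * ω (transpose zero (suc q) · σ′)    ≈⟨ *-congˡ (ω-ext {suc n} {transpose zero (suc q) · σ′} {(ρ · (transpose p (σ ⟨$⟩ʳ p) · σ)) · flip ρ} same) ⟩
      (r ×ⁿ 1#) * ω ((ρ · (transpose p (σ ⟨$⟩ʳ p) · σ)) · flip ρ)  ≈⟨ *-congˡ (ω-conj ρ (transpose p (σ ⟨$⟩ʳ p) · σ)) ⟩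
      (r ×ⁿ 1#) * ω (transpose p (σ ⟨$⟩ʳ p) · σ)     ∎
      where
      same : (transpose zero (suc q) · σ′) ≃ ((ρ · (transpose p (σ ⟨$⟩ʳ p) · σ)) · flip ρ)
      same i = ≡.sym (≡.trans (transpose-conj ρ p (σ ⟨$⟩ʳ p) (σ ⟨$⟩ʳ (ρ ⟨$⟩ˡ i)))
        (≡.cong₂ (λ x y → transpose x y ⟨$⟩ʳ (ρ ⟨$⟩ʳ (σ ⟨$⟩ʳ (ρ ⟨$⟩ˡ i)))) (transpose-right zero p)
          (≡.trans (≡.cong (λ j → ρ ⟨$⟩ʳ (σ ⟨$⟩ʳ j)) (≡.sym ρ⁻¹0≡p)) eq)))

module ShiftValue {c ℓ₁ ℓ₂} (K : HeytingField c ℓ₁ ℓ₂) (char0 : Over.CharacteristicZero K) (r : ℕ)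
                  (ζ : Over.Carrier K) (ζ-primitive : Over.IsPrimitiveRoot K (suc r) ζ) (k : Fin (suc r)) (τ : Over.Carrier K) where
  open Over K
  open FieldLaws K
  open FiniteSums K
  open RootsOfUnity K
  open FixedSpaceBases K (suc r) ζ ζ-primitive
  open Reflection (suc r) ζ
  open CycleWeights K char0 (suc r) ζ ζ-primitive k τ

  -- Orthogonality of characters: the sum is r for the trivial γ₀, and for k > 0 it is a geometric
  -- sum that vanishes.
  ∑-e : ∑ e ≈ 1# + shift k
  ∑-e = cases k ≡.refl
    where
    split-one : ∀ x → x ≈ 1# + (x - 1#)
    split-one x = sym (trans (+-comm _ _) (trans (+-assoc _ _ _) (trans (+-congˡ (-‿inverseˡ 1#)) (+-identityʳ x))))
    cases : ∀ k′ → k ≡ k′ → ∑ e ≈ 1# + shift k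
    cases zero    ≡.refl = trans (∑-replicate (suc r)) (split-one _)
    cases (suc j) ≡.refl = trans
      (∑-cong {suc r} (λ a → trans (^-assocʳ ζ (toℕ a) (suc (toℕ j))) (trans (reflexive (≡.cong (ζ ^_) (ℕ.*-comm (toℕ a) (suc (toℕ j)))))
        (sym (^-assocʳ ζ (suc (toℕ j)) (toℕ a))))))
      (trans (geometric-zero {ζ ^ suc (toℕ j)} {suc r} ζᵏʳ≈1 (proj₂ ζ-primitive (suc (toℕ j)) (ℕ.s≤s ℕ.z≤n) (Fin.toℕ<n (suc j))))
        (sym (-‿inverseʳ 1#)))
      where
      ζᵏʳ≈1 : (ζ ^ suc (toℕ j)) ^ suc r ≈ 1#
      ζᵏʳ≈1 = begin
        (ζ ^ suc (toℕ j)) ^ suc r     ≈⟨ ^-assocʳ ζ (suc (toℕ j)) (suc r) ⟩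
        ζ ^ (suc (toℕ j) ℕ.* suc r)   ≈⟨ reflexive (≡.cong (ζ ^_) (ℕ.*-comm (suc (toℕ j)) (suc r))) ⟩
        ζ ^ (suc r ℕ.* suc (toℕ j))   ≈⟨ ^-assocʳ ζ (suc r) (suc (toℕ j)) ⟨
        (ζ ^ suc r) ^ suc (toℕ j)     ≈⟨ ^-congˡ (suc (toℕ j)) (proj₁ ζ-primitive) ⟩
        1# ^ suc (toℕ j)              ≈⟨ 1^n (suc (toℕ j)) ⟩
        1#                            ∎

  -- The exponent 0 alone has a fixed vector and contributes τ. The others add up to the full
  -- character sum minus 1, which is the origin of r - 1 for k = 0 and of -1 for the other k.
  s≈τ+shift : s ≈ τ + shift k
  s≈τ+shift = begin
    s
      ≈⟨ reflexive (sumOver-tabulate (λ a → a) (λ a → e a * τ ^ fixedDim (scalar a))) ⟩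
    e zero * τ ^ fixedDim (scalar zero) + ∑ (λ j → e (suc j) * τ ^ fixedDim (scalar (suc j)))
      ≈⟨ +-cong (trans (*-cong e-0 (τ^-cong (fixedDim-scalar-0 char0 ≡.refl))) (trans (*-identityˡ _) (*-identityʳ τ)))
           (∑-cong {r} (λ j → trans (*-congˡ (τ^-cong (fixedDim-scalar-≢0 char0 {suc j} (λ ())))) (*-identityʳ (e (suc j))))) ⟩
    τ + ∑ (e ∘ suc)
      ≈⟨ +-congˡ (trans (sym (+-identityˡ _)) (trans (+-congʳ (sym (-‿inverseˡ 1#))) (+-assoc _ _ _))) ⟩
    τ + (- 1# + (1# + ∑ (e ∘ suc)))
      ≈⟨ +-congˡ (+-congˡ (trans (+-congʳ (sym e-0)) ∑-e)) ⟩
    τ + (- 1# + (1# + shift k))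
      ≈⟨ +-congˡ (trans (sym (+-assoc _ _ _)) (trans (+-congʳ (-‿inverseˡ 1#)) (+-identityˡ _))) ⟩
    τ + shift k ∎

-- Polynomials and their values at integers.

module Evaluation {c ℓ₁ ℓ₂} (K : HeytingField c ℓ₁ ℓ₂) where
  open Over K
  open FieldLaws K
  open Dimensions K using (×ⁿ-apart)

  eval : Carrier → Poly → Carrier
  eval x []      = 0#
  eval x (a ∷ p) = a + x * eval x p

  module _ (x : Carrier) where

    eval-+ : ∀ p q → eval x (p +ₚ q) ≈ eval x p + eval x q
    eval-+ []      q       = sym (+-identityˡ _)
    eval-+ (a ∷ p) []      = sym (+-identityʳ _)
    eval-+ (a ∷ p) (b ∷ q) = trans (+-congˡ (*-congˡ (eval-+ p q)))
      (solve 5 (λ x a b p q → a :+ b :+ x :* (p :+ q) := (a :+ x :* p) :+ (b :+ x :* q)) refl x a b (eval x p) (eval x q))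

    eval-∙ : ∀ a p → eval x (a ∙ₚ p) ≈ a * eval x p
    eval-∙ a []      = sym (zeroʳ a)
    eval-∙ a (b ∷ p) = trans (+-congˡ (*-congˡ (eval-∙ a p)))
      (solve 4 (λ x a b p → a :* b :+ x :* (a :* p) := a :* (b :+ x :* p)) refl x a b (eval x p))

    eval-* : ∀ p q → eval x (p *ₚ q) ≈ eval x p * eval x q
    eval-* []      q = sym (zeroˡ _)
    eval-* (a ∷ p) q = begin
      eval x ((a ∙ₚ q) +ₚ (0# ∷ (p *ₚ q)))           ≈⟨ eval-+ (a ∙ₚ q) (0# ∷ (p *ₚ q)) ⟩
      eval x (a ∙ₚ q) + (0# + x * eval x (p *ₚ q))   ≈⟨ +-cong (eval-∙ a q) (trans (+-identityˡ _) (*-congˡ (eval-* p q))) ⟩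
      a * eval x q + x * (eval x p * eval x q)       ≈⟨ solve 4 (λ x a p q → a :* q :+ x :* (p :* q) := (a :+ x :* p) :* q) refl x a (eval x p) (eval x q) ⟩
      (a + x * eval x p) * eval x q                  ∎

    eval-constant : ∀ a → eval x (constant a) ≈ a
    eval-constant a = trans (+-congˡ (zeroʳ x)) (+-identityʳ a)

    eval-t : eval x t ≈ x
    eval-t = trans (+-identityˡ _) (trans (*-congˡ (eval-constant 1#)) (*-identityʳ x))

    eval-t^ : ∀ d → eval x (t^ d) ≈ x ^ d
    eval-t^ zero    = eval-constant 1#
    eval-t^ (suc d) = trans (eval-* t (t^ d)) (*-cong eval-t (eval-t^ d))

    eval-∑ₚ : ∀ {A : Set} (f : A → Poly) (ys : List A) → eval x (∑ₚ (List.map f ys)) ≈ sumOver ys (eval x ∘ f)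
    eval-∑ₚ f []       = refl
    eval-∑ₚ f (y ∷ ys) = trans (eval-+ (f y) _) (+-congˡ (eval-∑ₚ f ys))

    eval-∏ₚ-map : ∀ {A : Set} (f : A → Poly) (ys : List A) → eval x (∏ₚ (List.map f ys)) ≈ ∏ (λ i → eval x (f (lookup ys i)))
    eval-∏ₚ-map f []       = eval-constant 1#
    eval-∏ₚ-map f (y ∷ ys) = trans (eval-* (f y) _) (*-congˡ (eval-∏ₚ-map f ys))

    eval-∏ₚ-tabulate : ∀ {n} (f : Fin n → Poly) → eval x (∏ₚ (List.tabulate f)) ≈ ∏ (eval x ∘ f)
    eval-∏ₚ-tabulate {zero}  f = eval-constant 1#
    eval-∏ₚ-tabulate {suc n} f = trans (eval-* (f zero) _) (*-congˡ (eval-∏ₚ-tabulate (f ∘ suc)))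

  coeff-+ : ∀ p q i → coeff (p +ₚ q) i ≈ coeff p i + coeff q i
  coeff-+ []      q       i       = sym (+-identityˡ _)
  coeff-+ (a ∷ p) []      i       = sym (+-identityʳ _)
  coeff-+ (a ∷ p) (b ∷ q) zero    = refl
  coeff-+ (a ∷ p) (b ∷ q) (suc i) = coeff-+ p q i

  coeff-∙ : ∀ a p i → coeff (a ∙ₚ p) i ≈ a * coeff p i
  coeff-∙ a []      i       = sym (zeroʳ a)
  coeff-∙ a (b ∷ p) zero    = refl
  coeff-∙ a (b ∷ p) (suc i) = coeff-∙ a p i

  -- The quotient of a ∷ p by t - y, which does not depend on a.
  quotient : Carrier → Poly → Poly
  quotient y []      = []
  quotient y (b ∷ p) = eval y (b ∷ p) ∷ quotient y p

  length-quotient : ∀ y p → length (quotient y p) ≡ length p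
  length-quotient y []      = ≡.refl
  length-quotient y (b ∷ p) = ≡.cong suc (length-quotient y p)

  -- The remainder theorem, by Horner's rule; the inductive step rewrites x as y + (x - y).
  division : ∀ x y a p → eval x (a ∷ p) ≈ eval y (a ∷ p) + (x - y) * eval x (quotient y p)
  division x y a [] = begin
    a + x * 0#                     ≈⟨ +-congˡ (trans (zeroʳ x) (sym (zeroʳ y))) ⟩
    a + y * 0#                     ≈⟨ +-identityʳ _ ⟨
    a + y * 0# + 0#                ≈⟨ +-congˡ (zeroʳ (x - y)) ⟨
    a + y * 0# + (x - y) * 0#      ∎
  division x y a p@(b ∷ p′) = begin
    a + x * eval x p
      ≈⟨ +-congˡ (*-congˡ (division x y b p′)) ⟩
    a + x * (P + (x - y) * D)
      ≈⟨ +-congˡ (trans (distribˡ x P _) (+-congʳ (*-congʳ x≈))) ⟩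
    a + ((y + (x - y)) * P + x * ((x - y) * D))
      ≈⟨ solve 6 (λ x y z a p d → a :+ ((y :+ z) :* p :+ x :* (z :* d)) := a :+ y :* p :+ z :* (p :+ x :* d)) refl x y (x - y) a P D ⟩
    a + y * P + (x - y) * (P + x * D) ∎
    where
    P D : Carrier
    P = eval y p
    D = eval x (quotient y p′)
    x≈ : x ≈ y + (x - y)
    x≈ = sym (trans (+-comm y _) (trans (+-assoc x (- y) y) (trans (+-congˡ (-‿inverseˡ y)) (+-identityʳ x))))

  quotient-zero : ∀ y p → (∀ i → coeff (quotient y p) i ≈ 0#) → eval y p ≈ 0#
  quotient-zero y []      _    = refl
  quotient-zero y (b ∷ p) zero≈ = zero≈ 0

  head-zero : ∀ y a p → eval y (a ∷ p) ≈ 0# → eval y p ≈ 0# → a ≈ 0#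
  head-zero y a p ap≈0 p≈0 = trans (sym (trans (+-congˡ (trans (*-congˡ p≈0) (zeroʳ y))) (+-identityʳ a))) ap≈0

  -- The entries of the quotient are the values at y of the successive tails of p; when two
  -- consecutive tails vanish there, so does the coefficient between them.
  quotient-reflects-zero : ∀ y p → (∀ i → coeff (quotient y p) i ≈ 0#) → ∀ i → coeff p i ≈ 0#
  quotient-reflects-zero y []      _     i       = refl
  quotient-reflects-zero y (b ∷ p) zero≈ zero    = head-zero y b p (zero≈ 0) (quotient-zero y p (zero≈ ∘ suc))
  quotient-reflects-zero y (b ∷ p) zero≈ (suc i) = quotient-reflects-zero y p (zero≈ ∘ suc) i

  module _ (char0 : CharacteristicZero) where

    -- The root k is divided out, and the quotient vanishes at every integer m > k because m - k is
    -- invertible. The length is an explicit argument, as the quotient is not a structural part of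
    -- the polynomial.
    vanishing : ∀ n p → length p ≡ n → ∀ k → (∀ m → k ℕ.≤ m → eval (m ×ⁿ 1#) p ≈ 0#) → ∀ i → coeff p i ≈ 0#
    vanishing _       []      _   k root≈0 i = refl
    vanishing (suc n) (a ∷ p) len k root≈0   = λ { zero → head-zero y a p root≈y (quotient-zero y p Q≈0) ; (suc i) → quotient-reflects-zero y p Q≈0 i }
      where
      y : Carrier
      y = k ×ⁿ 1#
      root≈y : eval y (a ∷ p) ≈ 0#
      root≈y = root≈0 k ℕ.≤-refl
      Q≈0 : ∀ i → coeff (quotient y p) i ≈ 0#
      Q≈0 = vanishing n (quotient y p) (≡.trans (length-quotient y p) (ℕ.suc-injective len)) (suc k) (λ m k<m →
        unit⇒zero (unit-- (×ⁿ-apart char0 k<m)) (begin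
          (m ×ⁿ 1# - y) * eval (m ×ⁿ 1#) (quotient y p)                      ≈⟨ +-identityˡ _ ⟨
          0# + (m ×ⁿ 1# - y) * eval (m ×ⁿ 1#) (quotient y p)                 ≈⟨ +-congʳ root≈y ⟨
          eval y (a ∷ p) + (m ×ⁿ 1# - y) * eval (m ×ⁿ 1#) (quotient y p)     ≈⟨ division (m ×ⁿ 1#) y a p ⟨
          eval (m ×ⁿ 1#) (a ∷ p)                                           ≈⟨ root≈0 m (ℕ.<⇒≤ k<m) ⟩
          0#                                                              ∎))

    -- The bound k allows finitely many integers to be skipped, namely those where some factor s
    -- fails to be invertible.
    eval-injective : ∀ k p q → (∀ m → k ℕ.≤ m → eval (m ×ⁿ 1#) p ≈ eval (m ×ⁿ 1#) q) → p ≈ₚ q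
    eval-injective k p q eq i = x-y≈0⇒x≈y (begin
      coeff p i - coeff q i           ≈⟨ +-congˡ (trans (coeff-∙ (- 1#) q i) (-1*x≈-x _)) ⟨
      coeff p i + coeff (- 1# ∙ₚ q) i ≈⟨ coeff-+ p (- 1# ∙ₚ q) i ⟨
      coeff (p +ₚ (- 1# ∙ₚ q)) i      ≈⟨ vanishing _ (p +ₚ (- 1# ∙ₚ q)) ≡.refl k (λ m k≤m → begin
        eval (m ×ⁿ 1#) (p +ₚ (- 1# ∙ₚ q))                      ≈⟨ eval-+ _ p (- 1# ∙ₚ q) ⟩
        eval (m ×ⁿ 1#) p + eval (m ×ⁿ 1#) (- 1# ∙ₚ q)          ≈⟨ +-cong (eq m k≤m) (trans (eval-∙ _ (- 1#) q) (-1*x≈-x _)) ⟩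
        eval (m ×ⁿ 1#) q - eval (m ×ⁿ 1#) q                    ≈⟨ -‿inverseʳ _ ⟩
        0#                                                     ∎) i ⟩
      0# ∎)

-- Summing an induced character against a class function.

module InducedCharacters {c ℓ₁ ℓ₂} (K : HeytingField c ℓ₁ ℓ₂) (char0 : Over.CharacteristicZero K) (r : ℕ) .{{_ : NonZero r}}
                         (ζ : Over.Carrier K) (ζ-primitive : Over.IsPrimitiveRoot K r ζ) where
  open Over K
  open FieldLaws K
  open FiniteSums K
  open GroupSums K
  open Dimensions K
  open FixedSpaceBases K r ζ ζ-primitive
  open Reflection r ζ

  -- What a function must satisfy for its sum against χ to split over the blocks. The two instances
  -- are τ to the power dim, for the Poincaré sum, and the indicator of the identity, for χ(1).
  record MultiplicativeClassFunction : Set (c ⊔ ℓ₁) where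
    field
      value       : ∀ {n} → G r n → Carrier
      value-≐     : ∀ {n} (g h : G r n) → g ≐ h → value g ≈ value h
      value-conj  : ∀ {n} (x h w : G r n) → (x ∙ h) ≐ (w ∙ x) → value w ≈ value h
      value-⊕     : ∀ {m n} (g : G r m) (h : G r n) → value (g ⊕ h) ≈ value g * value h
      value-empty : value {0} (id , λ ()) ≈ 1#

    value-blockDiagonal : ∀ {s} {ns : Fin s → ℕ} (h : ∀ k → G r (ns k)) → value (blockDiagonal h) ≈ ∏ (λ k → value (h k))
    value-blockDiagonal {zero}  h = value-empty
    value-blockDiagonal {suc s} h = trans (value-⊕ (h zero) _) (*-congˡ (value-blockDiagonal (h ∘ suc)))

    value-subst : ∀ {m n} (eq : m ≡ n) (g : G r m) → value (≡.subst (G r) eq g) ≈ value g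
    value-subst ≡.refl g = refl

  open MultiplicativeClassFunction

  powerOfDimension : Carrier → MultiplicativeClassFunction
  powerOfDimension τ = record
    { value       = λ g → τ ^ fixedDim g
    ; value-≐     = λ g h eq → τ^-cong (fixedDim-≐ char0 g h eq)
    ; value-conj  = λ x h w eq → τ^-cong (fixedDim-conjugate char0 x h w eq)
    ; value-⊕     = λ g h → trans (τ^-cong (fixedDim-⊕ char0 g h)) (^-homo-* τ (fixedDim g) (fixedDim h))
    ; value-empty = refl }
    where
    τ^-cong : ∀ {m n} → m ≡ n → τ ^ m ≈ τ ^ n
    τ^-cong eq = reflexive (≡.cong (τ ^_) eq)

  identity-⊕ : ∀ {m n} (g : G r m) (h : G r n) → IsIdentity (g ⊕ h) → IsIdentity g × IsIdentity h
  identity-⊕ {m} {n} g h (p , q) =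
    ( (λ i → Fin.↑ˡ-injective n _ _ (≡.trans (≡.sym (⊕-permˡ g h i)) (p (i ↑ˡ n))))
    , (λ i → ≡.trans (≡.sym (lookup-++ˡ (exps g) (exps h) i)) (q (i ↑ˡ n))) ) ,
    ( (λ j → Fin.↑ʳ-injective m _ _ (≡.trans (≡.sym (⊕-permʳ g h j)) (p (m ↑ʳ j))))
    , (λ j → ≡.trans (≡.sym (lookup-++ʳ (exps g) (exps h) j)) (q (m ↑ʳ j))) )

  identity-⊕⁻ : ∀ {m n} (g : G r m) (h : G r n) → IsIdentity g → IsIdentity h → IsIdentity (g ⊕ h)
  identity-⊕⁻ {m} {n} g h (p₁ , q₁) (p₂ , q₂) =
    ↑-elim (λ x → perm (g ⊕ h) ⟨$⟩ʳ x ≡ x)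
      (λ i → ≡.trans (⊕-permˡ g h i) (≡.cong (_↑ˡ n) (p₁ i))) (λ j → ≡.trans (⊕-permʳ g h j) (≡.cong (m ↑ʳ_) (p₂ j))) ,
    ↑-elim (λ x → exps (g ⊕ h) x ≡ 0ᶠ)
      (λ i → ≡.trans (lookup-++ˡ (exps g) (exps h) i) (q₁ i)) (λ j → ≡.trans (lookup-++ʳ (exps g) (exps h) j) (q₂ j))

  atIdentity : MultiplicativeClassFunction
  atIdentity = record
    { value       = λ g → indicator (g ≐? 1ᴳ)
    ; value-≐     = λ g h (p , q) → indicator-⇔ (g ≐? 1ᴳ) (h ≐? 1ᴳ)
        (λ (p′ , q′) → (λ i → ≡.trans (≡.sym (p i)) (p′ i)) , λ i → ≡.trans (≡.sym (q i)) (q′ i))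
        (λ (p′ , q′) → (λ i → ≡.trans (p i) (p′ i)) , λ i → ≡.trans (q i) (q′ i))
    ; value-conj  = λ x h w eq → indicator-⇔ (w ≐? 1ᴳ) (h ≐? 1ᴳ) (identity-conj⁻ x h w eq) (identity-conj x h w eq)
    ; value-⊕     = λ g h → indicator-× ((g ⊕ h) ≐? 1ᴳ) (g ≐? 1ᴳ) (h ≐? 1ᴳ) (identity-⊕ g h) (identity-⊕⁻ g h)
    ; value-empty = indicator-yes (_≐?_ {n = 0} (id , λ ()) 1ᴳ) ((λ ()) , λ ()) }

  -- An empty list would make the sum of indicators 0 instead of 1, so the length is positive, hence
  -- invertible in characteristic zero.
  length-unit : ∀ {A : Set} {_~_ : A → A → Set} {xs : List A} → Enumerates _~_ xs → A → Unit (length xs ×ⁿ 1#)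
  length-unit {xs = []}     E y = ⊥-elim (#⇒≉ (char0 1) (trans (+-identityʳ 1#) (sym (once E y))))
  length-unit {xs = x ∷ xs} E y = unit (char0 (suc (length xs)))

  module _ {n} (Λ : MultiPartition r n) where
    open MultiPartition Λ
    open BlockSubgroup Λ

    allH-unit : Unit (length allH ×ⁿ 1#)
    allH-unit = length-unit (enumerates-allΠ (λ k → enumerates-allG r (size (component k)))) (λ k → 1ᴳ)

    allG-unit : Unit (length (allG r n) ×ⁿ 1#)
    allG-unit = length-unit (enumerates-allG r n) 1ᴳ

    module _ {ψ : H → Carrier} {χ : G r n → Carrier} (induced : IsInduced Λ ψ χ) where

      ind : G r n → G r n → H → Carrier
      ind g x h = indicator ((x ∙ ι h) ≐? (g ∙ x))

      -- A form of Frobenius reciprocity. For given x and h exactly one w satisfies x h = w x, up to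
      -- `_≐_`, namely the conjugate of ι h, and F agrees on the two; so every x in G contributes
      -- the same sum over H.
      induced-sum : ∀ F → (length allH ×ⁿ 1#) * sumOver (allG r n) (λ w → χ w * value F w) ≈
                          (length (allG r n) ×ⁿ 1#) * sumOver allH (λ h → ψ h * ∏ (λ k → value F (h k)))
      induced-sum F = begin
        (length allH ×ⁿ 1#) * sumOver Gs (λ w → χ w * value F w)
          ≈⟨ trans (sumOver-*ˡ _ Gs _) (sumOver-cong Gs (λ w → trans (sym (*-assoc _ _ _))
               (*-congʳ (trans (sym (×ⁿ-* (length allH) (χ w))) (induced w))))) ⟩
        sumOver Gs (λ w → sumOver Gs (λ x → sumOver allH (λ h → ind w x h * ψ h)) * value F w)
          ≈⟨ sumOver-cong Gs (λ w → trans (sumOver-*ʳ (value F w) Gs _) (sumOver-cong Gs (λ x → sumOver-*ʳ (value F w) allH _))) ⟩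
        sumOver Gs (λ w → sumOver Gs (λ x → sumOver allH (λ h → ind w x h * ψ h * value F w)))
          ≈⟨ trans (sumOver-swap Gs Gs _) (sumOver-cong Gs (λ x → sumOver-swap Gs allH _)) ⟩
        sumOver Gs (λ x → sumOver allH (λ h → sumOver Gs (λ w → ind w x h * ψ h * value F w)))
          ≈⟨ sumOver-cong Gs (λ x → sumOver-cong allH (λ h → trans (sumOver-cong Gs (λ w → *-assoc _ _ _)) (conjugates x h))) ⟩
        sumOver Gs (λ x → sumOver allH (λ h → ψ h * ∏ (λ k → value F (h k))))
          ≈⟨ sumOver-const Gs _ ⟩
        (length Gs ×ⁿ 1#) * sumOver allH (λ h → ψ h * ∏ (λ k → value F (h k))) ∎
        where
        Gs = allG r n
        conjugates : ∀ x h → sumOver Gs (λ w → ind w x h * (ψ h * value F w)) ≈ ψ h * ∏ (λ k → value F (h k))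
        conjugates x h = begin
          sumOver Gs (λ w → ind w x h * (ψ h * value F w))
            ≈⟨ sift (enumerates-allG r n) (λ w → (x ∙ ι h) ≐? (w ∙ x)) (conjugate x (ι h))
                 (λ {w} → commutes⇒conjugate {x = x} {ι h} {w}) (λ {w} → conjugate⇒commutes {x = x} {ι h} {w})
                 (λ w → ψ h * value F w) (λ {w} eq → *-congˡ (value-≐ F w (conjugate x (ι h)) eq)) ⟩
          ψ h * value F (conjugate x (ι h))
            ≈⟨ *-congˡ (value-conj F x (ι h) (conjugate x (ι h)) (conjugate⇒commutes {x = x} {ι h} {conjugate x (ι h)} (≐-refl {g = conjugate x (ι h)}))) ⟩
          ψ h * value F (ι h)
            ≈⟨ *-congˡ (trans (value-subst F total (blockDiagonal h)) (value-blockDiagonal F h)) ⟩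
          ψ h * ∏ (λ k → value F (h k)) ∎

      -- The induction formula determines |H| χ(g) by conditions that respect `_≐_`, and |H| is
      -- invertible.
      χ-≐ : ∀ g g′ → g ≐ g′ → χ g ≈ χ g′
      χ-≐ g g′ (p , q) = cancelˡ allH-unit (begin
        (length allH ×ⁿ 1#) * χ g     ≈⟨ ×ⁿ-* (length allH) (χ g) ⟨
        length allH ×ⁿ χ g            ≈⟨ induced g ⟩
        sumOver (allG r n) (λ x → sumOver allH (λ h → ind g x h * ψ h))
          ≈⟨ sumOver-cong (allG r n) (λ x → sumOver-cong allH (λ h → *-congʳ
               (indicator-⇔ ((x ∙ ι h) ≐? (g ∙ x)) ((x ∙ ι h) ≐? (g′ ∙ x)) (multiply {g} {g′} {x ∙ ι h} x p q)
                 (multiply {g′} {g} {x ∙ ι h} x (λ i → ≡.sym (p i)) (λ i → ≡.sym (q i)))))) ⟩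
        sumOver (allG r n) (λ x → sumOver allH (λ h → ind g′ x h * ψ h))
          ≈⟨ induced g′ ⟨
        length allH ×ⁿ χ g′           ≈⟨ ×ⁿ-* (length allH) (χ g′) ⟩
        (length allH ×ⁿ 1#) * χ g′    ∎)
        where
        multiply : ∀ {g g′ y : G r n} x → perm g ≃ perm g′ → (∀ i → exps g i ≡ exps g′ i) → y ≐ (g ∙ x) → y ≐ (g′ ∙ x)
        multiply {g} {g′} x p q (p′ , q′) = (λ i → ≡.trans (p′ i) (p (perm x ⟨$⟩ʳ i))) , λ i → ≡.trans (q′ i)
          (≡.cong₂ _⊞_ (q i) (≡.cong (exps x) (flip-cong {σ = perm g} {perm g′} p i)))

      sum-atIdentity : sumOver (allG r n) (λ w → χ w * value atIdentity w) ≈ χ 1ᴳ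
      sum-atIdentity = trans (sumOver-cong (allG r n) (λ w → *-comm _ _))
        (sift (enumerates-allG r n) (_≐? 1ᴳ) 1ᴳ (λ p → p) (λ p → p) χ (λ {w} eq → χ-≐ w 1ᴳ eq))

    module _ (φ : ∀ k → Permutation′ (size (component k)) → Carrier) where

      outer : H → Carrier
      outer h = ∏ (λ k → φ k (perm (h k)) * γ k (entryProduct (h k)))

      block : MultiplicativeClassFunction → Fin r → Carrier
      block F k = sumOver (allG r (size (component k))) (λ g → φ k (perm g) * γ k (entryProduct g) * value F g)

      outer-sum : ∀ F → sumOver allH (λ h → outer h * ∏ (λ k → value F (h k))) ≈ ∏ (block F)
      outer-sum F = trans
        (sumOver-cong allH (λ h → sym (∏-distrib-* (λ k → φ k (perm (h k)) * γ k (entryProduct (h k))) (λ k → value F (h k)))))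
        (sumOver-allΠ-∏ (λ k → allG r (size (component k))) (λ k g → φ k (perm g) * γ k (entryProduct g) * value F g))

-- Evaluating the blocks and assembling the Poincaré polynomial.

module Blocks {c ℓ₁ ℓ₂} (K : HeytingField c ℓ₁ ℓ₂) (char0 : Over.CharacteristicZero K) (r : ℕ)
              (ζ : Over.Carrier K) (ζ-primitive : Over.IsPrimitiveRoot K (suc r) ζ) {n : ℕ} (Λ : MultiPartition (suc r) n) where
  open Over K
  open FieldLaws K
  open FiniteSums K
  open PermutationSums K
  open GroupSums K
  open SpechtModules K
  open FixedSpaceBases K (suc r) ζ ζ-primitive using (root; fixedDim; hasDimension; root-0)
  open Reflection (suc r) ζ
  open InducedCharacters K char0 (suc r) ζ ζ-primitive
  open MultiplicativeClassFunction
  open Evaluation K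
  open MultiPartition Λ

  module _ (φ : ∀ k → Permutation′ (size (component k)) → Carrier)
           (char : ∀ k → IsSymmetricCharacter (component k) (φ k)) where

    degree : Fin (suc r) → Carrier
    degree k = proj₁ (char k) ×ⁿ 1#

    -- Only σ = 1 with all exponents 0 survives, which leaves φₖ(1), the dimension of the Specht
    -- module.
    block-atIdentity : ∀ k → block Λ φ atIdentity k ≈ degree k
    block-atIdentity k = begin
      sumOver (allG (suc r) m) (λ g → φ k (perm g) * γ k (entryProduct g) * indicator (g ≐? 1ᴳ))
        ≈⟨ sumOver-allG (suc r) m _ ⟩
      sumOver (allPerms m) (λ σ → sumOver (Exps (suc r) m) (λ a → φ k σ * γ k (∏ (root ∘ a)) * indicator ((σ , a) ≐? 1ᴳ)))
        ≈⟨ sumOver-cong (allPerms m) (λ σ → trans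
             (sumOver-cong (Exps (suc r) m) (λ a → trans
               (*-congˡ (indicator-× ((σ , a) ≐? 1ᴳ) (_~?_ (enumerates-allPerms m) σ id) (zero? a) (λ p → p) _,_))
               (solve 4 (λ x y z w → x :* y :* (z :* w) := z :* x :* (w :* y)) refl (φ k σ) _ _ _)))
             (trans (sym (sumOver-*ˡ _ (Exps (suc r) m) _)) (trans (*-congˡ sum-zero) (*-identityʳ _)))) ⟩
      sumOver (allPerms m) (λ σ → indicator (_~?_ (enumerates-allPerms m) σ id) * φ k σ)
        ≈⟨ trace-id (component k) (char k) ⟩
      degree k ∎
      where
      m = size (component k)
      zero? : ∀ a → Dec (∀ i → a i ≡ 0ᶠ)
      zero? a = _~?_ (enumerates-Exps (suc r) m) a (λ _ → 0ᶠ)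
      sum-zero : sumOver (Exps (suc r) m) (λ a → indicator (zero? a) * γ k (∏ (root ∘ a))) ≈ 1#
      sum-zero = trans
        (sift (enumerates-Exps (suc r) m) zero? (λ _ → 0ᶠ) (λ p → p) (λ p → p) (λ a → γ k (∏ (root ∘ a)))
          (λ eq → ^-congˡ (toℕ k) (∏-cong (λ i → reflexive (≡.cong root (eq i))))))
        (trans (^-congˡ (toℕ k) (trans (∏-cong {m} (λ _ → root-0)) (∏-one m))) (1^n (toℕ k)))

    module _ (2-unit : Unit (1# + 1#)) (τ : Carrier) where

      boxFactor : ∀ k → Box → Carrier
      boxFactor k b = τ + (shift k + (suc r ×ⁿ 1#) * content b)

      block-powerOfDimension : ∀ k → Unit (τ + shift k) →
        block Λ φ (powerOfDimension τ) k ≈ degree k * ∏ (λ i → boxFactor k (lookup (boxes (component k)) i))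
      block-powerOfDimension k s-unit = begin
        sumOver (allG (suc r) m) (λ g → φ k (perm g) * γ k (entryProduct g) * τ ^ fixedDim g)
          ≈⟨ sumOver-allG (suc r) m _ ⟩
        sumOver (allPerms m) (λ σ → sumOver (Exps (suc r) m) (λ a → φ k σ * γ k (∏ (root ∘ a)) * τ ^ fixedDim (σ , a)))
          ≈⟨ sumOver-cong (allPerms m) (λ σ → trans
               (sumOver-cong (Exps (suc r) m) (λ a → trans (*-assoc _ _ _) (*-congˡ (*-congʳ (∏-e a)))))
               (trans (sym (sumOver-*ˡ (φ k σ) (Exps (suc r) m) _)) (*-comm _ _))) ⟩
        sumOver (allPerms m) (λ σ → ω σ * φ k σ)
          ≈⟨ trace-content (component k) 2-unit s (suc r ×ⁿ 1#) (unit-cong (sym s≈τ+shift) s-unit) ω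
               (λ {σ} {ρ} → ω-ext {m} {σ} {ρ}) (ω-id m) ω-cut ω-conj (char k) ⟩
        degree k * ∏ (λ i → s + (suc r ×ⁿ 1#) * content (lookup (boxes (component k)) i))
          ≈⟨ *-congˡ (∏-cong {m} (λ i → trans (+-congʳ s≈τ+shift) (+-assoc _ _ _))) ⟩
        degree k * ∏ (λ i → boxFactor k (lookup (boxes (component k)) i)) ∎
        where
        m = size (component k)
        open CycleWeights K char0 (suc r) ζ ζ-primitive k τ
        open ShiftValue K char0 r ζ ζ-primitive k τ

      eval-contentProduct : eval τ (contentProduct Λ) ≈ ∏ (λ k → ∏ (λ i → boxFactor k (lookup (boxes (component k)) i)))
      eval-contentProduct = trans
        (eval-∏ₚ-tabulate τ (λ k → ∏ₚ (List.map (linear k) (boxes (component k)))))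
        (∏-cong (λ k → trans (eval-∏ₚ-map τ (linear k) (boxes (component k)))
          (∏-cong (λ i → eval-linear k (lookup (boxes (component k)) i)))))
        where
        linear : Fin (suc r) → Box → Poly
        linear k b = t +ₚ constant (shift k + (suc r ×ⁿ 1#) * content b)
        eval-linear : ∀ k b → eval τ (linear k b) ≈ boxFactor k b
        eval-linear k b = trans (eval-+ τ t (constant _)) (+-cong (eval-t τ) (eval-constant τ _))

    module _ {χ : G (suc r) n → Carrier} (induced : IsInduced Λ (outer Λ φ) χ) where
      open BlockSubgroup Λ using (allH)

      |H| |G| : Carrier
      |H| = length allH ×ⁿ 1#
      |G| = length (allG (suc r) n) ×ⁿ 1#

      -- This is χ(1) = [G : H] ∏ degrees without the division. It makes χ(1) invertible and later
      -- converts the factor |G| ∏ degrees into |H| χ(1).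
      degree-formula : |H| * χ 1ᴳ ≈ |G| * ∏ degree
      degree-formula = begin
        |H| * χ 1ᴳ                                                    ≈⟨ *-congˡ (sum-atIdentity Λ induced) ⟨
        |H| * sumOver (allG (suc r) n) (λ w → χ w * value atIdentity w)  ≈⟨ induced-sum Λ induced atIdentity ⟩
        |G| * sumOver allH _                                          ≈⟨ *-congˡ (outer-sum Λ φ atIdentity) ⟩
        |G| * ∏ (block Λ φ atIdentity)                                ≈⟨ *-congˡ (∏-cong block-atIdentity) ⟩
        |G| * ∏ degree                                                ∎

      χ1-unit : Unit (χ 1ᴳ)
      χ1-unit = unit-*ʳ (unit-cong (sym degree-formula)
        (unit-* (allG-unit Λ) (unit-∏ (λ k → dimension-unit (component k) char0 (char k)))))

      poincareSum : Carrier → Carrier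
      poincareSum τ = sumOver (allG (suc r) n) (λ w → χ w * τ ^ fixedDim w)

      -- Each block yields its degree times its content factors; the degrees combine with |G| to |H|
      -- χ(1), and |H| cancels.
      poincare-factors : Unit (1# + 1#) → ∀ τ → (∀ k → Unit (τ + shift k)) → poincareSum τ ≈ χ 1ᴳ * eval τ (contentProduct Λ)
      poincare-factors 2-unit τ s-unit = cancelˡ (allH-unit Λ) (begin
        |H| * poincareSum τ
          ≈⟨ induced-sum Λ induced (powerOfDimension τ) ⟩
        |G| * sumOver allH _
          ≈⟨ *-congˡ (outer-sum Λ φ (powerOfDimension τ)) ⟩
        |G| * ∏ (block Λ φ (powerOfDimension τ))
          ≈⟨ *-congˡ (trans (∏-cong (λ k → block-powerOfDimension 2-unit τ k (s-unit k)))
               (∏-distrib-* degree (λ k → ∏ (λ i → boxFactor 2-unit τ k (lookup (boxes (component k)) i))))) ⟩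
        |G| * (∏ degree * ∏ (λ k → ∏ (λ i → boxFactor 2-unit τ k (lookup (boxes (component k)) i))))
          ≈⟨ *-congˡ (*-congˡ (eval-contentProduct 2-unit τ)) ⟨
        |G| * (∏ degree * eval τ (contentProduct Λ))
          ≈⟨ *-assoc _ _ _ ⟨
        |G| * ∏ degree * eval τ (contentProduct Λ)
          ≈⟨ *-congʳ degree-formula ⟨
        |H| * χ 1ᴳ * eval τ (contentProduct Λ)
          ≈⟨ *-assoc _ _ _ ⟩
        |H| * (χ 1ᴳ * eval τ (contentProduct Λ)) ∎)

      -- The start 2 is the least integer from which t - 1 is positive. At 2 + m the values are 1 +
      -- m for k > 0 and 2 + m + r for k = 0, since the order of the roots is 1 + r here.
      shift-unit : ∀ m k → Unit (((2 ℕ.+ m) ×ⁿ 1#) + shift k)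
      shift-unit m zero = unit-cong
        (trans (×ⁿ-homo-+ 1# (2 ℕ.+ m) r) (+-congˡ (sym (trans (+-congʳ (+-comm 1# _)) (trans (+-assoc _ _ _) (trans (+-congˡ (-‿inverseʳ 1#)) (+-identityʳ _)))))))
        (unit (char0 (2 ℕ.+ m ℕ.+ r)))
      shift-unit m (suc _) = unit-cong
        (sym (trans (+-congʳ (+-comm 1# _)) (trans (+-assoc _ _ _) (trans (+-congˡ (-‿inverseʳ 1#)) (+-identityʳ _)))))
        (unit (char0 (suc m)))

      isPoincarePolynomial : IsPoincarePolynomial χ (contentProduct Λ)
      isPoincarePolynomial = fixedDim , hasDimension , χ1⁻¹ , χ1⁻¹χ1≈1 ,
        eval-injective char0 2 (contentProduct Λ) poincare λ { (suc (suc m)) _ → evaluate ((2 ℕ.+ m) ×ⁿ 1#) (shift-unit m) ; (suc zero) (ℕ.s≤s ()) ; zero () }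
        where
        χ1⁻¹ : Carrier
        χ1⁻¹ = proj₁ χ1-unit
        χ1⁻¹χ1≈1 : χ1⁻¹ * χ 1ᴳ ≈ 1#
        χ1⁻¹χ1≈1 = proj₂ χ1-unit
        poincare : Poly
        poincare = χ1⁻¹ ∙ₚ ∑ₚ (List.map (λ w → χ w ∙ₚ (t^ fixedDim w)) (allG (suc r) n))
        2-unit : Unit (1# + 1#)
        2-unit = unit-cong (+-congˡ (+-identityʳ 1#)) (unit (char0 2))
        evaluate : ∀ τ → (∀ k → Unit (τ + shift k)) →
          eval τ (contentProduct Λ) ≈ eval τ poincare
        evaluate τ s-unit = begin
          eval τ (contentProduct Λ)                        ≈⟨ *-identityˡ _ ⟨
          1# * eval τ (contentProduct Λ)                   ≈⟨ *-congʳ χ1⁻¹χ1≈1 ⟨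
          χ1⁻¹ * χ 1ᴳ * eval τ (contentProduct Λ)          ≈⟨ *-assoc _ _ _ ⟩
          χ1⁻¹ * (χ 1ᴳ * eval τ (contentProduct Λ))        ≈⟨ *-congˡ (poincare-factors 2-unit τ s-unit) ⟨
          χ1⁻¹ * poincareSum τ                             ≈⟨ *-congˡ (sumOver-cong (allG (suc r) n) (λ w →
                                                                trans (eval-∙ τ (χ w) (t^ fixedDim w)) (*-congˡ (eval-t^ τ (fixedDim w))))) ⟨
          χ1⁻¹ * sumOver (allG (suc r) n) (λ w → eval τ (χ w ∙ₚ (t^ fixedDim w)))
                                                           ≈⟨ *-congˡ (eval-∑ₚ τ (λ w → χ w ∙ₚ (t^ fixedDim w)) (allG (suc r) n)) ⟨
          χ1⁻¹ * eval τ (∑ₚ (List.map (λ w → χ w ∙ₚ (t^ fixedDim w)) (allG (suc r) n)))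
                                                           ≈⟨ eval-∙ τ χ1⁻¹ (∑ₚ (List.map (λ w → χ w ∙ₚ (t^ fixedDim w)) (allG (suc r) n))) ⟨
          eval τ poincare ∎

theorem6p3 : ∀ {c ℓ₁ ℓ₂} (K : HeytingField c ℓ₁ ℓ₂) → let open Over K in
    CharacteristicZero →
    ∀ (r n : ℕ) .{{_ : NonZero r}} .{{_ : NonZero n}} →
    ∀ (ζ : Carrier) → IsPrimitiveRoot r ζ → let open Reflection r ζ in
    ∀ (Λ : MultiPartition r n) (χ : G r n → Carrier) →
    IsIrreducibleCharacter Λ χ →
    IsPoincarePolynomial χ (contentProduct Λ)
theorem6p3 K char0 (suc r) n ζ ζ-primitive Λ χ (φ , char , induced) =
  Blocks.isPoincarePolynomial K char0 r ζ ζ-primitive Λ φ char induced
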